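{- Let $w_1\le w_2$ be non-negative integers. Define the finite set $\mathcal{S}_{w_1,w_2}$ of lattice triangles as follows. If $w_1>0$, then $\mathcal{S}_{w_1,w_2}$ consists of the triangles \begin{enumerate} \item $T((0,0),(w_1,y_1),(0,w_2))$ for integers $y_1\ge 0$ with $y_1\le r$, where $r\in\{0,\dots,w_1-1\}$ is the remainder of $w_2-y_1$ modulo $w_1$; \item $T((0,0),(w_1,y_1),(x_2,w_2))$ for integers $x_2,y_1$ with $0<x_2\le \frac{w_1}{2}$, $0\le y_1\le w_1-x_2$, and additionally $y_1\ge x_2$ if $w_1=w_2$; \item $T((0,y_0),(w_1,0),(x_2,w_2))$ for integers $x_2,y_0$ with $1<x_2<\frac{w_1}{2}$ and $0<y_0<x_2$, these triangles being included only when $w_1<w_2$; \end{enumerate} and if $w_1=0$ then $\mathcal{S}_{0,w_2}=\{T((0,0),(0,y_1),(0,w_2)) : y_1\in\mathbb{Z},\ 0\le y_1\le \frac{w_2}{2}\}$. Let $\mathcal{T}_{w_1,w_2}$ be the set of affine equivalence classes of lattice triangles $T$ with $\operatorname{width}^1(T)=w_1$ and $\operatorname{width}^2(T)=w_2$. Then the map sending $T\in\mathcal{S}_{w_1,w_2}$ to its affine equivalence class is a bijection $\mathcal{S}_{w_1,w_2}\to\mathcal{T}_{w_1,w_2}$. In particular, \[ |\mathcal{T}_{w_1,w_2}|=\begin{cases}\frac{w_1^2}{2}+2 & w_1,w_2\text{ even},\\ \frac{w_1^2}{2}+1 & w_1\text{ even}, w_2\text{ odd},\\ \frac{w_1^2}{2}+\frac12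 & w_1\text{ odd}\end{cases}\quad\text{when }0<w_1<w_2, \] \[ |\mathcal{T}_{w_1,w_1}|=\begin{cases}\frac{w_1^2}{4}+\frac{w_1}{2}+1 & w_1\text{ even},\\ \frac{w_1^2}{4}+\frac{w_1}{2}+\frac14 & w_1\text{ odd}\end{cases}\quad\text{when }0<w_1=w_2, \] and $|\mathcal{T}_{0,w_2}|=\left\lceil\frac{w_2+1}{2}\right\rceil$ for all $w_2\ge 0$.
   Context: A lattice triangle $T=T(v_1,v_2,v_3)$ is the convex hull of three points $v_1,v_2,v_3\in\mathbb{Z}^2$ (its vertices), which are recorded as a multiset; degenerate triangles (collinear or non-distinct vertices) are allowed. Two lattice triangles $T(v_1,v_2,v_3)$ and $T(v_1',v_2',v_3')$ are affine equivalent if there is a map $\varphi(x)=Ax+c$ with $A\in\mathrm{GL}_2(\mathbb{Z})$, $c\in\mathbb{Z}^2$, and a permutation $\sigma$ of $\{1,2,3\}$ with $\varphi(v_i)=v'_{\sigma(i)}$ for all $i$. For a lattice polytope $P\subseteq\mathbb{R}^2$ and $u\in(\mathbb{Z}^2)^*$, $\operatorname{width}_u(P)=\max_{x\in P}u\cdot x-\min_{x\in P}u\cdot x$. Choose linearly independent $u_1,u_2\in(\mathbb{Z}^2)^*$ such that the pair $(\operatorname{width}_{u_1}(P),\operatorname{width}_{u_2}(P))$ is minimal in lexicographic order; then $\operatorname{width}^1(P)=\operatorname{width}_{u_1}(P)$ (the first width) and $\operatorname{width}^2(P)=\operatorname{width}_{u_2}(P)$ (the second width). -}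

module Defs where

open import Data.Nat as ℕ using (ℕ; zero; suc)
open import Data.Integer as ℤ using (ℤ; +_; _+_; _-_; _*_; _⊔_; _⊓_; -_; 0ℤ; 1ℤ)
open import Data.Integer.DivMod using (_%ℕ_)
open import Data.Product using (Σ; ∃; ∃-syntax; _×_; _,_)
open import Data.Sum using (_⊎_)
open import Data.Fin using (Fin; zero; suc)
open import Data.Fin.Permutation using (Permutation′; _⟨$⟩ʳ_)
open import Data.List using (List; length; lookup)
open import Relation.Binary.PropositionalEquality using (_≡_; _≢_)

Point : Set
Point = ℤ × ℤ

Dual : Set
Dual = ℤ × ℤ

-- A lattice triangle T(v₁,v₂,v₃), recorded by its three vertices
-- (indexed by Fin 3; the multiset structure is handled by allowing
-- permutations wherever triangles are compared).  Degenerate allowed.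
Triangle : Set
Triangle = Fin 3 → Point

tri : Point → Point → Point → Triangle
tri a b c zero = a
tri a b c (suc zero) = b
tri a b c (suc (suc zero)) = c

SameTriangle : Triangle → Triangle → Set
SameTriangle T T' = Σ (Permutation′ 3) λ σ → (∀ i → T i ≡ T' (σ ⟨$⟩ʳ i))

_·_ : Dual → Point → ℤ
(a , b) · (x , y) = a * x + b * y

-- width_u(T) = max_{x∈T} u·x − min_{x∈T} u·x ; a linear functional attains
-- its max/min over the convex hull at a vertex.
width : Dual → Triangle → ℤ
width u T =
  ((u · T zero) ⊔ (u · T (suc zero)) ⊔ (u · T (suc (suc zero))))
  - ((u · T zero) ⊓ (u · T (suc zero)) ⊓ (u · T (suc (suc zero))))

LinIndep : Dual → Dual → Set
LinIndep (a , b) (c , d) = a * d - b * c ≢ 0ℤ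

LexLeq : ℤ × ℤ → ℤ × ℤ → Set
LexLeq (a , b) (c , d) = (a ℤ.< c) ⊎ ((a ≡ c) × (b ℤ.≤ d))

HasWidths : Triangle → ℕ → ℕ → Set
HasWidths T w₁ w₂ =
  (∃[ u₁ ] ∃[ u₂ ] (LinIndep u₁ u₂ × width u₁ T ≡ + w₁ × width u₂ T ≡ + w₂))
  × (∀ u₁ u₂ → LinIndep u₁ u₂ → LexLeq (+ w₁ , + w₂) (width u₁ T , width u₂ T))

record GL2Z : Set where
  field
    a b c d : ℤ
    unimodular : (a * d - b * c ≡ 1ℤ) ⊎ (a * d - b * c ≡ - 1ℤ)

affine : GL2Z → Point → Point → Point
affine A (t₁ , t₂) (x , y) = (a * x + b * y + t₁ , c * x + d * y + t₂)
  where open GL2Z A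

AffEquiv : Triangle → Triangle → Set
AffEquiv T T' =
  Σ GL2Z λ A → Σ Point λ t → Σ (Permutation′ 3) λ σ →
    (∀ i → affine A t (T i) ≡ T' (σ ⟨$⟩ʳ i))

-- The set 𝒮_{w₁,w₂} as an inductive membership predicate.
-- Constructors c1–c3 cover w₁ > 0 (written w₁ = suc k); c0 covers w₁ = 0.
-- Inequalities like x₂ ≤ w₁/2 are written as 2·x₂ ≤ w₁.
data 𝒮 : ℕ → ℕ → Triangle → Set where
  c1 : ∀ {k w₂} (y₁ : ℤ) →
       0ℤ ℤ.≤ y₁ → y₁ ℤ.≤ + ((+ w₂ - y₁) %ℕ suc k) →
       𝒮 (suc k) w₂ (tri (0ℤ , 0ℤ) (+ suc k , y₁) (0ℤ , + w₂))
  c2 : ∀ {k w₂} (x₂ y₁ : ℤ) →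
       0ℤ ℤ.< x₂ → + 2 * x₂ ℤ.≤ + suc k →
       0ℤ ℤ.≤ y₁ → y₁ ℤ.≤ + suc k - x₂ →
       (suc k ≡ w₂ → x₂ ℤ.≤ y₁) →
       𝒮 (suc k) w₂ (tri (0ℤ , 0ℤ) (+ suc k , y₁) (x₂ , + w₂))
  c3 : ∀ {k w₂} (x₂ y₀ : ℤ) →
       suc k ℕ.< w₂ →
       1ℤ ℤ.< x₂ → + 2 * x₂ ℤ.< + suc k →
       0ℤ ℤ.< y₀ → y₀ ℤ.< x₂ →
       𝒮 (suc k) w₂ (tri (0ℤ , y₀) (+ suc k , 0ℤ) (x₂ , + w₂))
  c0 : ∀ {w₂} (y₁ : ℤ) →
       0ℤ ℤ.≤ y₁ → + 2 * y₁ ℤ.≤ + w₂ →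
       𝒮 zero w₂ (tri (0ℤ , 0ℤ) (0ℤ , y₁) (0ℤ , + w₂))

ClassMapBijective : ℕ → ℕ → Set
ClassMapBijective w₁ w₂ =
  (∀ T → 𝒮 w₁ w₂ T → HasWidths T w₁ w₂)
  × (∀ T T' → 𝒮 w₁ w₂ T → 𝒮 w₁ w₂ T' → AffEquiv T T' → SameTriangle T T')
  × (∀ T → HasWidths T w₁ w₂ → Σ Triangle λ T' → 𝒮 w₁ w₂ T' × AffEquiv T T')

ClassCount : ℕ → ℕ → ℕ → Set
ClassCount w₁ w₂ N =
  Σ (List Triangle) λ L →
    (length L ≡ N)
    × (∀ i → HasWidths (lookup L i) w₁ w₂)
    × (∀ i j → AffEquiv (lookup L i) (lookup L j) → i ≡ j)
    × (∀ T → HasWidths T w₁ w₂ → Σ (Fin (length L)) λ i → AffEquiv T (lookup L i))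

{-# OPTIONS --safe #-}
-- The width of a triangle T in direction u is a seminorm in u. Minimal independent directions can be chosen to
-- form a lattice basis, so up to equivalence T sits in a w₁ × w₂ box and touches its four sides; having only
-- three vertices, T then has one at a corner of the box. Width at least w₂ in the directions (1,±1), together
-- with reflections, shears and (if w₁ = w₂) the transposition, leaves exactly the triangles of 𝒮.
-- They are pairwise inequivalent by two invariants: the area, and the position of the middle one of the three
-- values of u on T, for u of width w₁ or w₂.
module Submission where

open import Defs

-- Passing to a lattice basis rests on one estimate. Take `u₁` primitive and put `m = det u₁ u₂`.
-- For a suitable `k` with `0 ≤ k < |m|`, the vector `u₂ - k u₁` is `m` times a vector completing
-- `u₁` to a basis. Its width is at most `w₂ + (|m| - 1) w₁ ≤ |m| w₂`, so the completing vector has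
-- width at most `w₂`. Conversely, a normal form has the right widths once every direction outside
-- the line of `e₁` has width at least `w₂`. These are infinitely many inequalities, but a few sign
-- conditions on the direction select the two vertices that witness each of them. A vertical side of
-- full height is preserved by shears. Such triangles are therefore governed by residues modulo
-- `w₁`, and the area, constantly `w₁ w₂`, cannot separate them. For the other triangles the middle
-- values give the position of the apex, and the area gives the remaining parameter.

module Triangles where

  open import Data.Nat as ℕ using (ℕ; zero; suc)
  import Data.Nat.Properties as ℕ
  open import Data.Integer as ℤ
    using (ℤ; +_; -[1+_]; _+_; _-_; _*_; -_; _⊔_; _⊓_; _≤_; _<_; 0ℤ; 1ℤ; -1ℤ; ∣_∣; +≤+; +<+)
  import Data.Integer.Properties as ℤ
  open import Data.Integer.DivMod using (_%ℕ_; _/ℕ_; _%_; _/_; n%ℕd<d; n%d<d; a≡a%ℕn+[a/ℕn]*n; a≡a%n+[a/n]*n)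
  open import Data.Integer.Tactic.RingSolver using (solve; solve-∀)
  open import Data.Product using (Σ; ∃; ∃₂; _×_; _,_; proj₁; proj₂)
  open import Data.Sum using (_⊎_; inj₁; inj₂; [_,_]′)
  open import Data.Empty using (⊥; ⊥-elim)
  open import Data.Fin using (Fin; zero; suc)
  open import Data.Fin.Permutation using (Permutation′; _⟨$⟩ʳ_; _⟨$⟩ˡ_; inverseˡ; inverseʳ; _∘ₚ_; flip)
  import Data.Fin.Permutation as Perm
  open import Data.List using (List; []; _∷_; _++_; map; upTo; length; lookup)
  open import Data.List.Properties using (length-++; length-map; length-upTo)
  open import Data.List.Membership.Propositional using (_∈_)
  open import Data.List.Membership.Propositional.Properties using (∈-++⁻; ∈-++⁺ˡ; ∈-++⁺ʳ; ∈-map⁻; ∈-map⁺; ∈-upTo⁻; ∈-upTo⁺; ∈-lookup)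
  open import Data.List.Relation.Binary.Disjoint.Propositional using (Disjoint)
  open import Data.List.Relation.Unary.Any using (here; there)
  import Data.List.Relation.Unary.Any as Any using (index)
  import Data.List.Relation.Unary.Any.Properties as Any using (lookup-index)
  import Data.List.Relation.Unary.All as All using (lookup; tabulate)
  import Data.List.Relation.Unary.All.Properties as All using (map⁺)
  open import Data.List.Relation.Unary.AllPairs using ([]; _∷_)
  open import Data.List.Relation.Unary.Unique.Propositional using (Unique)
  import Data.List.Relation.Unary.Unique.Propositional.Properties as Unique
  import Data.Nat.DivMod as ℕ
  import Data.Nat.Tactic.RingSolver as ℕRing
  import Data.Fin.Properties as Fin
  open import Relation.Nullary using (¬_; Dec; yes; no; contradiction)
  open import Relation.Binary.PropositionalEquality
  open import Relation.Binary.Definitions using (tri<; tri≈; tri>)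
  open import Function using (_∘_)
  open import Data.Nat.Induction using (<-wellFounded)
  open import Induction.WellFounded using (Acc; acc)

  -- Inequalities are certified by nonnegative combinations p of the gaps of the hypotheses;
  -- the ring solver checks that p is the gap of the conclusion (or -1, for a contradiction).

  gap : ∀ {a b} → a ≤ b → 0ℤ ≤ b - a
  gap = ℤ.i≤j⇒0≤j-i

  gap< : ∀ {a b} → a < b → 0ℤ ≤ b - a - 1ℤ
  gap< {a} {b} a<b = subst (0ℤ ≤_) (rearrange a b) (gap (ℤ.i<j⇒suc[i]≤j a<b))
    where
    rearrange : ∀ a b → b - (1ℤ + a) ≡ b - a - 1ℤ
    rearrange = solve-∀

  gap≡ : ∀ {a b} → a ≡ b → 0ℤ ≤ b - a
  gap≡ = gap ∘ ℤ.≤-reflexive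

  infixl 6 _⊕_
  infixl 7 _⊗_

  _⊕_ : ∀ {p q} → 0ℤ ≤ p → 0ℤ ≤ q → 0ℤ ≤ p + q
  _⊕_ = ℤ.+-mono-≤

  _⊗_ : ∀ {p q} → 0ℤ ≤ p → 0ℤ ≤ q → 0ℤ ≤ p * q
  _⊗_ {p} {q} 0≤p 0≤q = subst (_≤ p * q) (ℤ.*-zeroʳ p) (ℤ.*-monoˡ-≤-nonNeg p {{ℤ.nonNegative 0≤p}} 0≤q)

  abstract
    ≤-by : ∀ {p a b} → 0ℤ ≤ p → p ≡ b - a → a ≤ b
    ≤-by 0≤p refl = ℤ.0≤i-j⇒j≤i 0≤p

  abstract
    <-by : ∀ {p a b} → 0ℤ ≤ p → p ≡ b - a - 1ℤ → a < b
    <-by {p} {a} {b} 0≤p eq = ℤ.suc[i]≤j⇒i<j (≤-by 0≤p (trans eq (rearrange a b)))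
      where
      rearrange : ∀ a b → b - a - 1ℤ ≡ b - (1ℤ + a)
      rearrange = solve-∀

  abstract
    absurd-by : ∀ {p} {A : Set} → 0ℤ ≤ p → p ≡ -1ℤ → A
    absurd-by () refl

  0≤+ : ∀ {n} → 0ℤ ≤ + n
  0≤+ = +≤+ ℕ.z≤n

  compare : ∀ a b → a < b ⊎ a ≡ b ⊎ b < a
  compare a b with ℤ.<-cmp a b
  ... | tri< a<b _ _ = inj₁ a<b
  ... | tri≈ _ a≡b _ = inj₂ (inj₁ a≡b)
  ... | tri> _ _ b<a = inj₂ (inj₂ b<a)

  ≤⊎> : ∀ a b → a ≤ b ⊎ b < a
  ≤⊎> a b with a ℤ.≤? b
  ... | yes a≤b = inj₁ a≤b
  ... | no a≰b = inj₂ (ℤ.≰⇒> a≰b)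

  -- The counterpart for equations: a combination, with arbitrary integer coefficients, of
  -- differences known to vanish.
  zero-gap : ∀ {a b} → a ≡ b → b - a ≡ 0ℤ
  zero-gap {a} refl = ℤ.+-inverseʳ a

  infixl 6 _⊞_
  infixr 7 _⊠_

  _⊞_ : ∀ {p q} → p ≡ 0ℤ → q ≡ 0ℤ → p + q ≡ 0ℤ
  refl ⊞ refl = refl

  _⊠_ : ∀ k {p} → p ≡ 0ℤ → k * p ≡ 0ℤ
  k ⊠ refl = ℤ.*-zeroʳ k

  abstract
    ≡-from : ∀ {p a b} → p ≡ 0ℤ → p ≡ b - a → a ≡ b
    ≡-from {_} {a} {b} p≡0 eq = sym (ℤ.i-j≡0⇒i≡j b a (trans (sym eq) p≡0))

  -- Affine equivalence and area

  infix 4 _≡±_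

  _≡±_ : ℤ → ℤ → Set
  a ≡± b = a ≡ b ⊎ a ≡ - b

  unit-* : ∀ {δ e} → δ ≡± 1ℤ → e ≡± 1ℤ → δ * e ≡± 1ℤ
  unit-* (inj₁ refl) (inj₁ refl) = inj₁ refl
  unit-* (inj₁ refl) (inj₂ refl) = inj₂ refl
  unit-* (inj₂ refl) (inj₁ refl) = inj₂ refl
  unit-* (inj₂ refl) (inj₂ refl) = inj₁ refl

  unit-scale : ∀ {δ} a → δ ≡± 1ℤ → δ * a ≡± a
  unit-scale a (inj₁ refl) = inj₁ (ℤ.*-identityˡ a)
  unit-scale a (inj₂ refl) = inj₂ (ℤ.-1*i≡-i a)

  ≡±-trans : ∀ {a b c} → a ≡± b → b ≡± c → a ≡± c
  ≡±-trans (inj₁ refl) b≡±c = b≡±c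
  ≡±-trans (inj₂ refl) (inj₁ refl) = inj₂ refl
  ≡±-trans {c = c} (inj₂ refl) (inj₂ refl) = inj₁ (ℤ.neg-involutive c)

  det : Dual → Dual → ℤ
  det (a , b) (c , d) = a * d - b * c

  abstract
    -- Kept abstract: comparing unfolded products of integers is exponentially expensive.
    cross : (x₀ y₀ x₁ y₁ x₂ y₂ : ℤ) → ℤ
    cross x₀ y₀ x₁ y₁ x₂ y₂ = (x₁ - x₀) * (y₂ - y₀) - (y₁ - y₀) * (x₂ - x₀)

    cross-expand : ∀ x₀ y₀ x₁ y₁ x₂ y₂ →
      cross x₀ y₀ x₁ y₁ x₂ y₂ ≡ (x₁ - x₀) * (y₂ - y₀) - (y₁ - y₀) * (x₂ - x₀)
    cross-expand _ _ _ _ _ _ = refl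

    cross-021 : ∀ x₀ y₀ x₁ y₁ x₂ y₂ → cross x₀ y₀ x₂ y₂ x₁ y₁ ≡ - cross x₀ y₀ x₁ y₁ x₂ y₂
    cross-021 = expand
      where
      expand : ∀ x₀ y₀ x₁ y₁ x₂ y₂ →
        (x₂ - x₀) * (y₁ - y₀) - (y₂ - y₀) * (x₁ - x₀)
        ≡ - ((x₁ - x₀) * (y₂ - y₀) - (y₁ - y₀) * (x₂ - x₀))
      expand = solve-∀

    cross-102 : ∀ x₀ y₀ x₁ y₁ x₂ y₂ → cross x₁ y₁ x₀ y₀ x₂ y₂ ≡ - cross x₀ y₀ x₁ y₁ x₂ y₂
    cross-102 = expand
      where
      expand : ∀ x₀ y₀ x₁ y₁ x₂ y₂ →
        (x₀ - x₁) * (y₂ - y₁) - (y₀ - y₁) * (x₂ - x₁)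
        ≡ - ((x₁ - x₀) * (y₂ - y₀) - (y₁ - y₀) * (x₂ - x₀))
      expand = solve-∀

    cross-120 : ∀ x₀ y₀ x₁ y₁ x₂ y₂ → cross x₁ y₁ x₂ y₂ x₀ y₀ ≡ cross x₀ y₀ x₁ y₁ x₂ y₂
    cross-120 = expand
      where
      expand : ∀ x₀ y₀ x₁ y₁ x₂ y₂ →
        (x₂ - x₁) * (y₀ - y₁) - (y₂ - y₁) * (x₀ - x₁)
        ≡ (x₁ - x₀) * (y₂ - y₀) - (y₁ - y₀) * (x₂ - x₀)
      expand = solve-∀

    cross-201 : ∀ x₀ y₀ x₁ y₁ x₂ y₂ → cross x₂ y₂ x₀ y₀ x₁ y₁ ≡ cross x₀ y₀ x₁ y₁ x₂ y₂
    cross-201 = expand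
      where
      expand : ∀ x₀ y₀ x₁ y₁ x₂ y₂ →
        (x₀ - x₂) * (y₁ - y₂) - (y₀ - y₂) * (x₁ - x₂)
        ≡ (x₁ - x₀) * (y₂ - y₀) - (y₁ - y₀) * (x₂ - x₀)
      expand = solve-∀

    cross-210 : ∀ x₀ y₀ x₁ y₁ x₂ y₂ → cross x₂ y₂ x₁ y₁ x₀ y₀ ≡ - cross x₀ y₀ x₁ y₁ x₂ y₂
    cross-210 = expand
      where
      expand : ∀ x₀ y₀ x₁ y₁ x₂ y₂ →
        (x₁ - x₂) * (y₀ - y₂) - (y₁ - y₂) * (x₀ - x₂)
        ≡ - ((x₁ - x₀) * (y₂ - y₀) - (y₁ - y₀) * (x₂ - x₀))
      expand = solve-∀

    cross-affine : ∀ a b c d t₁ t₂ x₀ y₀ x₁ y₁ x₂ y₂ →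
      cross (a * x₀ + b * y₀ + t₁) (c * x₀ + d * y₀ + t₂)
            (a * x₁ + b * y₁ + t₁) (c * x₁ + d * y₁ + t₂)
            (a * x₂ + b * y₂ + t₁) (c * x₂ + d * y₂ + t₂)
      ≡ (a * d - b * c) * cross x₀ y₀ x₁ y₁ x₂ y₂
    cross-affine a b c d t₁ t₂ x₀ y₀ x₁ y₁ x₂ y₂ = trans
      (cong₂ _-_ (cong₂ _*_ (difference a b t₁ x₁ y₁ x₀ y₀) (difference c d t₂ x₂ y₂ x₀ y₀))
                 (cong₂ _*_ (difference c d t₂ x₁ y₁ x₀ y₀) (difference a b t₁ x₂ y₂ x₀ y₀)))
      (product a b c d (x₁ - x₀) (y₁ - y₀) (x₂ - x₀) (y₂ - y₀))
      where
      difference : ∀ a b t x y x′ y′ → (a * x + b * y + t) - (a * x′ + b * y′ + t) ≡ a * (x - x′) + b * (y - y′)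
      difference = solve-∀
      product : ∀ a b c d p q r s → (a * p + b * q) * (c * r + d * s) - (c * p + d * q) * (a * r + b * s)
                                    ≡ (a * d - b * c) * (p * s - q * r)
      product = solve-∀

  -- Twice the signed area. Relabelling the vertices and maps of determinant -1 change its sign,
  -- hence the relation `≡±`.
  area : Triangle → ℤ
  area T = cross (proj₁ (T zero)) (proj₂ (T zero)) (proj₁ (T (suc zero))) (proj₂ (T (suc zero)))
                 (proj₁ (T (suc (suc zero)))) (proj₂ (T (suc (suc zero))))

  ∀₃ : ∀ {ℓ} {P : Fin 3 → Set ℓ} → P zero → P (suc zero) → P (suc (suc zero)) → ∀ i → P i
  ∀₃ p q r zero = p
  ∀₃ p q r (suc zero) = q
  ∀₃ p q r (suc (suc zero)) = r

  pattern #0 = zero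
  pattern #1 = suc zero
  pattern #2 = suc (suc zero)

  -- The six permutations as data, so that a statement about relabelled vertices splits into six
  -- concrete cases.
  data Arrangement : Fin 3 → Fin 3 → Fin 3 → Set where
    a012 : Arrangement #0 #1 #2
    a021 : Arrangement #0 #2 #1
    a102 : Arrangement #1 #0 #2
    a120 : Arrangement #1 #2 #0
    a201 : Arrangement #2 #0 #1
    a210 : Arrangement #2 #1 #0

  arrangement : ∀ i j k → i ≢ j → i ≢ k → j ≢ k → Arrangement i j k
  arrangement #0 #1 #2 _ _ _ = a012
  arrangement #0 #2 #1 _ _ _ = a021
  arrangement #1 #0 #2 _ _ _ = a102
  arrangement #1 #2 #0 _ _ _ = a120
  arrangement #2 #0 #1 _ _ _ = a201
  arrangement #2 #1 #0 _ _ _ = a210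
  arrangement #0 #0 _ i≢j _ _ = ⊥-elim (i≢j refl)
  arrangement #1 #1 _ i≢j _ _ = ⊥-elim (i≢j refl)
  arrangement #2 #2 _ i≢j _ _ = ⊥-elim (i≢j refl)
  arrangement #0 #1 #0 _ i≢k _ = ⊥-elim (i≢k refl)
  arrangement #0 #2 #0 _ i≢k _ = ⊥-elim (i≢k refl)
  arrangement #1 #0 #1 _ i≢k _ = ⊥-elim (i≢k refl)
  arrangement #1 #2 #1 _ i≢k _ = ⊥-elim (i≢k refl)
  arrangement #2 #0 #2 _ i≢k _ = ⊥-elim (i≢k refl)
  arrangement #2 #1 #2 _ i≢k _ = ⊥-elim (i≢k refl)
  arrangement #0 #1 #1 _ _ j≢k = ⊥-elim (j≢k refl)
  arrangement #0 #2 #2 _ _ j≢k = ⊥-elim (j≢k refl)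
  arrangement #1 #0 #0 _ _ j≢k = ⊥-elim (j≢k refl)
  arrangement #1 #2 #2 _ _ j≢k = ⊥-elim (j≢k refl)
  arrangement #2 #0 #0 _ _ j≢k = ⊥-elim (j≢k refl)
  arrangement #2 #1 #1 _ _ j≢k = ⊥-elim (j≢k refl)

  permuted : (σ : Permutation′ 3) → Arrangement (σ ⟨$⟩ʳ #0) (σ ⟨$⟩ʳ #1) (σ ⟨$⟩ʳ #2)
  permuted σ = arrangement _ _ _ (distinct λ ()) (distinct λ ()) (distinct λ ())
    where
    distinct : ∀ {i j} → i ≢ j → σ ⟨$⟩ʳ i ≢ σ ⟨$⟩ʳ j
    distinct i≢j eq = i≢j (trans (sym (inverseˡ σ)) (trans (cong (σ ⟨$⟩ˡ_) eq) (inverseˡ σ)))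

  area-arrange : ∀ T {i j k} → Arrangement i j k → area (tri (T i) (T j) (T k)) ≡± area T
  area-arrange T a012 = inj₁ refl
  area-arrange T a021 = inj₂ (cross-021 _ _ _ _ _ _)
  area-arrange T a102 = inj₂ (cross-102 _ _ _ _ _ _)
  area-arrange T a120 = inj₁ (cross-120 _ _ _ _ _ _)
  area-arrange T a201 = inj₁ (cross-201 _ _ _ _ _ _)
  area-arrange T a210 = inj₂ (cross-210 _ _ _ _ _ _)

  area-affine : ∀ A t T → area (affine A t ∘ T) ≡ (GL2Z.a A * GL2Z.d A - GL2Z.b A * GL2Z.c A) * area T
  area-affine A (t₁ , t₂) T = cross-affine (GL2Z.a A) (GL2Z.b A) (GL2Z.c A) (GL2Z.d A) t₁ t₂ _ _ _ _ _ _

  area-cong : ∀ T T′ → (∀ i → T i ≡ T′ i) → area T ≡ area T′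
  area-cong T T′ eq rewrite eq #0 | eq #1 | eq #2 = refl

  -- Equivalence of triangles as an equivalence relation

  infix 4 _≅_

  -- A record, so that the two triangles can be inferred from a proof.
  record _≅_ (T T′ : Triangle) : Set where
    constructor ⌈_⌉
    field ⌊_⌋ : AffEquiv T T′
  open _≅_

  area-invariant : ∀ {T T′} → T ≅ T′ → area T′ ≡± area T
  area-invariant {T} {T′} ⌈ A , t , σ , eq ⌉ = ≡±-trans (≡±-sym (area-arrange T′ (permuted σ))) moved
    where
    ≡±-sym : ∀ {a b} → a ≡± b → b ≡± a
    ≡±-sym (inj₁ refl) = inj₁ refl
    ≡±-sym {b = b} (inj₂ refl) = inj₂ (sym (ℤ.neg-involutive b))
    moved : area (tri (T′ (σ ⟨$⟩ʳ #0)) (T′ (σ ⟨$⟩ʳ #1)) (T′ (σ ⟨$⟩ʳ #2))) ≡± area T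
    moved = subst (_≡± area T)
      (trans (sym (area-affine A t T)) (area-cong (affine A t ∘ T) (tri (T′ (σ ⟨$⟩ʳ #0)) (T′ (σ ⟨$⟩ʳ #1)) (T′ (σ ⟨$⟩ʳ #2))) (∀₃ (eq #0) (eq #1) (eq #2))))
      (unit-scale (area T) (GL2Z.unimodular A))

  pair≡ : ∀ {p q p′ q′ : ℤ} → p ≡ p′ → q ≡ q′ → (p , q) ≡ (p′ , q′)
  pair≡ refl refl = refl

  -- The inverse matrix is the adjugate divided by the determinant; the two cases are the two signs
  -- of the determinant.
  affine-inverse : ∀ A t → Σ GL2Z λ B → Σ Point λ s → ∀ p → affine B s (affine A t p) ≡ p
  affine-inverse A (t₁ , t₂) = go unimodular
    where
    open GL2Z A
    go : a * d - b * c ≡± 1ℤ → Σ GL2Z λ B → Σ Point λ s → ∀ p → affine B s (affine A (t₁ , t₂) p) ≡ p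
    go (inj₁ δ≡1) = B , s , λ (x , y) → pair≡ (first x y) (second x y)
      where
      expand : ∀ a b c d → d * a - (- b) * (- c) ≡ a * d - b * c
      expand = solve-∀
      B : GL2Z
      B = record { a = d ; b = - b ; c = - c ; d = a ; unimodular = inj₁ (trans (expand a b c d) δ≡1) }
      s : Point
      s = - (d * t₁ - b * t₂) , - (a * t₂ - c * t₁)
      expand₁ : ∀ a b c d t₁ t₂ x y →
        d * (a * x + b * y + t₁) + (- b) * (c * x + d * y + t₂) + - (d * t₁ - b * t₂) ≡ (a * d - b * c) * x
      expand₁ = solve-∀
      expand₂ : ∀ a b c d t₁ t₂ x y →
        (- c) * (a * x + b * y + t₁) + a * (c * x + d * y + t₂) + - (a * t₂ - c * t₁) ≡ (a * d - b * c) * y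
      expand₂ = solve-∀
      first : ∀ x y → d * (a * x + b * y + t₁) + (- b) * (c * x + d * y + t₂) + - (d * t₁ - b * t₂) ≡ x
      first x y = trans (expand₁ a b c d t₁ t₂ x y) (trans (cong (_* x) δ≡1) (ℤ.*-identityˡ x))
      second : ∀ x y → (- c) * (a * x + b * y + t₁) + a * (c * x + d * y + t₂) + - (a * t₂ - c * t₁) ≡ y
      second x y = trans (expand₂ a b c d t₁ t₂ x y) (trans (cong (_* y) δ≡1) (ℤ.*-identityˡ y))
    go (inj₂ δ≡-1) = B , s , λ (x , y) → pair≡ (first x y) (second x y)
      where
      expand : ∀ a b c d → (- d) * (- a) - b * c ≡ a * d - b * c
      expand = solve-∀
      B : GL2Z
      B = record { a = - d ; b = b ; c = c ; d = - a ; unimodular = inj₂ (trans (expand a b c d) δ≡-1) }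
      s : Point
      s = d * t₁ - b * t₂ , a * t₂ - c * t₁
      negneg : ∀ x → - (- 1ℤ * x) ≡ x
      negneg = solve-∀
      expand₁ : ∀ a b c d t₁ t₂ x y →
        (- d) * (a * x + b * y + t₁) + b * (c * x + d * y + t₂) + (d * t₁ - b * t₂) ≡ - ((a * d - b * c) * x)
      expand₁ = solve-∀
      expand₂ : ∀ a b c d t₁ t₂ x y →
        c * (a * x + b * y + t₁) + (- a) * (c * x + d * y + t₂) + (a * t₂ - c * t₁) ≡ - ((a * d - b * c) * y)
      expand₂ = solve-∀
      first : ∀ x y → (- d) * (a * x + b * y + t₁) + b * (c * x + d * y + t₂) + (d * t₁ - b * t₂) ≡ x
      first x y = trans (expand₁ a b c d t₁ t₂ x y) (trans (cong (λ δ → - (δ * x)) δ≡-1) (negneg x))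
      second : ∀ x y → c * (a * x + b * y + t₁) + (- a) * (c * x + d * y + t₂) + (a * t₂ - c * t₁) ≡ y
      second x y = trans (expand₂ a b c d t₁ t₂ x y) (trans (cong (λ δ → - (δ * y)) δ≡-1) (negneg y))

  ≅-sym : ∀ {T T′} → T ≅ T′ → T′ ≅ T
  ≅-sym {T} {T′} ⌈ A , t , σ , eq ⌉ with affine-inverse A t
  ... | B , s , undo = ⌈ B , s , flip σ , (λ i → begin
    affine B s (T′ i)                               ≡⟨ cong (λ j → affine B s (T′ j)) (sym (inverseʳ σ)) ⟩
    affine B s (T′ (σ ⟨$⟩ʳ (σ ⟨$⟩ˡ i)))             ≡⟨ cong (affine B s) (sym (eq (σ ⟨$⟩ˡ i))) ⟩
    affine B s (affine A t (T (σ ⟨$⟩ˡ i)))          ≡⟨ undo (T (σ ⟨$⟩ˡ i)) ⟩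
    T (σ ⟨$⟩ˡ i)                                    ∎) ⌉
    where open ≡-Reasoning

  affine-compose : ∀ A t B s → Σ GL2Z λ C → Σ Point λ r → ∀ p → affine C r p ≡ affine B s (affine A t p)
  affine-compose A (t₁ , t₂) B (s₁ , s₂) = C , (row-shift B.a B.b s₁ , row-shift B.c B.d s₂) ,
    λ (x , y) → pair≡ (row A.a A.b A.c A.d t₁ t₂ B.a B.b s₁ x y) (row A.a A.b A.c A.d t₁ t₂ B.c B.d s₂ x y)
    where
    module A = GL2Z A
    module B = GL2Z B
    row-shift : ℤ → ℤ → ℤ → ℤ
    row-shift p q s = p * t₁ + q * t₂ + s
    expand : ∀ a b c d a′ b′ c′ d′ →
      (a′ * a + b′ * c) * (c′ * b + d′ * d) - (a′ * b + b′ * d) * (c′ * a + d′ * c)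
      ≡ (a * d - b * c) * (a′ * d′ - b′ * c′)
    expand = solve-∀
    C : GL2Z
    C = record
      { a = B.a * A.a + B.b * A.c ; b = B.a * A.b + B.b * A.d
      ; c = B.c * A.a + B.d * A.c ; d = B.c * A.b + B.d * A.d
      ; unimodular = subst (_≡± 1ℤ) (sym (expand A.a A.b A.c A.d B.a B.b B.c B.d))
          (unit-* A.unimodular B.unimodular) }
    row : ∀ a b c d t₁ t₂ p q s x y →
      (p * a + q * c) * x + (p * b + q * d) * y + (p * t₁ + q * t₂ + s)
      ≡ p * (a * x + b * y + t₁) + q * (c * x + d * y + t₂) + s
    row = solve-∀

  ≅-trans : ∀ {T T′ T″} → T ≅ T′ → T′ ≅ T″ → T ≅ T″
  ≅-trans {T} {T′} {T″} ⌈ A , t , σ , eq ⌉ ⌈ B , s , τ , eq′ ⌉ = go (affine-compose A t B s)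
    where
    step : ∀ i → affine B s (affine A t (T i)) ≡ T″ (τ ⟨$⟩ʳ (σ ⟨$⟩ʳ i))
    step i = trans (cong (affine B s) (eq i)) (eq′ (σ ⟨$⟩ʳ i))
    go : (Σ GL2Z λ C → Σ Point λ r → ∀ p → affine C r p ≡ affine B s (affine A t p)) → T ≅ T″
    go (C , r , composite) = ⌈ C , r , σ ∘ₚ τ , (λ i → trans (composite (T i)) (step i)) ⌉

  identity : GL2Z
  identity = record { a = 1ℤ ; b = 0ℤ ; c = 0ℤ ; d = 1ℤ ; unimodular = inj₁ refl }

  SameTriangle⇒≅ : ∀ T T′ → SameTriangle T T′ → T ≅ T′
  SameTriangle⇒≅ T T′ (σ , eq) = ⌈ identity , (0ℤ , 0ℤ) , σ , (λ i → trans (fixed (T i)) (eq i)) ⌉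
    where
    fixed : ∀ p → affine identity (0ℤ , 0ℤ) p ≡ p
    fixed (x , y) = pair≡ (fix₁ x y) (fix₂ x y)
      where
      fix₁ : ∀ x y → 1ℤ * x + 0ℤ * y + 0ℤ ≡ x
      fix₁ = solve-∀
      fix₂ : ∀ x y → 0ℤ * x + 1ℤ * y + 0ℤ ≡ y
      fix₂ = solve-∀

  ≅-refl : ∀ {T} → T ≅ T
  ≅-refl {T} = SameTriangle⇒≅ T T (Perm.id , λ i → refl)

  arranged : ∀ T {i j k} → Arrangement i j k → SameTriangle (tri (T i) (T j) (T k)) T
  arranged T a012 = Perm.id , ∀₃ refl refl refl
  arranged T a021 = Perm.transpose #1 #2 , ∀₃ refl refl refl
  arranged T a102 = Perm.transpose #0 #1 , ∀₃ refl refl refl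
  arranged T a120 = Perm.transpose #1 #2 ∘ₚ Perm.transpose #0 #1 , ∀₃ refl refl refl
  arranged T a201 = Perm.transpose #0 #1 ∘ₚ Perm.transpose #1 #2 , ∀₃ refl refl refl
  arranged T a210 = Perm.transpose #0 #2 , ∀₃ refl refl refl

  arrange : ∀ T {i j k} → Arrangement i j k → T ≅ tri (T i) (T j) (T k)
  arrange T {i} {j} {k} a = ≅-sym (SameTriangle⇒≅ (tri (T i) (T j) (T k)) T (arranged T a))

  third : ∀ i j → i ≢ j → ∃ λ k → Arrangement i j k
  third #0 #1 _ = #2 , a012
  third #0 #2 _ = #1 , a021
  third #1 #0 _ = #2 , a102
  third #1 #2 _ = #0 , a120
  third #2 #0 _ = #1 , a201
  third #2 #1 _ = #0 , a210
  third #0 #0 i≢i = ⊥-elim (i≢i refl)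
  third #1 #1 i≢i = ⊥-elim (i≢i refl)
  third #2 #2 i≢i = ⊥-elim (i≢i refl)

  move : ∀ A t {p q r p′ q′ r′} →
         affine A t p ≡ p′ → affine A t q ≡ q′ → affine A t r ≡ r′ →
         tri p q r ≅ tri p′ q′ r′
  move A t eq₀ eq₁ eq₂ = ⌈ A , t , Perm.id , ∀₃ eq₀ eq₁ eq₂ ⌉

  -- Widths

  -- A width together with the minimum, expressed by bounds and attaining vertices. Unlike the
  -- nested `⊔` and `⊓` of `width`, this form does not depend on the order of the vertices and moves
  -- directly along affine maps.
  record Range (T : Triangle) (u : Dual) (n w : ℤ) : Set where
    field
      lower   : ∀ i → n ≤ u · T i
      upper   : ∀ i → u · T i ≤ n + w
      lowest  : ∃ λ i → u · T i ≡ n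
      highest : ∃ λ i → u · T i ≡ n + w
  open Range

  -- m is the difference between the middle and the lowest value of u on T.
  record Profile (T : Triangle) (u : Dual) (w m : ℤ) : Set where
    field
      base  : ℤ
      range : Range T u base w
      total : u · T #0 + u · T #1 + u · T #2 ≡ + 3 * base + w + m
  open Profile

  Range-unique : ∀ {T u n w n′ w′} → Range T u n w → Range T u n′ w′ → n ≡ n′ × w ≡ w′
  Range-unique {T} {u} {n} {w} {n′} {w′} r r′ = n≡n′ , w≡w′
    where
    n≡n′ : n ≡ n′
    n≡n′ = ℤ.≤-antisym (subst (n ≤_) (proj₂ (lowest r′)) (lower r _))
                        (subst (n′ ≤_) (proj₂ (lowest r)) (lower r′ _))
    tops : n + w ≡ n′ + w′
    tops = ℤ.≤-antisym (subst (_≤ n′ + w′) (proj₂ (highest r)) (upper r′ _))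
                       (subst (_≤ n + w) (proj₂ (highest r′)) (upper r _))
    w≡w′ : w ≡ w′
    w≡w′ = ≡-from (zero-gap tops ⊞ zero-gap (sym n≡n′)) (solve (n ∷ w ∷ n′ ∷ w′ ∷ []))

  -- The range fixes `base` and the width, and then the sum of the three values fixes `m`. The sum
  -- is symmetric, so the middle vertex never has to be named.
  Profile-unique : ∀ {T u w m w′ m′} → Profile T u w m → Profile T u w′ m′ → m ≡ m′
  Profile-unique {T} {u} {w} {m} {w′} {m′} P P′ with base P | base P′ | Range-unique (range P) (range P′) | total P | total P′
  ... | n | .n | refl , refl | eq | eq′ = cancel n w m m′ (trans (sym eq) eq′)
    where
    cancel : ∀ n w m m′ → + 3 * n + w + m ≡ + 3 * n + w + m′ → m ≡ m′
    cancel n w m m′ eq = ≡-from (zero-gap eq) (solve (n ∷ w ∷ m ∷ m′ ∷ []))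

  Range-bound : ∀ {T u n w} → Range T u n w → ∀ i j → u · T i - u · T j ≤ w
  Range-bound {T} {u} {n} {w} r i j = bound (u · T i) (u · T j) (upper r i) (lower r j)
    where
    bound : ∀ p q → p ≤ n + w → n ≤ q → p - q ≤ w
    bound p q p≤ ≤q = ≤-by (gap p≤ ⊕ gap ≤q) (solve (p ∷ q ∷ n ∷ w ∷ []))

  Range-attained : ∀ {T u n w} → Range T u n w → ∃₂ λ i j → u · T i - u · T j ≡ w
  Range-attained {T} {u} {n} {w} r with highest r | lowest r
  ... | i , top | j , bottom = i , j , trans (cong₂ _-_ top bottom) (cancel n w)
    where
    cancel : ∀ n w → n + w - n ≡ w
    cancel = solve-∀

  width-range : ∀ T u → Range T u (u · T #0 ⊓ u · T #1 ⊓ u · T #2) (width u T)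
  width-range T u = record
    { lower = ∀₃ (ℤ.≤-trans (ℤ.i⊓j≤i (p ⊓ q) r) (ℤ.i⊓j≤i p q))
                 (ℤ.≤-trans (ℤ.i⊓j≤i (p ⊓ q) r) (ℤ.i⊓j≤j p q)) (ℤ.i⊓j≤j (p ⊓ q) r)
    ; upper = λ i → subst (u · T i ≤_) (sym (top (p ⊓ q ⊓ r) (p ⊔ q ⊔ r))) (below-max i)
    ; lowest = min-attained
    ; highest = proj₁ max-attained , trans (proj₂ max-attained) (sym (top (p ⊓ q ⊓ r) (p ⊔ q ⊔ r))) }
    where
    p = u · T #0
    q = u · T #1
    r = u · T #2
    top : ∀ n w → n + (w - n) ≡ w
    top = solve-∀
    below-max : ∀ i → u · T i ≤ p ⊔ q ⊔ r
    below-max = ∀₃ (ℤ.≤-trans (ℤ.i≤i⊔j p q) (ℤ.i≤i⊔j (p ⊔ q) r))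
                   (ℤ.≤-trans (ℤ.i≤j⊔i p q) (ℤ.i≤i⊔j (p ⊔ q) r)) (ℤ.i≤j⊔i (p ⊔ q) r)
    max-attained : ∃ λ i → u · T i ≡ p ⊔ q ⊔ r
    max-attained with ℤ.⊔-sel (p ⊔ q) r | ℤ.⊔-sel p q
    ... | inj₂ eq | _ = #2 , sym eq
    ... | inj₁ eq | inj₁ eq′ = #0 , sym (trans eq eq′)
    ... | inj₁ eq | inj₂ eq′ = #1 , sym (trans eq eq′)
    min-attained : ∃ λ i → u · T i ≡ p ⊓ q ⊓ r
    min-attained with ℤ.⊓-sel (p ⊓ q) r | ℤ.⊓-sel p q
    ... | inj₂ eq | _ = #2 , sym eq
    ... | inj₁ eq | inj₁ eq′ = #0 , sym (trans eq eq′)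
    ... | inj₁ eq | inj₂ eq′ = #1 , sym (trans eq eq′)

  Range⇒width : ∀ {T u n w} → Range T u n w → width u T ≡ w
  Range⇒width {T} {u} r = proj₂ (Range-unique (width-range T u) r)

  width⇒Range : ∀ {T u w} → width u T ≡ w → ∃ λ n → Range T u n w
  width⇒Range {T} {u} refl = _ , width-range T u

  ≤width : ∀ {T u w} i j → w ≤ u · T i - u · T j → w ≤ width u T
  ≤width {T} {u} i j w≤ = ℤ.≤-trans w≤ (Range-bound (width-range T u) i j)

  width-attained : ∀ T u → ∃₂ λ i j → u · T i - u · T j ≡ width u T
  width-attained T u = Range-attained (width-range T u)

  width≤ : ∀ {T u w} → (∀ i j → u · T i - u · T j ≤ w) → width u T ≤ w
  width≤ {T} {u} {w} bound =
    let (i , j , eq) = width-attained T u in subst (_≤ w) eq (bound i j)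

  neg : Dual → Dual
  neg (a , b) = - a , - b

  neg-· : ∀ u p → neg u · p ≡ - (u · p)
  neg-· (a , b) (x , y) = expand a b x y
    where
    expand : ∀ a b x y → - a * x + - b * y ≡ - (a * x + b * y)
    expand = solve-∀

  Range-neg : ∀ {T u n w} → Range T u n w → Range T (neg u) (- (n + w)) w
  Range-neg {T} {u} {n} {w} r = record
    { lower = λ i → subst (- (n + w) ≤_) (sym (neg-· u (T i))) (ℤ.neg-mono-≤ (upper r i))
    ; upper = λ i → subst₂ _≤_ (sym (neg-· u (T i))) (flip-top n w) (ℤ.neg-mono-≤ (lower r i))
    ; lowest = proj₁ (highest r) , trans (neg-· u (T _)) (cong -_ (proj₂ (highest r)))
    ; highest = proj₁ (lowest r) , trans (neg-· u (T _)) (trans (cong -_ (proj₂ (lowest r))) (flip-top n w)) }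
    where
    flip-top : ∀ n w → - n ≡ - (n + w) + w
    flip-top = solve-∀

  -- Negation reverses the order of the values, so the distance of the middle value from the top
  -- becomes its distance from the bottom.
  Profile-neg : ∀ {T u w m} → Profile T u w m → Profile T (neg u) w (w - m)
  Profile-neg {T} {u} {w} {m} P = record
    { base = - (n + w)
    ; range = Range-neg (range P)
    ; total = trans (cong₂ _+_ (cong₂ _+_ (neg-· u (T #0)) (neg-· u (T #1))) (neg-· u (T #2)))
        (negated (u · T #0) (u · T #1) (u · T #2) (total P)) }
    where
    n = base P
    negated : ∀ p q r → p + q + r ≡ + 3 * n + w + m → - p + - q + - r ≡ + 3 * (- (n + w)) + w + (w - m)
    negated p q r = lemma p q r n
      where
      lemma : ∀ p q r n → p + q + r ≡ + 3 * n + w + m → - p + - q + - r ≡ + 3 * (- (n + w)) + w + (w - m)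
      lemma p q r n eq = ≡-from (-1ℤ ⊠ zero-gap eq) (solve (p ∷ q ∷ r ∷ n ∷ w ∷ m ∷ []))

  total-arrange : (f : Fin 3 → ℤ) → ∀ {i j k} → Arrangement i j k → f #0 + f #1 + f #2 ≡ f i + f j + f k
  total-arrange f = λ where
      a012 → refl
      a021 → s021 (f #0) (f #1) (f #2)
      a102 → s102 (f #0) (f #1) (f #2)
      a120 → s120 (f #0) (f #1) (f #2)
      a201 → s201 (f #0) (f #1) (f #2)
      a210 → s210 (f #0) (f #1) (f #2)
    where
    s021 : ∀ p q r → p + q + r ≡ p + r + q
    s021 = solve-∀
    s102 : ∀ p q r → p + q + r ≡ q + p + r
    s102 = solve-∀
    s120 : ∀ p q r → p + q + r ≡ q + r + p
    s120 = solve-∀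
    s201 : ∀ p q r → p + q + r ≡ r + p + q
    s201 = solve-∀
    s210 : ∀ p q r → p + q + r ≡ r + q + p
    s210 = solve-∀

  sorted-profile : ∀ {T u i j k} → Arrangement i j k →
    u · T i ≤ u · T j → u · T j ≤ u · T k →
    Profile T u (u · T k - u · T i) (u · T j - u · T i)
  sorted-profile {T} {u} {i} {j} {k} a i≤j j≤k = record
    { base = u · T i
    ; range = record
      { lower = covers a (u · T i ≤_) ℤ.≤-refl i≤j (ℤ.≤-trans i≤j j≤k)
      ; upper = λ l → subst (u · T l ≤_) (sym (top (u · T i) (u · T k)))
          (covers a (_≤ u · T k) (ℤ.≤-trans i≤j j≤k) j≤k ℤ.≤-refl l)
      ; lowest = i , refl
      ; highest = k , sym (top (u · T i) (u · T k)) }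
    ; total = trans (total-arrange (λ l → u · T l) a) (expand (u · T i) (u · T j) (u · T k)) }
    where
    top : ∀ n w → n + (w - n) ≡ w
    top = solve-∀
    expand : ∀ p q r → p + q + r ≡ + 3 * p + (r - p) + (q - p)
    expand = solve-∀
    covers : ∀ {i j k} → Arrangement i j k → (P : ℤ → Set) →
             P (u · T i) → P (u · T j) → P (u · T k) → ∀ l → P (u · T l)
    covers a012 P p q r = ∀₃ p q r
    covers a021 P p q r = ∀₃ p r q
    covers a102 P p q r = ∀₃ q p r
    covers a120 P p q r = ∀₃ r p q
    covers a201 P p q r = ∀₃ q r p
    covers a210 P p q r = ∀₃ r q p

  -- The arrangement lists the vertices from the lowest value to the highest; `a021`, for instance,
  -- makes vertex `#2` the middle one.
  profile₃ : ∀ {T u n w m i j k} → Arrangement i j k →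
    u · T i ≡ n → u · T j ≡ n + m → u · T k ≡ n + w → 0ℤ ≤ m → m ≤ w → Profile T u w m
  profile₃ {T} {u} {n} {w} {m} {i} {j} {k} a refl eqⱼ eqₖ 0≤m m≤w =
    subst₂ (Profile T u) (trans (cong (_- n) eqₖ) (cancel n w)) (trans (cong (_- n) eqⱼ) (cancel n m))
      (sorted-profile {T} {u} a (subst (n ≤_) (sym eqⱼ) (low n m 0≤m))
        (subst₂ _≤_ (sym eqⱼ) (sym eqₖ) (ℤ.+-monoʳ-≤ n m≤w)))
    where
    cancel : ∀ n w → n + w - n ≡ w
    cancel = solve-∀
    low : ∀ n m → 0ℤ ≤ m → n ≤ n + m
    low n m 0≤m = ≤-by 0≤m (solve (n ∷ m ∷ []))

  -- All that an equivalence does to a single functional: along a relabelling, its values change by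
  -- a constant. Ranges, middle values and widths are transported from this alone.
  record Pullback (T T′ : Triangle) (u u′ : Dual) : Set where
    field
      shift : ℤ
      perm  : Permutation′ 3
      agree : ∀ i → u′ · T′ (perm ⟨$⟩ʳ i) ≡ u · T i + shift
  open Pullback

  Range-pull : ∀ {T T′ u u′ n w} (p : Pullback T T′ u u′) → Range T′ u′ n w → Range T u (n - shift p) w
  Range-pull {T} {T′} {u} {u′} {n} {w} p r = record
    { lower = λ i → down (u · T i) s n (subst (n ≤_) (agree p i) (lower r (σ ⟨$⟩ʳ i)))
    ; upper = λ i → up (u · T i) s n (subst (_≤ n + w) (agree p i) (upper r (σ ⟨$⟩ʳ i)))
    ; lowest = σ ⟨$⟩ˡ proj₁ (lowest r) ,
        back (u · T _) s n (trans (sym (agree p _)) (trans (cong (λ j → u′ · T′ j) (inverseʳ σ)) (proj₂ (lowest r))))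
    ; highest = σ ⟨$⟩ˡ proj₁ (highest r) ,
        back′ (u · T _) s n (trans (sym (agree p _)) (trans (cong (λ j → u′ · T′ j) (inverseʳ σ)) (proj₂ (highest r)))) }
    where
    σ = perm p
    s = shift p
    down : ∀ v s n → n ≤ v + s → n - s ≤ v
    down v s n h = ≤-by (gap h) (solve (v ∷ s ∷ n ∷ []))
    up : ∀ v s n → v + s ≤ n + w → v ≤ n - s + w
    up v s n h = ≤-by (gap h) (solve (v ∷ s ∷ n ∷ w ∷ []))
    back : ∀ v s n → v + s ≡ n → v ≡ n - s
    back v s n h = ≡-from (zero-gap h) (solve (v ∷ s ∷ n ∷ []))
    back′ : ∀ v s n → v + s ≡ n + w → v ≡ n - s + w
    back′ v s n h = ≡-from (zero-gap h) (solve (v ∷ s ∷ n ∷ w ∷ []))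

  Profile-pull : ∀ {T T′ u u′ w m} → Pullback T T′ u u′ → Profile T′ u′ w m → Profile T u w m
  Profile-pull {T} {T′} {u} {u′} {w} {m} p P = record
    { base = base P - shift p
    ; range = Range-pull p (range P)
    ; total = moved (u · T #0) (u · T #1) (u · T #2) (base P) (shift p)
        (trans (sym (trans (total-arrange (λ l → u′ · T′ l) (permuted (perm p)))
          (cong₂ _+_ (cong₂ _+_ (agree p #0) (agree p #1)) (agree p #2)))) (total P)) }
    where
    moved : ∀ x y z n s → x + s + (y + s) + (z + s) ≡ + 3 * n + w + m → x + y + z ≡ + 3 * (n - s) + w + m
    moved x y z n s h = ≡-from (zero-gap h) (solve (x ∷ y ∷ z ∷ n ∷ s ∷ w ∷ m ∷ []))

  width-pull : ∀ {T T′ u u′} → Pullback T T′ u u′ → width u T ≡ width u′ T′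
  width-pull {T} {T′} {u} {u′} p = Range⇒width (Range-pull p (width-range T′ u′))

  pull : GL2Z → Dual → Dual
  pull A (p , q) = p * GL2Z.a A + q * GL2Z.c A , p * GL2Z.b A + q * GL2Z.d A

  pullback : ∀ {T T′} (e : T ≅ T′) u → Pullback T T′ (pull (proj₁ ⌊ e ⌋) u) u
  pullback {T} {T′} ⌈ A , (t₁ , t₂) , σ , eq ⌉ (p , q) = record
    { shift = p * t₁ + q * t₂
    ; perm = σ
    ; agree = λ i → trans (cong ((p , q) ·_) (sym (eq i)))
        (expand p q a b c d t₁ t₂ (proj₁ (T i)) (proj₂ (T i))) }
    where
    open GL2Z A
    expand : ∀ p q a b c d t₁ t₂ x y →
      p * (a * x + b * y + t₁) + q * (c * x + d * y + t₂) ≡ (p * a + q * c) * x + (p * b + q * d) * y + (p * t₁ + q * t₂)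
    expand = solve-∀

  det-pull : ∀ A u v → det (pull A u) (pull A v) ≡± det u v
  det-pull A (p , q) (r , s) = subst (_≡± (p * s - q * r)) (sym (expand p q r s a b c d))
    (unit-scale (p * s - q * r) unimodular)
    where
    open GL2Z A
    expand : ∀ p q r s a b c d →
      (p * a + q * c) * (r * b + s * d) - (p * b + q * d) * (r * a + s * c) ≡ (a * d - b * c) * (p * s - q * r)
    expand = solve-∀

  LinIndep-pull : ∀ A u v → LinIndep u v → LinIndep (pull A u) (pull A v)
  LinIndep-pull A u v indep eq = indep (vanish (det-pull A u v) eq)
    where
    vanish : ∀ {a b} → a ≡± b → a ≡ 0ℤ → b ≡ 0ℤ
    vanish (inj₁ refl) eq = eq
    vanish {b = b} (inj₂ refl) eq = ℤ.neg-injective eq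

  -- The realising pair is carried to `T′` by the inverse equivalence, while a competing pair on
  -- `T′` is pulled back along `e` to a competing pair on `T`.
  HasWidths-invariant : ∀ {T T′} → T ≅ T′ → ∀ {w₁ w₂} → HasWidths T w₁ w₂ → HasWidths T′ w₁ w₂
  HasWidths-invariant {T} {T′} e {w₁} {w₂} ((u₁ , u₂ , indep , eq₁ , eq₂) , minimal) =
    (pull B u₁ , pull B u₂ , LinIndep-pull B u₁ u₂ indep ,
      trans (width-pull (pullback e⁻¹ u₁)) eq₁ , trans (width-pull (pullback e⁻¹ u₂)) eq₂) ,
    λ v₁ v₂ indep′ → subst₂ (λ x y → LexLeq (+ w₁ , + w₂) (x , y))
      (width-pull (pullback e v₁)) (width-pull (pullback e v₂))
      (minimal (pull A v₁) (pull A v₂) (LinIndep-pull A v₁ v₂ indep′))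
    where
    e⁻¹ : T′ ≅ T
    e⁻¹ = ≅-sym e
    A B : GL2Z
    A = proj₁ ⌊ e ⌋
    B = proj₁ ⌊ e⁻¹ ⌋

  -- Widths of the triangles of 𝒮

  e₁ e₂ : Dual
  e₁ = 1ℤ , 0ℤ
  e₂ = 0ℤ , 1ℤ

  -- A certificate that the width in direction `u` is at least `w`: two vertices take the place of a
  -- maximum and a minimum.
  Spread : Triangle → ℤ → Dual → Set
  Spread T w u = ∃₂ λ i j → w ≤ u · T i - u · T j

  Spread-neg : ∀ {T w u} → Spread T w (neg u) → Spread T w u
  Spread-neg {T} {w} {u} (i , j , h) = j , i ,
    subst (w ≤_) (trans (cong₂ _-_ (neg-· u (T i)) (neg-· u (T j))) (swap (u · T i) (u · T j))) h
    where
    swap : ∀ p q → - p - - q ≡ q - p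
    swap = solve-∀

  off-axis : ∀ {T w} → (∀ a b → 0ℤ < b → Spread T w (a , b)) → ∀ a b → b ≢ 0ℤ → w ≤ width (a , b) T
  off-axis {T} {w} spread a b b≢0 = ≤width {T} {a , b} (proj₁ s) (proj₁ (proj₂ s)) (proj₂ (proj₂ s))
    where
    s : Spread T w (a , b)
    s with compare b 0ℤ
    ... | inj₁ b<0 = Spread-neg {T} {w} {a , b} (spread (- a) (- b) (ℤ.neg-mono-< b<0))
    ... | inj₂ (inj₁ b≡0) = ⊥-elim (b≢0 b≡0)
    ... | inj₂ (inj₂ 0<b) = spread a b 0<b

  -- The direction `(a , 0)` has width `|a| w₁`, and every other one has width at least `w₂`. Two
  -- independent directions are not both multiples of `e₁`, so no pair beats `e₁ , e₂`
  -- lexicographically.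
  widths-from : ∀ {T w₁ w₂ n₁ n₂} → w₁ ℕ.≤ w₂ → Range T e₁ n₁ (+ w₁) → Range T e₂ n₂ (+ w₂) →
    (∀ a b → 0ℤ < b → Spread T (+ w₂) (a , b)) → HasWidths T w₁ w₂
  widths-from {T} {w₁} {w₂} w₁≤w₂ r₁ r₂ spread =
    (e₁ , e₂ , (λ ()) , Range⇒width r₁ , Range⇒width r₂) , minimal
    where
    on-axis : ∀ a → a ≢ 0ℤ → + w₁ ≤ width (a , 0ℤ) T
    on-axis a a≢0 = go (compare a 0ℤ)
      where
      i j : Fin 3
      i = proj₁ (Range-attained r₁)
      j = proj₁ (proj₂ (Range-attained r₁))
      eq : e₁ · T i - e₁ · T j ≡ + w₁
      eq = proj₂ (proj₂ (Range-attained r₁))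
      above : ∀ p q w → 0ℤ ≤ w → 0ℤ < a → p - q ≡ w → w ≤ a * p - a * q
      above p q w 0≤w 0<a eq =
        ≤-by (gap< 0<a ⊗ 0≤w ⊕ gap≡ (cong (a *_) (sym eq))) (solve (a ∷ p ∷ q ∷ w ∷ []))
      below : ∀ p q w → 0ℤ ≤ w → a < 0ℤ → p - q ≡ w → w ≤ a * q - a * p
      below p q w 0≤w a<0 eq =
        ≤-by (gap< a<0 ⊗ 0≤w ⊕ gap≡ (cong (a *_) eq)) (solve (a ∷ p ∷ q ∷ w ∷ []))
      scale : ∀ p → (a , 0ℤ) · p ≡ a * (e₁ · p)
      scale (x , y) = expand a x y
        where
        expand : ∀ a x y → a * x + 0ℤ * y ≡ a * (1ℤ * x + 0ℤ * y)
        expand = solve-∀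
      go : a < 0ℤ ⊎ a ≡ 0ℤ ⊎ 0ℤ < a → + w₁ ≤ width (a , 0ℤ) T
      go (inj₁ a<0) = ≤width {T} {a , 0ℤ} j i (subst (+ w₁ ≤_) (sym (cong₂ _-_ (scale (T j)) (scale (T i))))
        (below (e₁ · T i) (e₁ · T j) (+ w₁) 0≤+ a<0 eq))
      go (inj₂ (inj₁ a≡0)) = ⊥-elim (a≢0 a≡0)
      go (inj₂ (inj₂ 0<a)) = ≤width {T} {a , 0ℤ} i j (subst (+ w₁ ≤_) (sym (cong₂ _-_ (scale (T i)) (scale (T j))))
        (above (e₁ · T i) (e₁ · T j) (+ w₁) 0≤+ 0<a eq))
    at-least-w₁ : ∀ u → u ≢ (0ℤ , 0ℤ) → + w₁ ≤ width u T
    at-least-w₁ (a , b) u≢0 with b ℤ.≟ 0ℤ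
    ... | yes refl = on-axis a (λ { refl → u≢0 refl })
    ... | no b≢0 = ℤ.≤-trans (+≤+ w₁≤w₂) (off-axis spread a b b≢0)
    lex : ∀ {w w′} → + w₁ ≤ w → (w ≡ + w₁ → + w₂ ≤ w′) → LexLeq (+ w₁ , + w₂) (w , w′)
    lex {w} w₁≤w h with compare (+ w₁) w
    ... | inj₁ w₁<w = inj₁ w₁<w
    ... | inj₂ (inj₁ w₁≡w) = inj₂ (w₁≡w , h (sym w₁≡w))
    ... | inj₂ (inj₂ w<w₁) = ⊥-elim (ℤ.<⇒≱ w<w₁ w₁≤w)
    collinear : ∀ a c → a * 0ℤ - 0ℤ * c ≡ 0ℤ
    collinear = solve-∀
    zeroˡ : ∀ c d → 0ℤ * d - 0ℤ * c ≡ 0ℤ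
    zeroˡ = solve-∀
    zeroʳ : ∀ a b → a * 0ℤ - b * 0ℤ ≡ 0ℤ
    zeroʳ = solve-∀
    minimal : ∀ u v → LinIndep u v → LexLeq (+ w₁ , + w₂) (width u T , width v T)
    minimal (a , b) (c , d) indep = lex (at-least-w₁ (a , b) u≢0) second
      where
      u≢0 : (a , b) ≢ (0ℤ , 0ℤ)
      u≢0 refl = indep (zeroˡ c d)
      v≢0 : (c , d) ≢ (0ℤ , 0ℤ)
      v≢0 refl = indep (zeroʳ a b)
      second : width (a , b) T ≡ + w₁ → + w₂ ≤ width (c , d) T
      second eq with b ℤ.≟ 0ℤ
      ... | yes refl = off-axis spread c d (λ { refl → indep (collinear a c) })
      -- The first direction lies off the axis and still has width `w₁`, so `w₂ ≤ w₁`, and `w₁`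
      -- bounds the width of every nonzero direction from below.
      ... | no b≢0 = ℤ.≤-trans (subst (+ w₂ ≤_) eq (off-axis spread a b b≢0)) (at-least-w₁ (c , d) v≢0)

  e₁-· : ∀ x y → e₁ · (x , y) ≡ 0ℤ + x
  e₁-· x y = expand x y
    where
    expand : ∀ x y → 1ℤ * x + 0ℤ * y ≡ 0ℤ + x
    expand = solve-∀

  e₂-· : ∀ x y → e₂ · (x , y) ≡ 0ℤ + y
  e₂-· x y = expand x y
    where
    expand : ∀ x y → 0ℤ * x + 1ℤ * y ≡ 0ℤ + y
    expand = solve-∀

  -- `corner` gives `c2`, the family `c1` at `x = 0`, and `c0` at `W = x = 0`; `cut` gives `c3`. The
  -- occupied corner of the box is `(0 , 0)` in the first shape and `(W , 0)` in the second.
  corner cut : (W H x y : ℤ) → Triangle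
  corner W H x y = tri (0ℤ , 0ℤ) (W , y) (x , H)
  cut W H x y = tri (0ℤ , y) (W , 0ℤ) (x , H)

  corner-profile₁ : ∀ {W H x y} → 0ℤ ≤ x → x ≤ W → Profile (corner W H x y) e₁ W x
  corner-profile₁ {W} {H} {x} {y} = profile₃ {corner W H x y} {e₁} a021 refl (e₁-· x H) (e₁-· W y)

  corner-profile₂ : ∀ {W H x y} → 0ℤ ≤ y → y ≤ H → Profile (corner W H x y) e₂ H y
  corner-profile₂ {W} {H} {x} {y} = profile₃ {corner W H x y} {e₂} a012 refl (e₂-· W y) (e₂-· x H)

  cut-profile₁ : ∀ {W H x y} → 0ℤ ≤ x → x ≤ W → Profile (cut W H x y) e₁ W x
  cut-profile₁ {W} {H} {x} {y} = profile₃ {cut W H x y} {e₁} a021 (e₁-· 0ℤ y) (e₁-· x H) (e₁-· W 0ℤ)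

  cut-profile₂ : ∀ {W H x y} → 0ℤ ≤ y → y ≤ H → Profile (cut W H x y) e₂ H y
  cut-profile₂ {W} {H} {x} {y} = profile₃ {cut W H x y} {e₂} a102 (e₂-· W 0ℤ) (e₂-· 0ℤ y) (e₂-· x H)

  edge-spread : ∀ {W H y} → 0ℤ ≤ H → ∀ a b → 0ℤ < b → Spread (corner W H 0ℤ y) H (a , b)
  edge-spread {W} {H} {y} 0≤H a b 0<b = #2 , #0 , bound
    where
    bound : H ≤ a * 0ℤ + b * H - (a * 0ℤ + b * 0ℤ)
    bound = ≤-by (gap< 0<b ⊗ 0≤H) (solve (a ∷ b ∷ H ∷ []))

  -- For `a > - b` the values at `#2` and `#0` differ by `a x + b H ≥ H`. For `a ≤ - b` vertex `#1`
  -- replaces `#0`: the difference `- a (W - x) + b (H - y)` is at least `b (H + W - x - y)`, and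
  -- `x + y ≤ W` makes this at least `H`.
  corner-spread : ∀ {W H x y} → W ≤ H → 0ℤ ≤ x → 0ℤ ≤ y → x + y ≤ W →
                  ∀ a b → 0ℤ < b → Spread (corner W H x y) H (a , b)
  corner-spread {W} {H} {x} {y} W≤H 0≤x 0≤y x+y≤W a b 0<b with ≤⊎> 0ℤ a | ≤⊎> (a + b) 0ℤ
  ... | inj₁ 0≤a | _ = #2 , #0 , bound
    where
    bound : H ≤ a * x + b * H - (a * 0ℤ + b * 0ℤ)
    -- The four gaps in the bracket telescope to `H`.
    bound = ≤-by (gap 0≤a ⊗ 0≤x ⊕ gap< 0<b ⊗ (gap W≤H ⊕ gap x+y≤W ⊕ 0≤x ⊕ 0≤y)) (solve (a ∷ b ∷ W ∷ H ∷ x ∷ y ∷ []))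
  ... | inj₂ a<0 | inj₁ a+b≤0 = #2 , #1 , bound
    where
    bound : H ≤ a * x + b * H - (a * W + b * y)
    bound = ≤-by (gap< 0<b ⊗ (gap W≤H ⊕ gap x+y≤W ⊕ 0≤x ⊕ 0≤y) ⊕ gap a+b≤0 ⊗ (gap x+y≤W ⊕ 0≤y)
      ⊕ gap (ℤ.<⇒≤ 0<b) ⊗ gap x+y≤W) (solve (a ∷ b ∷ W ∷ H ∷ x ∷ y ∷ []))
  ... | inj₂ a<0 | inj₂ 0<a+b = #2 , #0 , bound
    where
    bound : H ≤ a * x + b * H - (a * 0ℤ + b * 0ℤ)
    bound = ≤-by (gap< 0<a+b ⊗ (gap W≤H ⊕ gap x+y≤W ⊕ 0≤x ⊕ 0≤y) ⊕ gap (ℤ.<⇒≤ a<0) ⊗ (gap W≤H ⊕ gap x+y≤W ⊕ 0≤y))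
      (solve (a ∷ b ∷ W ∷ H ∷ x ∷ y ∷ []))

  -- For `a < b` the values at `#2` and `#1` are far enough apart. For `a ≥ b` those at `#2` and
  -- `#0` are: `a x + b (H - y) ≥ b (H + x - y)`, and `y ≤ x`.
  cut-spread : ∀ {W H x y} → W ≤ H → 0ℤ ≤ x → x ≤ W → y ≤ x →
               ∀ a b → 0ℤ < b → Spread (cut W H x y) H (a , b)
  cut-spread {W} {H} {x} {y} W≤H 0≤x x≤W y≤x a b 0<b with ≤⊎> a 0ℤ | ≤⊎> b a
  ... | inj₁ a≤0 | _ = #2 , #1 , bound
    where
    bound : H ≤ a * x + b * H - (a * W + b * 0ℤ)
    bound = ≤-by (gap< 0<b ⊗ (gap W≤H ⊕ gap x≤W ⊕ 0≤x) ⊕ gap a≤0 ⊗ gap x≤W) (solve (a ∷ b ∷ W ∷ H ∷ x ∷ []))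
  ... | inj₂ 0<a | inj₁ b≤a = #2 , #0 , bound
    where
    bound : H ≤ a * x + b * H - (a * 0ℤ + b * y)
    bound = ≤-by (gap< 0<b ⊗ (gap W≤H ⊕ gap x≤W ⊕ 0≤x) ⊕ gap b≤a ⊗ 0≤x ⊕ gap (ℤ.<⇒≤ 0<b) ⊗ gap y≤x)
      (solve (a ∷ b ∷ W ∷ H ∷ x ∷ y ∷ []))
  ... | inj₂ 0<a | inj₂ a<b = #2 , #1 , bound
    where
    bound : H ≤ a * x + b * H - (a * W + b * 0ℤ)
    bound = ≤-by (gap< a<b ⊗ (gap W≤H ⊕ gap x≤W ⊕ 0≤x) ⊕ gap (ℤ.<⇒≤ 0<a) ⊗ (gap W≤H ⊕ 0≤x)) (solve (a ∷ b ∷ W ∷ H ∷ x ∷ []))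

  c1-bound : ∀ {k w₂ y} → y ≤ + ((+ w₂ - y) %ℕ suc k) → y < + suc k
  c1-bound {k} {w₂} {y} y≤r = ℤ.≤-<-trans y≤r (+<+ (n%ℕd<d (+ w₂ - y) (suc k)))

  double-bound : ∀ {x W} → 0ℤ ≤ x → + 2 * x ≤ W → x ≤ W
  double-bound {x} {W} 0≤x 2x≤W = ≤-by (0≤x ⊕ gap 2x≤W) (solve (x ∷ W ∷ []))

  𝒮⇒HasWidths : ∀ {w₁ w₂} → w₁ ℕ.≤ w₂ → ∀ T → 𝒮 w₁ w₂ T → HasWidths T w₁ w₂
  𝒮⇒HasWidths {_} {w₂} w₁≤w₂ _ (c1 {k} y 0≤y y≤r) = widths-from w₁≤w₂
    (range (corner-profile₁ {y = y} ℤ.≤-refl 0≤+))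
    (range (corner-profile₂ {W = + suc k} 0≤y (ℤ.≤-trans (ℤ.<⇒≤ (c1-bound y≤r)) (+≤+ w₁≤w₂))))
    (edge-spread {y = y} 0≤+)
  𝒮⇒HasWidths {_} {w₂} w₁≤w₂ _ (c2 {k} x y 0<x 2x≤W 0≤y y≤W-x _) = widths-from w₁≤w₂
    (range (corner-profile₁ {y = y} 0≤x (double-bound 0≤x 2x≤W)))
    (range (corner-profile₂ {W = + suc k} {x = x} 0≤y (ℤ.≤-trans (bounded 0≤x y≤W-x) (+≤+ w₁≤w₂))))
    (corner-spread (+≤+ w₁≤w₂) 0≤x 0≤y (summed (+ suc k) y≤W-x))
    where
    0≤x = ℤ.<⇒≤ 0<x
    bounded : ∀ {W} → 0ℤ ≤ x → y ≤ W - x → y ≤ W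
    bounded {W} 0≤x h = ≤-by (0≤x ⊕ gap h) (solve (x ∷ y ∷ W ∷ []))
    summed : ∀ W → y ≤ W - x → x + y ≤ W
    summed W h = ≤-by (gap h) (solve (x ∷ y ∷ W ∷ []))
  𝒮⇒HasWidths {_} {w₂} w₁≤w₂ _ (c3 {k} x y w₁<w₂ 1<x 2x<W 0<y y<x) = widths-from w₁≤w₂
    (range (cut-profile₁ {y = y} 0≤x x≤W))
    (range (cut-profile₂ {W = + suc k} {x = x} (ℤ.<⇒≤ 0<y) (ℤ.≤-trans (ℤ.<⇒≤ y<x) (ℤ.≤-trans x≤W (+≤+ w₁≤w₂)))))
    (cut-spread (+≤+ w₁≤w₂) 0≤x x≤W (ℤ.<⇒≤ y<x))
    where
    0≤x : 0ℤ ≤ x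
    0≤x = ℤ.≤-trans (ℤ.<⇒≤ 0<y) (ℤ.<⇒≤ y<x)
    x≤W : x ≤ + suc k
    x≤W = double-bound 0≤x (ℤ.<⇒≤ 2x<W)
  𝒮⇒HasWidths {_} {w₂} w₁≤w₂ _ (c0 y 0≤y 2y≤H) = widths-from w₁≤w₂
    (range (corner-profile₁ {y = y} ℤ.≤-refl ℤ.≤-refl))
    (range (corner-profile₂ {W = 0ℤ} 0≤y (double-bound 0≤y 2y≤H)))
    (edge-spread {y = y} 0≤+)

  -- Lattice bases realising the widths

  -- Bézout data: `(p , q)` is a primitive vector on the line of `(a , b)`, and `(r , s)` completes
  -- it to a lattice basis. The factor `g` may have either sign.
  record Primitive (a b : ℤ) : Set where
    field
      g p q r s : ℤ
      a≡gp : a ≡ g * p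
      b≡gq : b ≡ g * q
      basis : p * s - q * r ≡ 1ℤ

  -- Euclid's algorithm `(a , b) ↦ (b , a % b)`, undone on the way back. Undoing one division has
  -- determinant -1; negating the completing vector restores determinant 1.
  factorise : ∀ a b → Primitive a b
  factorise a b = go a b (<-wellFounded ∣ b ∣)
    where
    go : ∀ a b → Acc ℕ._<_ ∣ b ∣ → Primitive a b
    go a b (acc rec) with b ℤ.≟ 0ℤ
    ... | yes refl = record
      { g = a ; p = 1ℤ ; q = 0ℤ ; r = 0ℤ ; s = 1ℤ
      ; a≡gp = sym (ℤ.*-identityʳ a) ; b≡gq = sym (ℤ.*-zeroʳ a) ; basis = refl }
    ... | no b≢0 = record
      { g = g ; p = t * p + q ; q = p ; r = - (t * r) - s ; s = - r
      ; a≡gp = dividend a b (+ (a % b)) t g p q (a≡a%n+[a/n]*n a b) a≡gp b≡gq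
      ; b≡gq = a≡gp ; basis = trans (expand t p q r s) basis }
      where
      instance
        b-nonZero : ℤ.NonZero b
        b-nonZero = ℤ.≢-nonZero b≢0
      t = a / b
      open Primitive (go b (+ (a % b)) (rec (n%d<d a b)))
      dividend : ∀ a b c t g p q → a ≡ c + t * b → b ≡ g * p → c ≡ g * q → a ≡ g * (t * p + q)
      dividend a b c t g p q eq eq₁ eq₂ =
        ≡-from (zero-gap eq ⊞ t ⊠ zero-gap eq₁ ⊞ zero-gap eq₂) (solve (a ∷ b ∷ c ∷ t ∷ g ∷ p ∷ q ∷ []))
      expand : ∀ t p q r s → (t * p + q) * (- r) - p * (- (t * r) - s) ≡ p * s - q * r
      expand = solve-∀

  shrink : ∀ {g D w} → g ≢ 0ℤ → 0ℤ ≤ w → g * D ≤ w → - (g * D) ≤ w → D ≤ w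
  shrink {g} {D} {w} g≢0 0≤w gD≤w -gD≤w = go (≤⊎> D w) (compare g 0ℤ)
    where
    go : D ≤ w ⊎ w < D → g < 0ℤ ⊎ g ≡ 0ℤ ⊎ 0ℤ < g → D ≤ w
    go (inj₁ D≤w) _ = D≤w
    go (inj₂ w<D) (inj₂ (inj₁ g≡0)) = ⊥-elim (g≢0 g≡0)
    go (inj₂ w<D) (inj₂ (inj₂ 0<g)) =
      absurd-by (gap< 0<g ⊗ (gap< w<D ⊕ 0≤w ⊕ 0≤+ {1}) ⊕ gap< w<D ⊕ gap gD≤w) (solve (g ∷ D ∷ w ∷ []))
    go (inj₂ w<D) (inj₁ g<0) =
      absurd-by (gap< g<0 ⊗ (gap< w<D ⊕ 0≤w ⊕ 0≤+ {1}) ⊕ gap< w<D ⊕ gap -gD≤w) (solve (g ∷ D ∷ w ∷ []))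

  -- If m D = D₂ − k D₁ with 0 ≤ k < |m|, then |D| ≤ (w₂ + k w₁) / |m| ≤ w₂.
  reduce : ∀ {m k D₁ D₂ D w₁ w₂} → m ≢ 0ℤ → 0ℤ ≤ w₂ → w₁ ≤ w₂ → 0ℤ ≤ k → k < + ∣ m ∣ →
    D₁ ≤ w₁ → - D₁ ≤ w₁ → D₂ ≤ w₂ → - D₂ ≤ w₂ → m * D ≡ D₂ - k * D₁ → D ≤ w₂
  reduce {m} {k} {D₁} {D₂} {D} {w₁} {w₂} m≢0 0≤w₂ w₁≤w₂ 0≤k k<∣m∣ D₁≤ -D₁≤ D₂≤ -D₂≤ eq = go (≤⊎> D w₂) (compare m 0ℤ)
    where
    go : D ≤ w₂ ⊎ w₂ < D → m < 0ℤ ⊎ m ≡ 0ℤ ⊎ 0ℤ < m → D ≤ w₂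
    go (inj₁ D≤w₂) _ = D≤w₂
    go (inj₂ w₂<D) (inj₂ (inj₁ m≡0)) = ⊥-elim (m≢0 m≡0)
    go (inj₂ w₂<D) (inj₂ (inj₂ 0<m)) = absurd-by
      (gap (ℤ.<⇒≤ 0<m) ⊗ gap< w₂<D ⊕ gap D₂≤ ⊕ 0≤k ⊗ gap -D₁≤ ⊕ 0≤k ⊗ gap w₁≤w₂ ⊕ gap< k<m ⊗ 0≤w₂ ⊕ gap< 0<m ⊕ gap≡ eq)
      (solve (m ∷ k ∷ D₁ ∷ D₂ ∷ D ∷ w₁ ∷ w₂ ∷ []))
      where
      k<m : k < m
      k<m = subst (k <_) (ℤ.0≤i⇒+∣i∣≡i (ℤ.<⇒≤ 0<m)) k<∣m∣
    go (inj₂ w₂<D) (inj₁ m<0) = absurd-by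
      (gap (ℤ.<⇒≤ m<0) ⊗ gap< w₂<D ⊕ gap -D₂≤ ⊕ 0≤k ⊗ gap D₁≤ ⊕ 0≤k ⊗ gap w₁≤w₂ ⊕ gap< k<-m ⊗ 0≤w₂ ⊕ gap< m<0 ⊕ gap≡ (sym eq))
      (solve (m ∷ k ∷ D₁ ∷ D₂ ∷ D ∷ w₁ ∷ w₂ ∷ []))
      where
      k<-m : k < - m
      k<-m = subst (k <_) (trans (cong +_ (sym (ℤ.∣-i∣≡∣i∣ m))) (ℤ.0≤i⇒+∣i∣≡i (ℤ.neg-mono-≤ (ℤ.<⇒≤ m<0)))) k<∣m∣

  width-bounds : ∀ {T u w} → width u T ≡ w → ∀ i j →
    u · T i - u · T j ≤ w × - (u · T i - u · T j) ≤ w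
  width-bounds {T} {u} {w} refl i j =
    Range-bound (width-range T u) i j ,
    subst (_≤ w) (swap (u · T j) (u · T i)) (Range-bound (width-range T u) j i)
    where
    swap : ∀ p q → p - q ≡ - (q - p)
    swap = solve-∀

  Minimal : Triangle → ℕ → ℕ → Set
  Minimal T w₁ w₂ = ∀ u v → LinIndep u v → LexLeq (+ w₁ , + w₂) (width u T , width v T)

  -- Widths scale by `|g|` and `g` is nonzero, so `(p , q)` is no wider than `(a , b)`. Minimality,
  -- tested against the same second direction, turns this into equality.
  primitive-width : ∀ {T w₁ w₂ a b c d} (f : Primitive a b) → let open Primitive f in
    Minimal T w₁ w₂ → LinIndep (a , b) (c , d) → width (a , b) T ≡ + w₁ →
    LinIndep (p , q) (c , d) × width (p , q) T ≡ + w₁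
  primitive-width {T} {w₁} {w₂} {a} {b} {c} {d}
    record { g = g ; p = p ; q = q ; a≡gp = a≡gp ; b≡gq = b≡gq } minimal indep eq =
    m≢0 , exact (minimal (p , q) (c , d) m≢0)
    where
    factor : ∀ a b c d g p q → a ≡ g * p → b ≡ g * q → a * d - b * c ≡ g * (p * d - q * c)
    factor a b c d g p q refl refl = expand c d g p q
      where
      expand : ∀ c d g p q → g * p * d - g * q * c ≡ g * (p * d - q * c)
      expand = solve-∀
    det≡ : a * d - b * c ≡ g * (p * d - q * c)
    det≡ = factor a b c d g p q a≡gp b≡gq
    m≢0 : p * d - q * c ≢ 0ℤ
    m≢0 m≡0 = indep (trans det≡ (trans (cong (g *_) m≡0) (ℤ.*-zeroʳ g)))
    g≢0 : g ≢ 0ℤ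
    g≢0 g≡0 = indep (trans det≡ (trans (cong (_* (p * d - q * c)) g≡0) (ℤ.*-zeroˡ (p * d - q * c))))
    scale : ∀ a b g p q x y x′ y′ → a ≡ g * p → b ≡ g * q →
      a * x + b * y - (a * x′ + b * y′) ≡ g * (p * x + q * y - (p * x′ + q * y′))
    scale a b g p q x y x′ y′ refl refl = expand g p q x y x′ y′
      where
      expand : ∀ g p q x y x′ y′ →
        g * p * x + g * q * y - (g * p * x′ + g * q * y′) ≡ g * (p * x + q * y - (p * x′ + q * y′))
      expand = solve-∀
    bound : ∀ i j → (p , q) · T i - (p , q) · T j ≤ + w₁
    bound i j = shrink g≢0 0≤+ (subst (_≤ + w₁) D≡ (proj₁ bounds)) (subst (λ D → - D ≤ + w₁) D≡ (proj₂ bounds))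
      where
      bounds = width-bounds {T} {a , b} eq i j
      D≡ : (a , b) · T i - (a , b) · T j ≡ g * ((p , q) · T i - (p , q) · T j)
      D≡ = scale a b g p q (proj₁ (T i)) (proj₂ (T i)) (proj₁ (T j)) (proj₂ (T j)) a≡gp b≡gq
    exact : LexLeq (+ w₁ , + w₂) (width (p , q) T , width (c , d) T) → width (p , q) T ≡ + w₁
    exact (inj₁ w₁<) = ⊥-elim (ℤ.<⇒≱ w₁< (width≤ {T} {p , q} bound))
    exact (inj₂ (w₁≡ , _)) = sym w₁≡

  -- In the basis `(p , q) , (r , s)` the vector `(c , d)` has coordinates `c s - d r` and
  -- `m = p d - q c`. Dividing the former by `m` shows that `(c , d) - k (p , q)` is `m` times
  -- `(r + t p , s + t q)`. Then `reduce` bounds the width of that vector by `w₂`, and minimality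
  -- gives the reverse bound.
  basis-width : ∀ {T w₁ w₂ p q r s c d k t} → w₁ ℕ.≤ w₂ → Minimal T w₁ w₂ →
    p * s - q * r ≡ 1ℤ → p * d - q * c ≢ 0ℤ →
    width (p , q) T ≡ + w₁ → width (c , d) T ≡ + w₂ →
    0ℤ ≤ k → k < + ∣ p * d - q * c ∣ → c * s - d * r ≡ k + t * (p * d - q * c) →
    p * (s + t * q) - q * (r + t * p) ≡ 1ℤ × width (r + t * p , s + t * q) T ≡ + w₂
  basis-width {T} {w₁} {w₂} {p} {q} {r} {s} {c} {d} {k} {t} w₁≤w₂ minimal basis m≢0 eq₁ eq₂ 0≤k k<∣m∣ division =
    basis′ , ℤ.≤-antisym (width≤ {T} {r + t * p , s + t * q} bound)
      (exact (minimal (p , q) (r + t * p , s + t * q) independent))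
    where
    basis′ : p * (s + t * q) - q * (r + t * p) ≡ 1ℤ
    basis′ = trans (expand p q r s t) basis
      where
      expand : ∀ p q r s t → p * (s + t * q) - q * (r + t * p) ≡ p * s - q * r
      expand = solve-∀
    independent : LinIndep (p , q) (r + t * p , s + t * q)
    independent eq = contradiction (trans (sym basis′) eq) λ ()
    exact : LexLeq (+ w₁ , + w₂) (width (p , q) T , width (r + t * p , s + t * q) T) →
            + w₂ ≤ width (r + t * p , s + t * q) T
    exact (inj₁ w₁<) = ⊥-elim (ℤ.<-irrefl (sym eq₁) w₁<)
    exact (inj₂ (_ , w₂≤)) = w₂≤
    relation : ∀ p q r s c d k t x y x′ y′ → p * s - q * r ≡ 1ℤ → c * s - d * r ≡ k + t * (p * d - q * c) →
      (p * d - q * c) * ((r + t * p) * x + (s + t * q) * y - ((r + t * p) * x′ + (s + t * q) * y′))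
      ≡ c * x + d * y - (c * x′ + d * y′) - k * (p * x + q * y - (p * x′ + q * y′))
    relation p q r s c d k t x y x′ y′ eq eq′ = ≡-from
      ((c * (x - x′) + d * (y - y′)) ⊠ zero-gap eq ⊞ (- (p * (x - x′) + q * (y - y′))) ⊠ zero-gap eq′)
      (solve (p ∷ q ∷ r ∷ s ∷ c ∷ d ∷ k ∷ t ∷ x ∷ y ∷ x′ ∷ y′ ∷ []))
    bound : ∀ i j → (r + t * p , s + t * q) · T i - (r + t * p , s + t * q) · T j ≤ + w₂
    bound i j = reduce m≢0 0≤+ (+≤+ w₁≤w₂) 0≤k k<∣m∣
      (proj₁ bounds₁) (proj₂ bounds₁) (proj₁ bounds₂) (proj₂ bounds₂)
      (relation p q r s c d k t (proj₁ (T i)) (proj₂ (T i)) (proj₁ (T j)) (proj₂ (T j)) basis division)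
      where
      bounds₁ = width-bounds {T} {p , q} eq₁ i j
      bounds₂ = width-bounds {T} {c , d} eq₂ i j

  align : ∀ T {p q r s} {w₁ w₂ : ℤ} → p * s - q * r ≡ 1ℤ → width (p , q) T ≡ w₁ → width (r , s) T ≡ w₂ →
    ∃ λ T′ → T ≅ T′ × width e₁ T′ ≡ w₁ × width e₂ T′ ≡ w₂
  align T {p} {q} {r} {s} basis eq₁ eq₂ =
    T′ , e , trans (sym (width-pull agree₁)) eq₁ , trans (sym (width-pull agree₂)) eq₂
    where
    A : GL2Z
    A = record { a = p ; b = q ; c = r ; d = s ; unimodular = inj₁ basis }
    T′ : Triangle
    T′ = affine A (0ℤ , 0ℤ) ∘ T
    e : T ≅ T′
    e = ⌈ A , (0ℤ , 0ℤ) , Perm.id , (λ i → refl) ⌉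
    expand₁ : ∀ p q r s x y → 1ℤ * (p * x + q * y + 0ℤ) + 0ℤ * (r * x + s * y + 0ℤ) ≡ p * x + q * y + 0ℤ
    expand₁ = solve-∀
    expand₂ : ∀ p q r s x y → 0ℤ * (p * x + q * y + 0ℤ) + 1ℤ * (r * x + s * y + 0ℤ) ≡ r * x + s * y + 0ℤ
    expand₂ = solve-∀
    agree₁ : Pullback T T′ (p , q) e₁
    agree₁ = record { shift = 0ℤ ; perm = Perm.id ; agree = λ i → expand₁ p q r s (proj₁ (T i)) (proj₂ (T i)) }
    agree₂ : Pullback T T′ (r , s) e₂
    agree₂ = record { shift = 0ℤ ; perm = Perm.id ; agree = λ i → expand₂ p q r s (proj₁ (T i)) (proj₂ (T i)) }

  axis-aligned : ∀ {T w₁ w₂} → w₁ ℕ.≤ w₂ → HasWidths T w₁ w₂ →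
    ∃ λ T′ → T ≅ T′ × width e₁ T′ ≡ + w₁ × width e₂ T′ ≡ + w₂
  axis-aligned {T} {w₁} {w₂} w₁≤w₂ (((a , b) , (c , d) , indep , eq₁ , eq₂) , minimal) = go (factorise a b)
    where
    go : Primitive a b → ∃ λ T′ → T ≅ T′ × width e₁ T′ ≡ + w₁ × width e₂ T′ ≡ + w₂
    go f = divide (+ ((c * s - d * r) % m)) ((c * s - d * r) / m)
      0≤+ (+<+ (n%d<d (c * s - d * r) m)) (a≡a%n+[a/n]*n (c * s - d * r) m)
      where
      open Primitive f
      m : ℤ
      m = p * d - q * c
      first : LinIndep (p , q) (c , d) × width (p , q) T ≡ + w₁
      first = primitive-width {T} f minimal indep eq₁
      instance
        m-nonZero : ℤ.NonZero m
        m-nonZero = ℤ.≢-nonZero (proj₁ first)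
      divide : ∀ k t → 0ℤ ≤ k → k < + ∣ p * d - q * c ∣ → c * s - d * r ≡ k + t * (p * d - q * c) →
        ∃ λ T′ → T ≅ T′ × width e₁ T′ ≡ + w₁ × width e₂ T′ ≡ + w₂
      divide k t 0≤k k<∣m∣ division = align T {p} {q} {r + t * p} {s + t * q} (proj₁ second) (proj₂ first) (proj₂ second)
        where
        second : p * (s + t * q) - q * (r + t * p) ≡ 1ℤ × width (r + t * p , s + t * q) T ≡ + w₂
        second = basis-width {T} {w₁} {w₂} {p} {q} {r} {s} {c} {d} {k} {t} w₁≤w₂ minimal basis
          (proj₁ first) (proj₂ first) eq₂ 0≤k k<∣m∣ division

  -- Triangles in a box

  Range-arrange : ∀ {T u n w i j k} → Arrangement i j k → Range T u n w → Range (tri (T i) (T j) (T k)) u n w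
  Range-arrange {T} {u} {n} {w} {i} {j} {k} a r =
    subst (λ n → Range T′ u n w) (ℤ.+-identityʳ n) (Range-pull relabel r)
    where
    T′ = tri (T i) (T j) (T k)
    σ = arranged T a
    relabel : Pullback T′ T u u
    relabel = record { shift = 0ℤ ; perm = proj₁ σ
      ; agree = λ l → trans (cong (u ·_) (sym (proj₂ σ l))) (sym (ℤ.+-identityʳ (u · T′ l))) }

  e₁-coordinate : ∀ p → e₁ · p ≡ proj₁ p
  e₁-coordinate (x , y) = trans (e₁-· x y) (ℤ.+-identityˡ x)

  e₂-coordinate : ∀ p → e₂ · p ≡ proj₂ p
  e₂-coordinate (x , y) = trans (e₂-· x y) (ℤ.+-identityˡ y)

  -- End n w z s: z is an end of the interval [n , n + w], and s is the direction from it into the interval.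
  data End (n w z : ℤ) : ℤ → Set where
    low  : z ≡ n → End n w z 1ℤ
    high : z ≡ n + w → End n w z (- 1ℤ)

  End-unit : ∀ {n w z s} → End n w z s → s ≡± 1ℤ
  End-unit (low _) = inj₁ refl
  End-unit (high _) = inj₂ refl

  End-depth : ∀ {n w z s} x → End n w z s → n ≤ x → x ≤ n + w → 0ℤ ≤ s * (x - z) × s * (x - z) ≤ w
  End-depth {n} {w} x (low refl) n≤x x≤n+w =
    ≤-by (gap n≤x) (solve (n ∷ x ∷ [])) , ≤-by (gap x≤n+w) (solve (n ∷ w ∷ x ∷ []))
  End-depth {n} {w} x (high refl) n≤x x≤n+w =
    ≤-by (gap x≤n+w) (solve (n ∷ w ∷ x ∷ [])) , ≤-by (gap n≤x) (solve (n ∷ w ∷ x ∷ []))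

  End-opposite : ∀ {n w z z′ s} → End n w z s → End n w z′ (- s) → s * (z′ - z) ≡ w
  End-opposite {n} {w} (low refl) (high refl) = expand n w
    where
    expand : ∀ n w → 1ℤ * (n + w - n) ≡ w
    expand = solve-∀
  End-opposite {n} {w} (high refl) (low refl) = expand n w
    where
    expand : ∀ n w → - 1ℤ * (n - (n + w)) ≡ w
    expand = solve-∀

  -- If `a` is a corner of a box and the signs point from it into the box, the new coordinates are
  -- distances from the two sides through `a`.
  reframe : ∀ {s₁ s₂} → s₁ ≡± 1ℤ → s₂ ≡± 1ℤ → ∀ a b c →
    let place = λ (p : Point) → s₁ * (proj₁ p - proj₁ a) , s₂ * (proj₂ p - proj₂ a) in
    tri a b c ≅ tri (0ℤ , 0ℤ) (place b) (place c)
  reframe {s₁} {s₂} unit₁ unit₂ (x , y) (x₁ , y₁) (x₂ , y₂) =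
    move A (- (s₁ * x) , - (s₂ * y))
      (pair≡ (origin s₁ x y) (origin′ s₂ x y))
      (pair≡ (first s₁ x₁ y₁ x) (second s₂ x₁ y₁ y)) (pair≡ (first s₁ x₂ y₂ x) (second s₂ x₂ y₂ y))
    where
    expand : ∀ s₁ s₂ → s₁ * s₂ ≡ s₁ * s₂ - 0ℤ * 0ℤ
    expand = solve-∀
    A : GL2Z
    A = record { a = s₁ ; b = 0ℤ ; c = 0ℤ ; d = s₂ ; unimodular = subst (_≡± 1ℤ) (expand s₁ s₂) (unit-* unit₁ unit₂) }
    origin : ∀ s x y → s * x + 0ℤ * y + - (s * x) ≡ 0ℤ
    origin = solve-∀
    origin′ : ∀ s x y → 0ℤ * x + s * y + - (s * y) ≡ 0ℤ
    origin′ = solve-∀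
    first : ∀ s x₁ y₁ x → s * x₁ + 0ℤ * y₁ + - (s * x) ≡ s * (x₁ - x)
    first = solve-∀
    second : ∀ s x₁ y₁ y → 0ℤ * x₁ + s * y₁ + - (s * y) ≡ s * (y₁ - y)
    second = solve-∀

  Boxed : (ℤ → ℤ → ℤ → ℤ → Triangle) → ℤ → ℤ → Triangle → Set
  Boxed shape W H T = ∃₂ λ x y → (0ℤ ≤ x × x ≤ W) × (0ℤ ≤ y × y ≤ H) × T ≅ shape W H x y

  -- The case in which two vertices at opposite corners already touch all four sides, which leaves
  -- the third vertex free in the box.
  diagonal : (W H x y : ℤ) → Triangle
  diagonal W H x y = tri (0ℤ , 0ℤ) (W , H) (x , y)

  corner-boxed : ∀ {m n W H s₁ s₂} a b c →
    End m W (proj₁ a) s₁ → End m W (proj₁ b) (- s₁) → End n H (proj₂ a) s₂ → End n H (proj₂ c) (- s₂) →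
    (m ≤ proj₁ c × proj₁ c ≤ m + W) → (n ≤ proj₂ b × proj₂ b ≤ n + H) → Boxed corner W H (tri a b c)
  corner-boxed a b c ax bx ay cy (m≤ , ≤m+W) (n≤ , ≤n+H) =
    _ , _ , End-depth (proj₁ c) ax m≤ ≤m+W , End-depth (proj₂ b) ay n≤ ≤n+H ,
    subst₂ (λ W H → tri a b c ≅ tri (0ℤ , 0ℤ) (W , _) (_ , H)) (End-opposite ax bx) (End-opposite ay cy)
      (reframe (End-unit ax) (End-unit ay) a b c)

  diagonal-boxed : ∀ {m n W H s₁ s₂} a b c →
    End m W (proj₁ a) s₁ → End m W (proj₁ b) (- s₁) → End n H (proj₂ a) s₂ → End n H (proj₂ b) (- s₂) →
    (m ≤ proj₁ c × proj₁ c ≤ m + W) → (n ≤ proj₂ c × proj₂ c ≤ n + H) → Boxed diagonal W H (tri a b c)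
  diagonal-boxed a b c ax bx ay by (m≤ , ≤m+W) (n≤ , ≤n+H) =
    _ , _ , End-depth (proj₁ c) ax m≤ ≤m+W , End-depth (proj₂ c) ay n≤ ≤n+H ,
    subst₂ (λ W H → tri a b c ≅ tri (0ℤ , 0ℤ) (W , H) (_ , _)) (End-opposite ax bx) (End-opposite ay by)
      (reframe (End-unit ax) (End-unit ay) a b c)

  Boxed-≅ : ∀ {shape W H T T′} → T ≅ T′ → Boxed shape W H T′ → Boxed shape W H T
  Boxed-≅ e (x , y , bx , by , e′) = x , y , bx , by , ≅-trans e e′

  -- Three vertices touch all four sides of the bounding box, so one of them is a corner of the box.
  box : ∀ {T m n W H} → 0ℤ < W → 0ℤ < H → Range T e₁ m W → Range T e₂ n H →
    Boxed corner W H T ⊎ Boxed diagonal W H T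
  box {T} {m} {n} {W} {H} 0<W 0<H r₁ r₂ =
    [ inj₁ ∘ Boxed-≅ {corner} (arrange T a) , inj₂ ∘ Boxed-≅ {diagonal} (arrange T a) ]′
      (go (lowest r₂′) (highest r₂′))
    where
    distinct : ∀ {p q n w} → p ≡ n → q ≡ n + w → 0ℤ < w → p ≢ q
    distinct {n = n} {w} refl refl 0<w eq = absurd-by (gap< 0<w ⊕ gap≡ (sym eq)) (solve (n ∷ w ∷ []))
    iₗ iᵣ iₘ : Fin 3
    iₗ = proj₁ (lowest r₁)
    iᵣ = proj₁ (highest r₁)
    split : ∃ λ k → Arrangement iₗ iᵣ k
    split = third iₗ iᵣ λ eq → distinct (proj₂ (lowest r₁)) (proj₂ (highest r₁)) 0<W (cong (λ l → e₁ · T l) eq)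
    iₘ = proj₁ split
    a : Arrangement iₗ iᵣ iₘ
    a = proj₂ split
    A B C : Point
    A = T iₗ
    B = T iᵣ
    C = T iₘ
    r₂′ : Range (tri A B C) e₂ n H
    r₂′ = Range-arrange a r₂
    Ax : End m W (proj₁ A) 1ℤ
    Ax = low (trans (sym (e₁-coordinate A)) (proj₂ (lowest r₁)))
    Bx : End m W (proj₁ B) (- 1ℤ)
    Bx = high (trans (sym (e₁-coordinate B)) (proj₂ (highest r₁)))
    Cx : m ≤ proj₁ C × proj₁ C ≤ m + W
    Cx = subst (m ≤_) (e₁-coordinate C) (lower r₁ iₘ) , subst (_≤ m + W) (e₁-coordinate C) (upper r₁ iₘ)
    inside : ∀ l → n ≤ proj₂ (tri A B C l) × proj₂ (tri A B C l) ≤ n + H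
    inside l = subst (n ≤_) (e₂-coordinate (tri A B C l)) (lower r₂′ l) ,
               subst (_≤ n + H) (e₂-coordinate (tri A B C l)) (upper r₂′ l)
    go : (∃ λ l → e₂ · tri A B C l ≡ n) → (∃ λ h → e₂ · tri A B C h ≡ n + H) →
         Boxed corner W H (tri A B C) ⊎ Boxed diagonal W H (tri A B C)
    go (l , l≡) (h , h≡) = cases l h
        (low (trans (sym (e₂-coordinate (tri A B C l))) l≡)) (high (trans (sym (e₂-coordinate (tri A B C h))) h≡))
        λ { refl → distinct l≡ h≡ 0<H refl }
      where
      swap : tri A B C ≅ tri B A C
      swap = arrange (tri A B C) a102
      cases : ∀ l h → End n H (proj₂ (tri A B C l)) 1ℤ → End n H (proj₂ (tri A B C h)) (- 1ℤ) → l ≢ h →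
              Boxed corner W H (tri A B C) ⊎ Boxed diagonal W H (tri A B C)
      cases #0 #1 ly hy _ = inj₂ (diagonal-boxed A B C Ax Bx ly hy Cx (inside #2))
      cases #1 #0 ly hy _ = inj₂ (diagonal-boxed A B C Ax Bx hy ly Cx (inside #2))
      cases #0 #2 ly hy _ = inj₁ (corner-boxed A B C Ax Bx ly hy Cx (inside #1))
      cases #2 #0 ly hy _ = inj₁ (corner-boxed A B C Ax Bx hy ly Cx (inside #1))
      cases #1 #2 ly hy _ = inj₁ (Boxed-≅ {corner} swap (corner-boxed B A C Bx Ax ly hy Cx (inside #0)))
      cases #2 #1 ly hy _ = inj₁ (Boxed-≅ {corner} swap (corner-boxed B A C Bx Ax hy ly Cx (inside #0)))
      cases #0 #0 _ _ l≢h = ⊥-elim (l≢h refl)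
      cases #1 #1 _ _ l≢h = ⊥-elim (l≢h refl)
      cases #2 #2 _ _ l≢h = ⊥-elim (l≢h refl)

  -- Normal forms

  ≅-reflexive : ∀ {T T′} → T ≡ T′ → T ≅ T′
  ≅-reflexive refl = ≅-refl

  remainder-unique : ∀ {W r r′ q q′} → r + q * W ≡ r′ + q′ * W →
    0ℤ ≤ r → r < W → 0ℤ ≤ r′ → r′ < W → r ≡ r′
  remainder-unique {W} {r} {r′} {q} {q′} eq 0≤r r<W 0≤r′ r′<W = go (compare q q′)
    where
    0≤W : 0ℤ ≤ W
    0≤W = ℤ.≤-trans 0≤r (ℤ.<⇒≤ r<W)
    go : q < q′ ⊎ q ≡ q′ ⊎ q′ < q → r ≡ r′
    go (inj₁ q<q′) = absurd-by (gap< q<q′ ⊗ 0≤W ⊕ gap< r<W ⊕ 0≤r′ ⊕ gap≡ (sym eq)) (solve (W ∷ r ∷ r′ ∷ q ∷ q′ ∷ []))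
    go (inj₂ (inj₁ q≡q′)) =
      ≡-from (zero-gap eq ⊞ W ⊠ zero-gap (sym q≡q′)) (solve (W ∷ r ∷ r′ ∷ q ∷ q′ ∷ []))
    go (inj₂ (inj₂ q′<q)) = absurd-by (gap< q′<q ⊗ 0≤W ⊕ gap< r′<W ⊕ 0≤r ⊕ gap≡ eq) (solve (W ∷ r ∷ r′ ∷ q ∷ q′ ∷ []))

  %ℕ-unique : ∀ {k z r} q → z ≡ r + q * + suc k → 0ℤ ≤ r → r < + suc k → + (z %ℕ suc k) ≡ r
  %ℕ-unique {k} {z} {r} q eq 0≤r r<W = remainder-unique {q = z /ℕ suc k} {q′ = q}
    (trans (sym (a≡a%ℕn+[a/ℕn]*n z (suc k))) eq) 0≤+ (+<+ (n%ℕd<d z (suc k))) 0≤r r<W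

  -- The unimodular moves that normalise a triangle in its box

  shear : ℤ → GL2Z
  shear c = record { a = 1ℤ ; b = 0ℤ ; c = c ; d = 1ℤ ; unimodular = inj₁ (expand c) }
    where
    expand : ∀ c → 1ℤ * 1ℤ - 0ℤ * c ≡ 1ℤ
    expand = solve-∀

  flip-shear : ℤ → GL2Z
  flip-shear c = record { a = 1ℤ ; b = 0ℤ ; c = c ; d = - 1ℤ ; unimodular = inj₂ (expand c) }
    where
    expand : ∀ c → 1ℤ * - 1ℤ - 0ℤ * c ≡ - 1ℤ
    expand = solve-∀

  mirror : GL2Z
  mirror = record { a = - 1ℤ ; b = 0ℤ ; c = 0ℤ ; d = 1ℤ ; unimodular = inj₂ refl }

  transposition : GL2Z
  transposition = record { a = 0ℤ ; b = 1ℤ ; c = 1ℤ ; d = 0ℤ ; unimodular = inj₂ refl }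

  keep-x : ∀ x y → 1ℤ * x + 0ℤ * y + 0ℤ ≡ x
  keep-x = solve-∀

  edge-shear : ∀ {W H y y′ q} → y ≡ y′ + q * W → corner W H 0ℤ y ≅ corner W H 0ℤ y′
  edge-shear {W} {H} {y} {y′} {q} eq = move (shear (- q)) (0ℤ , 0ℤ)
    (pair≡ refl (fix q)) (pair≡ (keep-x W y) (slide W y y′ q eq)) (pair≡ (keep-x 0ℤ H) (top q H))
    where
    fix : ∀ q → - q * 0ℤ + 1ℤ * 0ℤ + 0ℤ ≡ 0ℤ
    fix = solve-∀
    top : ∀ q H → - q * 0ℤ + 1ℤ * H + 0ℤ ≡ H
    top = solve-∀
    slide : ∀ W y y′ q → y ≡ y′ + q * W → - q * W + 1ℤ * y + 0ℤ ≡ y′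
    slide W y y′ q eq = ≡-from (zero-gap eq) (solve (W ∷ y ∷ y′ ∷ q ∷ []))

  -- Turning the triangle upside down exchanges the ends of the vertical side and sends `y` to
  -- `H - y`. A shear fixes that side pointwise and changes the third height by a multiple of `W`.
  edge-flip : ∀ {W H y y′ q} → H - y ≡ y′ + q * W → corner W H 0ℤ y ≅ corner W H 0ℤ y′
  edge-flip {W} {H} {y} {y′} {q} eq = ≅-trans
    (move (flip-shear (- q)) (0ℤ , H) {p′ = 0ℤ , H} {q′ = W , y′} {r′ = 0ℤ , 0ℤ}
      (pair≡ refl (top q H)) (pair≡ (keep-x W y) (slide W H y y′ q eq)) (pair≡ (keep-x 0ℤ H) (bottom q H)))
    (arrange (tri (0ℤ , H) (W , y′) (0ℤ , 0ℤ)) a210)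
    where
    top : ∀ q H → - q * 0ℤ + - 1ℤ * 0ℤ + H ≡ H
    top = solve-∀
    bottom : ∀ q H → - q * 0ℤ + - 1ℤ * H + H ≡ 0ℤ
    bottom = solve-∀
    slide : ∀ W H y y′ q → H - y ≡ y′ + q * W → - q * W + - 1ℤ * y + H ≡ y′
    slide W H y y′ q eq = ≡-from (zero-gap eq) (solve (W ∷ H ∷ y ∷ y′ ∷ q ∷ []))

  Classified : ℕ → ℕ → Triangle → Set
  Classified w₁ w₂ T = ∃ λ T′ → 𝒮 w₁ w₂ T′ × T ≅ T′

  Classified-≅ : ∀ {w₁ w₂ T T′} → T ≅ T′ → Classified w₁ w₂ T′ → Classified w₁ w₂ T
  Classified-≅ e (T″ , s , e′) = T″ , s , ≅-trans e e′

  -- Shears leave only the residue of `y` modulo `W`, and the flip exchanges it with the residue of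
  -- `w₂ - y`. The condition `y₁ ≤ r` in `c1` selects the smaller of the two.
  reduced-edge-classified : ∀ {k w₂ y} → 0ℤ ≤ y → y < + suc k → Classified (suc k) w₂ (corner (+ suc k) (+ w₂) 0ℤ y)
  reduced-edge-classified {k} {w₂} {y} 0≤y y<W = go (≤⊎> y r)
    where
    r q : ℤ
    r = + ((+ w₂ - y) %ℕ suc k)
    q = (+ w₂ - y) /ℕ suc k
    division : + w₂ - y ≡ r + q * + suc k
    division = a≡a%ℕn+[a/ℕn]*n (+ w₂ - y) (suc k)
    go : y ≤ r ⊎ r < y → Classified (suc k) w₂ (corner (+ suc k) (+ w₂) 0ℤ y)
    go (inj₁ y≤r) = _ , c1 y 0≤y y≤r , ≅-refl
    go (inj₂ r<y) = _ , c1 r 0≤+ (subst (r ≤_) (sym back) (ℤ.<⇒≤ r<y)) , edge-flip {q = q} division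
      where
      solved : ∀ H y r t → H - y ≡ r + t → H - r ≡ y + t
      solved H y r t eq = ≡-from (zero-gap eq) (solve (H ∷ y ∷ r ∷ t ∷ []))
      -- Exchanging the residues is an involution, so the condition of `c1` at `r` reads `r ≤ y`.
      back : + ((+ w₂ - r) %ℕ suc k) ≡ y
      back = %ℕ-unique q (solved (+ w₂) y r (q * + suc k) division) 0≤y y<W

  edge-classified : ∀ {k w₂} y → Classified (suc k) w₂ (corner (+ suc k) (+ w₂) 0ℤ y)
  edge-classified {k} {w₂} y = Classified-≅ (edge-shear {q = y /ℕ suc k} (a≡a%ℕn+[a/ℕn]*n y (suc k)))
    (reduced-edge-classified 0≤+ (+<+ (n%ℕd<d y (suc k))))

  ≤⇒≡⊎< : ∀ {a b} → a ≤ b → a ≡ b ⊎ a < b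
  ≤⇒≡⊎< {a} {b} a≤b = [ (λ b≤a → inj₁ (ℤ.≤-antisym a≤b b≤a)) , inj₂ ]′ (≤⊎> b a)

  -- Transposition exchanges `x` and `y`, so `x ≤ y` can be arranged, and then `x + y ≤ W` gives
  -- `2 x ≤ W`. If `y = 0`, the exchange moves the apex onto the left side and the triangle belongs
  -- to `c1`.
  square-classified : ∀ {k W x y} → + suc k ≡ W → 0ℤ < x → 0ℤ ≤ y → x + y ≤ W →
    Classified (suc k) (suc k) (corner W W x y)
  square-classified {k} {W} {x} {y} refl 0<x 0≤y x+y≤W = go (≤⊎> x y)
    where
    half : ∀ {W x y} → x ≤ y → x + y ≤ W → + 2 * x ≤ W
    half {W} {x} {y} x≤y h = ≤-by (gap x≤y ⊕ gap h) (solve (W ∷ x ∷ y ∷ []))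
    rest : ∀ {W x y} → x + y ≤ W → y ≤ W - x
    rest {W} {x} {y} h = ≤-by (gap h) (solve (W ∷ x ∷ y ∷ []))
    rest′ : ∀ {W x y} → x + y ≤ W → x ≤ W - y
    rest′ {W} {x} {y} h = ≤-by (gap h) (solve (W ∷ x ∷ y ∷ []))
    half′ : ∀ {W x y} → y < x → x + y ≤ W → + 2 * y ≤ W
    half′ {W} {x} {y} y<x h = ≤-by (gap (ℤ.<⇒≤ y<x) ⊕ gap h) (solve (W ∷ x ∷ y ∷ []))
    transposed : corner W W x y ≅ corner W W y x
    transposed = ≅-trans
      (move transposition (0ℤ , 0ℤ) {p′ = 0ℤ , 0ℤ} {q′ = y , W} {r′ = W , x}
        refl (pair≡ (exchange W y) (exchange′ W y)) (pair≡ (exchange x W) (exchange′ x W)))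
      (arrange (tri (0ℤ , 0ℤ) (y , W) (W , x)) a021)
      where
      exchange : ∀ x y → 0ℤ * x + 1ℤ * y + 0ℤ ≡ y
      exchange = solve-∀
      exchange′ : ∀ x y → 1ℤ * x + 0ℤ * y + 0ℤ ≡ x
      exchange′ = solve-∀
    go : x ≤ y ⊎ y < x → Classified (suc k) (suc k) (corner W W x y)
    go (inj₁ x≤y) = _ , c2 x y 0<x (half x≤y x+y≤W) 0≤y (rest {x = x} x+y≤W) (λ _ → x≤y) , ≅-refl
    go (inj₂ y<x) = Classified-≅ transposed (case (≤⇒≡⊎< 0≤y))
      where
      case : 0ℤ ≡ y ⊎ 0ℤ < y → Classified (suc k) (suc k) (corner W W y x)
      case (inj₁ refl) = edge-classified x
      case (inj₂ 0<y) =
        _ , c2 y x 0<y (half′ y<x x+y≤W) (ℤ.<⇒≤ 0<x) (rest′ {y = y} x+y≤W) (λ _ → ℤ.<⇒≤ y<x) , ≅-refl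

  mirrored : ∀ {W H x y} → corner W H x y ≅ cut W H (W - x) y
  mirrored {W} {H} {x} {y} = ≅-trans
    (move mirror (W , 0ℤ) {p′ = W , 0ℤ} {q′ = 0ℤ , y} {r′ = W - x , H}
      (pair≡ (ℤ.+-identityˡ W) refl) (pair≡ (right W y) (level W y)) (pair≡ (reflected W H x) (level x H)))
    (arrange (tri (W , 0ℤ) (0ℤ , y) (W - x , H)) a102)
    where
    right : ∀ W y → - 1ℤ * W + 0ℤ * y + W ≡ 0ℤ
    right = solve-∀
    level : ∀ x y → 0ℤ * x + 1ℤ * y + 0ℤ ≡ y
    level = solve-∀
    reflected : ∀ W H x → - 1ℤ * x + 0ℤ * H + W ≡ W - x
    reflected = solve-∀

  -- The shear `(X , Y) ↦ (X , X + Y - x)` fixes the apex and brings the left vertex to the origin.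
  -- The boundary case `y = x` of the cuts is thus a corner, and `c3` demands `y₀ < x₂`.
  cut-sheared : ∀ {W H x} → cut W H x x ≅ corner W H x (W - x)
  cut-sheared {W} {H} {x} = move (shear 1ℤ) (0ℤ , - x)
    (pair≡ (keep-x 0ℤ x) (origin x)) (pair≡ (keep-x W 0ℤ) (right W x)) (pair≡ (keep-x x H) (top x H))
    where
    origin : ∀ x → 1ℤ * 0ℤ + 1ℤ * x + - x ≡ 0ℤ
    origin = solve-∀
    right : ∀ W x → 1ℤ * W + 1ℤ * 0ℤ + - x ≡ W - x
    right = solve-∀
    top : ∀ x H → 1ℤ * x + 1ℤ * H + - x ≡ H
    top = solve-∀

  oblong-classified : ∀ {k w₂ x y} → suc k ℕ.< w₂ → 0ℤ < x → 0ℤ ≤ y → x + y ≤ + suc k →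
    Classified (suc k) w₂ (corner (+ suc k) (+ w₂) x y)
  oblong-classified {k} {w₂} {x} {y} w₁<w₂ 0<x 0≤y x+y≤W = go (≤⊎> (+ 2 * x) W)
    where
    W H : ℤ
    W = + suc k
    H = + w₂
    c2′ : ∀ x y → 0ℤ < x → + 2 * x ≤ W → 0ℤ ≤ y → y ≤ W - x → Classified (suc k) w₂ (corner W H x y)
    c2′ x y 0<x 2x≤W 0≤y y≤ = _ , c2 x y 0<x 2x≤W 0≤y y≤ (λ eq → ⊥-elim (ℕ.<⇒≢ w₁<w₂ eq)) , ≅-refl
    rest : ∀ W x y → x + y ≤ W → y ≤ W - x
    rest W x y h = ≤-by (gap h) (solve (W ∷ x ∷ y ∷ []))
    small : ∀ W x → W < + 2 * x → + 2 * (W - x) < W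
    small W x h = <-by (gap< h) (solve (W ∷ x ∷ []))
    left : ∀ W x → + 2 * x < W → 0ℤ ≤ x → 0ℤ ≤ W - x
    left W x h 0≤x = ≤-by (gap (ℤ.<⇒≤ h) ⊕ 0≤x) (solve (W ∷ x ∷ []))
    nonneg : ∀ W x y → x + y ≤ W → 0ℤ ≤ y → 0ℤ ≤ W - x
    nonneg W x y h 0≤y = ≤-by (gap h ⊕ 0≤y) (solve (W ∷ x ∷ y ∷ []))
    cut-classified : ∀ x → 0ℤ ≤ x → + 2 * x < W → ∀ y → 0ℤ ≤ y → y ≤ x → Classified (suc k) w₂ (cut W H x y)
    cut-classified x 0≤x 2x<W y 0≤y y≤x = case (≤⇒≡⊎< 0≤y) (≤⇒≡⊎< y≤x) (≤⇒≡⊎< 0≤x)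
      where
      case : 0ℤ ≡ y ⊎ 0ℤ < y → y ≡ x ⊎ y < x → 0ℤ ≡ x ⊎ 0ℤ < x → Classified (suc k) w₂ (cut W H x y)
      case (inj₁ refl) _ (inj₁ refl) = edge-classified 0ℤ
      case (inj₁ refl) _ (inj₂ 0<x) = c2′ x 0ℤ 0<x (ℤ.<⇒≤ 2x<W) ℤ.≤-refl (left W x 2x<W 0≤x)
      case (inj₂ 0<y) (inj₁ refl) _ = Classified-≅ cut-sheared
        (c2′ x (W - x) 0<y (ℤ.<⇒≤ 2x<W) (left W x 2x<W 0≤x) ℤ.≤-refl)
      case (inj₂ 0<y) (inj₂ y<x) _ =
        _ , c3 x y w₁<w₂ (ℤ.≤-<-trans (ℤ.i<j⇒suc[i]≤j 0<y) y<x) 2x<W 0<y y<x , ≅-refl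
    go : + 2 * x ≤ W ⊎ W < + 2 * x → Classified (suc k) w₂ (corner W H x y)
    go (inj₁ 2x≤W) = c2′ x y 0<x 2x≤W 0≤y (rest W x y x+y≤W)
    go (inj₂ W<2x) = Classified-≅ mirrored
      (cut-classified (W - x) (nonneg W x y x+y≤W 0≤y) (small W x W<2x) y 0≤y (rest W x y x+y≤W))

  -- Minimality tested on the pairs `e₁ , (a , b)`: the first width is already `w₁`, so the second
  -- is at least `w₂`. It is applied below in the direction `(1 , -1)`.
  off-axis-spread : ∀ T {w₁ w₂} → HasWidths T w₁ w₂ → width e₁ T ≡ + w₁ → ∀ a b → b ≢ 0ℤ → Spread T (+ w₂) (a , b)
  off-axis-spread T {w₁} {w₂} (_ , minimal) width₁ a b b≢0 =
    i , j , ℤ.≤-trans (second (minimal e₁ (a , b) λ eq → b≢0 (trans (sym (expand a b)) eq))) (ℤ.≤-reflexive (sym attained))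
    where
    expand : ∀ a b → 1ℤ * b - 0ℤ * a ≡ b
    expand = solve-∀
    i j : Fin 3
    i = proj₁ (width-attained T (a , b))
    j = proj₁ (proj₂ (width-attained T (a , b)))
    attained : (a , b) · T i - (a , b) · T j ≡ width (a , b) T
    attained = proj₂ (proj₂ (width-attained T (a , b)))
    second : LexLeq (+ w₁ , + w₂) (width e₁ T , width (a , b) T) → + w₂ ≤ width (a , b) T
    second (inj₁ w₁<) = ⊥-elim (ℤ.<-irrefl (sym width₁) w₁<)
    second (inj₂ (_ , w₂≤)) = w₂≤

  -- The functional `(1 , -1)` takes the values `0`, `W - y` and `x - H`. Only three differences can
  -- reach `H`: `H - x`, which forces `x = 0`, and `W - y` and `H + W - x - y`, each of which forces
  -- `x + y ≤ W`.
  corner-constraint : ∀ {W H x y} → 0ℤ < W → W ≤ H → 0ℤ ≤ x × x ≤ W → 0ℤ ≤ y × y ≤ H →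
    Spread (corner W H x y) H (1ℤ , - 1ℤ) → x ≡ 0ℤ ⊎ x + y ≤ W
  corner-constraint {W} {H} {x} {y} 0<W W≤H (0≤x , x≤W) (0≤y , y≤H) (i , j , h) = go i j h
    where
    u : Dual
    u = 1ℤ , - 1ℤ
    diagonal-case : ∀ v → H ≤ v - v → x ≡ 0ℤ ⊎ x + y ≤ W
    diagonal-case v h = absurd-by (gap h ⊕ gap W≤H ⊕ gap< 0<W) (solve (W ∷ H ∷ v ∷ []))
    go : ∀ i j → H ≤ u · corner W H x y i - u · corner W H x y j → x ≡ 0ℤ ⊎ x + y ≤ W
    go #0 #1 h = absurd-by (gap {b = 0ℤ - (1ℤ * W + - 1ℤ * y)} h ⊕ gap y≤H ⊕ gap< 0<W) (solve (W ∷ H ∷ y ∷ []))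
    go #0 #2 h = inj₁ (ℤ.≤-antisym (≤-by (gap {b = 0ℤ - (1ℤ * x + - 1ℤ * H)} h) (solve (H ∷ x ∷ []))) 0≤x)
    go #1 #0 h = inj₂ (≤-by (gap {b = 1ℤ * W + - 1ℤ * y - 0ℤ} h ⊕ gap W≤H ⊕ gap x≤W) (solve (W ∷ H ∷ x ∷ y ∷ [])))
    go #1 #2 h = inj₂ (≤-by (gap {b = 1ℤ * W + - 1ℤ * y - (1ℤ * x + - 1ℤ * H)} h) (solve (W ∷ H ∷ x ∷ y ∷ [])))
    go #2 #0 h = absurd-by (gap {b = 1ℤ * x + - 1ℤ * H - 0ℤ} h ⊕ gap x≤W ⊕ gap W≤H ⊕ gap W≤H ⊕ gap< 0<W)
      (solve (W ∷ H ∷ x ∷ []))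
    go #2 #1 h = absurd-by (gap {b = 1ℤ * x + - 1ℤ * H - (1ℤ * W + - 1ℤ * y)} h ⊕ gap x≤W ⊕ gap y≤H ⊕ gap W≤H ⊕ gap< 0<W)
      (solve (W ∷ H ∷ x ∷ y ∷ []))
    go #0 #0 h = diagonal-case 0ℤ h
    go #1 #1 h = diagonal-case (1ℤ * W + - 1ℤ * y) h
    go #2 #2 h = diagonal-case (1ℤ * x + - 1ℤ * H) h

  -- On the two opposite corners the values of `(1 , -1)` are only `H - W` apart, so the third
  -- vertex must supply the width. Only the remaining two corners of the box are extreme enough.
  diagonal-constraint : ∀ {W H x y} → 0ℤ < W → W ≤ H → 0ℤ ≤ x × x ≤ W → 0ℤ ≤ y × y ≤ H →
    Spread (diagonal W H x y) H (1ℤ , - 1ℤ) → (x ≡ 0ℤ × y ≡ H) ⊎ (x ≡ W × y ≡ 0ℤ)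
  diagonal-constraint {W} {H} {x} {y} 0<W W≤H (0≤x , x≤W) (0≤y , y≤H) (i , j , h) = go i j h
    where
    u : Dual
    u = 1ℤ , - 1ℤ
    Goal : Set
    Goal = (x ≡ 0ℤ × y ≡ H) ⊎ (x ≡ W × y ≡ 0ℤ)
    top-left : x ≤ 0ℤ → H ≤ y → Goal
    top-left x≤0 H≤y = inj₁ (ℤ.≤-antisym x≤0 0≤x , ℤ.≤-antisym y≤H H≤y)
    bottom-right : W ≤ x → y ≤ 0ℤ → Goal
    bottom-right W≤x y≤0 = inj₂ (ℤ.≤-antisym x≤W W≤x , ℤ.≤-antisym y≤0 0≤y)
    diagonal-case : ∀ v → H ≤ v - v → Goal
    diagonal-case v h = absurd-by (gap h ⊕ gap W≤H ⊕ gap< 0<W) (solve (W ∷ H ∷ v ∷ []))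
    go : ∀ i j → H ≤ u · diagonal W H x y i - u · diagonal W H x y j → Goal
    go #0 #1 h = absurd-by (gap {b = 0ℤ - (1ℤ * W + - 1ℤ * H)} h ⊕ gap< 0<W) (solve (W ∷ H ∷ []))
    go #1 #0 h = absurd-by (gap {b = 1ℤ * W + - 1ℤ * H - 0ℤ} h ⊕ gap W≤H ⊕ gap W≤H ⊕ gap< 0<W) (solve (W ∷ H ∷ []))
    go #0 #2 h = top-left (≤-by (h′ ⊕ gap y≤H) (solve (H ∷ x ∷ y ∷ []))) (≤-by (h′ ⊕ 0≤x) (solve (H ∷ x ∷ y ∷ [])))
      where h′ = gap {b = 0ℤ - (1ℤ * x + - 1ℤ * y)} h
    go #2 #0 h = bottom-right (≤-by (h′ ⊕ 0≤y ⊕ gap W≤H) (solve (W ∷ H ∷ x ∷ y ∷ [])))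
      (≤-by (h′ ⊕ gap W≤H ⊕ gap x≤W) (solve (W ∷ H ∷ x ∷ y ∷ [])))
      where h′ = gap {b = 1ℤ * x + - 1ℤ * y - 0ℤ} h
    go #1 #2 h = top-left (≤-by (h′ ⊕ gap y≤H ⊕ gap W≤H) (solve (W ∷ H ∷ x ∷ y ∷ [])))
      (≤-by (h′ ⊕ 0≤x ⊕ gap W≤H) (solve (W ∷ H ∷ x ∷ y ∷ [])))
      where h′ = gap {b = 1ℤ * W + - 1ℤ * H - (1ℤ * x + - 1ℤ * y)} h
    go #2 #1 h = bottom-right (≤-by (h′ ⊕ 0≤y) (solve (W ∷ H ∷ x ∷ y ∷ [])))
      (≤-by (h′ ⊕ gap x≤W) (solve (W ∷ H ∷ x ∷ y ∷ [])))
      where h′ = gap {b = 1ℤ * x + - 1ℤ * y - (1ℤ * W + - 1ℤ * H)} h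
    go #0 #0 h = diagonal-case 0ℤ h
    go #1 #1 h = diagonal-case (1ℤ * W + - 1ℤ * H) h
    go #2 #2 h = diagonal-case (1ℤ * x + - 1ℤ * y) h

  corner-classified : ∀ {k w₂ x y} → suc k ℕ.≤ w₂ → 0ℤ ≤ x × x ≤ + suc k → 0ℤ ≤ y × y ≤ + w₂ →
    HasWidths (corner (+ suc k) (+ w₂) x y) (suc k) w₂ → Classified (suc k) w₂ (corner (+ suc k) (+ w₂) x y)
  corner-classified {k} {w₂} {x} {y} w₁≤w₂ bx by widths =
    go (corner-constraint (+<+ (ℕ.s≤s ℕ.z≤n)) (+≤+ w₁≤w₂) bx by
      (off-axis-spread T widths (Range⇒width (range (corner-profile₁ {H = + w₂} {y = y} (proj₁ bx) (proj₂ bx)))) 1ℤ (- 1ℤ) λ ()))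
      (≤⇒≡⊎< (proj₁ bx)) (ℕ.m≤n⇒m<n∨m≡n w₁≤w₂)
    where
    T = corner (+ suc k) (+ w₂) x y
    go : x ≡ 0ℤ ⊎ x + y ≤ + suc k → 0ℤ ≡ x ⊎ 0ℤ < x → suc k ℕ.< w₂ ⊎ suc k ≡ w₂ → Classified (suc k) w₂ T
    go (inj₁ refl) _ _ = edge-classified y
    go (inj₂ _) (inj₁ refl) _ = edge-classified y
    go (inj₂ x+y≤W) (inj₂ 0<x) (inj₁ w₁<w₂) = oblong-classified w₁<w₂ 0<x (proj₁ by) x+y≤W
    go (inj₂ x+y≤W) (inj₂ 0<x) (inj₂ refl) = square-classified refl 0<x (proj₁ by) x+y≤W

  diagonal-classified : ∀ {k w₂ x y} → suc k ℕ.≤ w₂ → 0ℤ ≤ x × x ≤ + suc k → 0ℤ ≤ y × y ≤ + w₂ →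
    HasWidths (diagonal (+ suc k) (+ w₂) x y) (suc k) w₂ → Classified (suc k) w₂ (diagonal (+ suc k) (+ w₂) x y)
  diagonal-classified {k} {w₂} {x} {y} w₁≤w₂ bx by widths =
    go (diagonal-constraint (+<+ (ℕ.s≤s ℕ.z≤n)) (+≤+ w₁≤w₂) bx by (off-axis-spread T widths (Range⇒width (range profile₁)) 1ℤ (- 1ℤ) λ ()))
    where
    W H : ℤ
    W = + suc k
    H = + w₂
    T = diagonal W H x y
    profile₁ : Profile T e₁ W x
    profile₁ = profile₃ {T} {e₁} a021 refl (e₁-· x y) (e₁-· W H) (proj₁ bx) (proj₂ bx)
    go : (x ≡ 0ℤ × y ≡ H) ⊎ (x ≡ W × y ≡ 0ℤ) → Classified (suc k) w₂ T
    go (inj₁ (refl , refl)) = edge-classified H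
    -- The third vertex `(W , 0)` becomes the right vertex of a `corner` whose apex is `(W , H)`.
    go (inj₂ (refl , refl)) = Classified-≅ swap
      (corner-classified w₁≤w₂ (0≤+ , ℤ.≤-refl) (ℤ.≤-refl , 0≤+) (HasWidths-invariant swap widths))
      where
      swap : T ≅ corner W H W 0ℤ
      swap = arrange T a021

  positive-classified : ∀ {k w₂ T} → suc k ℕ.≤ w₂ → HasWidths T (suc k) w₂ → Classified (suc k) w₂ T
  positive-classified {k} {w₂} {T} w₁≤w₂ widths = go (axis-aligned {T} w₁≤w₂ widths)
    where
    go : (∃ λ T′ → T ≅ T′ × width e₁ T′ ≡ + suc k × width e₂ T′ ≡ + w₂) → Classified (suc k) w₂ T
    go (T′ , e , eq₁ , eq₂) = boxed (box (+<+ (ℕ.s≤s ℕ.z≤n)) (+<+ (ℕ.≤-trans (ℕ.s≤s ℕ.z≤n) w₁≤w₂))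
        (proj₂ (width⇒Range {T′} {e₁} eq₁)) (proj₂ (width⇒Range {T′} {e₂} eq₂)))
      where
      boxed : Boxed corner (+ suc k) (+ w₂) T′ ⊎ Boxed diagonal (+ suc k) (+ w₂) T′ → Classified (suc k) w₂ T
      boxed (inj₁ (x , y , bx , by , e′)) = Classified-≅ (≅-trans e e′)
        (corner-classified w₁≤w₂ bx by (HasWidths-invariant (≅-trans e e′) widths))
      boxed (inj₂ (x , y , bx , by , e′)) = Classified-≅ (≅-trans e e′)
        (diagonal-classified w₁≤w₂ bx by (HasWidths-invariant (≅-trans e e′) widths))

  -- A vertical segment with a marked point is determined by the distance of that point from the
  -- nearer end; the flip makes the nearer end the lower one.
  segment-classified : ∀ {w₂ x a b c} → a ≤ b → b ≤ a + + w₂ → c ≡ a + + w₂ →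
    Classified 0 w₂ (tri (x , a) (x , b) (x , c))
  segment-classified {w₂} {x} {a} {b} {c} a≤b b≤c refl = go (≤⊎> (+ 2 * (b - a)) H)
    where
    H : ℤ
    H = + w₂
    recentre : ∀ x y → 1ℤ * x + 0ℤ * y + - x ≡ 0ℤ
    recentre = solve-∀
    up : ∀ a x y → 0ℤ * x + 1ℤ * y + - a ≡ y - a
    up = solve-∀
    down : ∀ c x y → 0ℤ * x + - 1ℤ * y + c ≡ c - y
    down = solve-∀
    top : ∀ a H → a + H - a ≡ H
    top = solve-∀
    go : + 2 * (b - a) ≤ H ⊎ H < + 2 * (b - a) → Classified 0 w₂ (tri (x , a) (x , b) (x , a + H))
    go (inj₁ h) = _ , c0 (b - a) (gap a≤b) h ,
      move identity (- x , - a) (pair≡ (recentre x a) (trans (up a x a) (ℤ.+-inverseʳ a)))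
        (pair≡ (recentre x b) (up a x b)) (pair≡ (recentre x (a + H)) (trans (up a x (a + H)) (top a H)))
    go (inj₂ h) = _ , c0 (a + H - b) (gap b≤c) (small a b H h) , ≅-trans
      (move (flip-shear 0ℤ) (- x , a + H) {p′ = 0ℤ , H} {q′ = 0ℤ , a + H - b} {r′ = 0ℤ , 0ℤ}
        (pair≡ (recentre x a) (trans (down (a + H) x a) (top a H)))
        (pair≡ (recentre x b) (down (a + H) x b))
        (pair≡ (recentre x (a + H)) (trans (down (a + H) x (a + H)) (ℤ.+-inverseʳ (a + H)))))
      (arrange (tri (0ℤ , H) (0ℤ , a + H - b) (0ℤ , 0ℤ)) a210)
      where
      small : ∀ a b H → H < + 2 * (b - a) → + 2 * (a + H - b) ≤ H
      small a b H h = ≤-by (gap (ℤ.<⇒≤ h)) (solve (a ∷ b ∷ H ∷ []))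

  flat-classified : ∀ {w₂ T} → HasWidths T 0 w₂ → Classified 0 w₂ T
  flat-classified {w₂} {T} widths = go (axis-aligned {T} ℕ.z≤n widths)
    where
    go : (∃ λ T′ → T ≅ T′ × width e₁ T′ ≡ 0ℤ × width e₂ T′ ≡ + w₂) → Classified 0 w₂ T
    go (T′ , e , eq₁ , eq₂) = sorted (lowest r₂) (highest r₂)
      where
      m n : ℤ
      m = proj₁ (width⇒Range {T′} {e₁} eq₁)
      n = proj₁ (width⇒Range {T′} {e₂} eq₂)
      r₁ : Range T′ e₁ m 0ℤ
      r₁ = proj₂ (width⇒Range {T′} {e₁} eq₁)
      r₂ : Range T′ e₂ n (+ w₂)
      r₂ = proj₂ (width⇒Range {T′} {e₂} eq₂)
      X≡m : ∀ i → proj₁ (T′ i) ≡ m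
      X≡m i = trans (sym (e₁-coordinate (T′ i)))
        (ℤ.≤-antisym (subst (e₁ · T′ i ≤_) (ℤ.+-identityʳ m) (upper r₁ i)) (lower r₁ i))
      Y≥n : ∀ i → n ≤ proj₂ (T′ i)
      Y≥n i = subst (n ≤_) (e₂-coordinate (T′ i)) (lower r₂ i)
      Y≤n+H : ∀ i → proj₂ (T′ i) ≤ n + + w₂
      Y≤n+H i = subst (_≤ n + + w₂) (e₂-coordinate (T′ i)) (upper r₂ i)
      place : ∀ {i j k} → Arrangement i j k → proj₂ (T′ i) ≡ n → proj₂ (T′ k) ≡ n + + w₂ → Classified 0 w₂ T
      place {i} {j} {k} a eqᵢ eqₖ = Classified-≅ (≅-trans e (≅-trans (arrange T′ a)
          (≅-reflexive (cong₃ tri (pair≡ (X≡m i) eqᵢ) (pair≡ (X≡m j) refl) (pair≡ (X≡m k) eqₖ)))))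
        (segment-classified (Y≥n j) (Y≤n+H j) refl)
        where
        cong₃ : ∀ {A B : Set} (f : A → A → A → B) {x y z x′ y′ z′} → x ≡ x′ → y ≡ y′ → z ≡ z′ → f x y z ≡ f x′ y′ z′
        cong₃ f refl refl refl = refl
      sorted : (∃ λ i → e₂ · T′ i ≡ n) → (∃ λ k → e₂ · T′ k ≡ n + + w₂) → Classified 0 w₂ T
      sorted (i , eqᵢ) (k , eqₖ) = cases (i Fin.≟ k)
        where
        Yᵢ : proj₂ (T′ i) ≡ n
        Yᵢ = trans (sym (e₂-coordinate (T′ i))) eqᵢ
        Yₖ : proj₂ (T′ k) ≡ n + + w₂
        Yₖ = trans (sym (e₂-coordinate (T′ k))) eqₖ
        cases : Dec (i ≡ k) → Classified 0 w₂ T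
        cases (no i≢k) = place (last (proj₂ (third i k i≢k))) Yᵢ Yₖ
          where
          last : ∀ {i j k} → Arrangement i j k → Arrangement i k j
          last a012 = a021
          last a021 = a012
          last a102 = a120
          last a120 = a102
          last a201 = a210
          last a210 = a201
        -- One vertex can be both lowest and highest only if the top and bottom heights agree; then
        -- all heights are equal and any arrangement serves.
        cases (yes refl) = place a012 (at #0) (trans (at #2) n≡top)
          where
          n≡top : n ≡ n + + w₂
          n≡top = trans (sym Yᵢ) Yₖ
          at : ∀ l → proj₂ (T′ l) ≡ n
          at l = ℤ.≤-antisym (subst (proj₂ (T′ l) ≤_) (sym n≡top) (Y≤n+H l)) (Y≥n l)

  classified : ∀ {w₁ w₂ T} → w₁ ℕ.≤ w₂ → HasWidths T w₁ w₂ → Classified w₁ w₂ T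
  classified {zero} {w₂} {T} _ widths = flat-classified {w₂} {T} widths
  classified {suc k} {w₂} {T} w₁≤w₂ widths = positive-classified {k} {w₂} {T} w₁≤w₂ widths

  -- Inequivalence of the triangles of 𝒮

  unit-factors : ∀ a d → a * d ≡± 1ℤ → a ≡± 1ℤ × d ≡± 1ℤ
  unit-factors a d eq = unit a (ℕ.m*n≡1⇒m≡1 ∣ a ∣ ∣ d ∣ abs≡1) , unit d (ℕ.m*n≡1⇒n≡1 ∣ a ∣ ∣ d ∣ abs≡1)
    where
    abs-unit : a * d ≡± 1ℤ → ∣ a * d ∣ ≡ 1
    abs-unit (inj₁ eq) = cong ∣_∣ eq
    abs-unit (inj₂ eq) = cong ∣_∣ eq
    abs≡1 : ∣ a ∣ ℕ.* ∣ d ∣ ≡ 1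
    abs≡1 = trans (sym (ℤ.abs-* a d)) (abs-unit eq)
    unit : ∀ a → ∣ a ∣ ≡ 1 → a ≡± 1ℤ
    unit (+ _) refl = inj₁ refl
    unit -[1+ _ ] refl = inj₂ refl

  -- The rows of the matrix: the coordinates of `T′` read as functionals on `T`. Inequivalence
  -- follows by listing which functionals on `T` have the required width and comparing middle
  -- values.
  frame : ∀ {T T′} → T ≅ T′ → ∃₂ λ u v → det u v ≡± 1ℤ ×
    (∀ {w m} → Profile T′ e₁ w m → Profile T u w m) × (∀ {w m} → Profile T′ e₂ w m → Profile T v w m)
  frame e = pull A e₁ , pull A e₂ , det-pull A e₁ e₂ ,
    Profile-pull (pullback e e₁) , Profile-pull (pullback e e₂)
    where
    A = proj₁ ⌊ e ⌋

  Profile-width : ∀ {T u w m} → Profile T u w m → width u T ≡ w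
  Profile-width P = Range⇒width (range P)

  Profile-bound : ∀ {T u w m} → Profile T u w m → ∀ i j → u · T i - u · T j ≤ w
  Profile-bound P = Range-bound (range P)

  -- For W < H only ±e₁ realise the first width, which forces the equivalence to be a shear up to signs.
  oblong-frame : ∀ {T T′ W H x x′ y′} → W < H → (∀ a b → 0ℤ < b → Spread T H (a , b)) → T ≅ T′ →
    Profile T e₁ W x → Profile T′ e₁ W x′ → Profile T′ e₂ H y′ →
    (x′ ≡ x ⊎ x′ ≡ W - x) × ∃ λ c → Profile T (c , 1ℤ) H y′ ⊎ Profile T (c , 1ℤ) H (H - y′)
  oblong-frame {T} {T′} {W} {H} {x} {x′} {y′} W<H spread e P P₁′ P₂′ = go (frame e)
    where
    Goal : Set
    Goal = (x′ ≡ x ⊎ x′ ≡ W - x) × ∃ λ c → Profile T (c , 1ℤ) H y′ ⊎ Profile T (c , 1ℤ) H (H - y′)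
    go : (∃₂ λ u v → det u v ≡± 1ℤ ×
      (∀ {w m} → Profile T′ e₁ w m → Profile T u w m) × (∀ {w m} → Profile T′ e₂ w m → Profile T v w m)) → Goal
    go ((a , b) , (c , d) , unimodular , pull₁ , pull₂) = on-axis (b ℤ.≟ 0ℤ)
      where
      Q₁ : Profile T (a , b) W x′
      Q₁ = pull₁ P₁′
      Q₂ : Profile T (c , d) H y′
      Q₂ = pull₂ P₂′
      on-axis : Dec (b ≡ 0ℤ) → Goal
      on-axis (no b≢0) = ⊥-elim (ℤ.<⇒≱ W<H (subst (H ≤_) (Profile-width Q₁) (off-axis spread a b b≢0)))
      on-axis (yes b≡0) = first (proj₁ units) (subst (λ b → Profile T (a , b) W x′) b≡0 Q₁) , second (proj₂ units) Q₂
        where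
        expand : ∀ a b c d → b ≡ 0ℤ → a * d - b * c ≡ a * d
        expand a b c d refl = drop a c d
          where
          drop : ∀ a c d → a * d - 0ℤ * c ≡ a * d
          drop = solve-∀
        units : a ≡± 1ℤ × d ≡± 1ℤ
        units = unit-factors a d (subst (_≡± 1ℤ) (expand a b c d b≡0) unimodular)
        first : ∀ {a} → a ≡± 1ℤ → Profile T (a , 0ℤ) W x′ → x′ ≡ x ⊎ x′ ≡ W - x
        first (inj₁ refl) Q = inj₁ (Profile-unique Q P)
        first (inj₂ refl) Q = inj₂ (Profile-unique Q (Profile-neg P))
        second : ∀ {d} → d ≡± 1ℤ → Profile T (c , d) H y′ →
                 ∃ λ c → Profile T (c , 1ℤ) H y′ ⊎ Profile T (c , 1ℤ) H (H - y′)
        second (inj₁ refl) Q = c , inj₁ Q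
        second (inj₂ refl) Q = - c , inj₂ (Profile-neg Q)

  half-unique : ∀ {W x x′} → + 2 * x ≤ W → + 2 * x′ ≤ W → x′ ≡ x ⊎ x′ ≡ W - x → x ≡ x′
  half-unique _ _ (inj₁ eq) = sym eq
  half-unique {W} {x} {x′} 2x≤W 2x′≤W (inj₂ eq) = ℤ.≤-antisym
    (≤-by (gap 2x≤W ⊕ gap≡ (sym eq)) (solve (W ∷ x ∷ x′ ∷ [])))
    (≤-by (gap 2x′≤W ⊕ gap≡ (sym eq)) (solve (W ∷ x ∷ x′ ∷ [])))

  -- The ends of the vertical side take the values `0` and `H` under `(c , 1)` and thus exhaust the
  -- width `H`. The third value `y + c W` must lie between them.
  edge-mid : ∀ {W H y c m} → Profile (corner W H 0ℤ y) (c , 1ℤ) H m → m ≡ y + c * W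
  edge-mid {W} {H} {y} {c} {m} P = Profile-unique P
    (profile₃ {corner W H 0ℤ y} {c , 1ℤ} {0ℤ} a012 (bottom c) (middle c W y) (top c H)
      (nonneg (Profile-bound P #2 #1)) (below (Profile-bound P #1 #0)))
    where
    bottom : ∀ c → c * 0ℤ + 1ℤ * 0ℤ ≡ 0ℤ
    bottom = solve-∀
    middle : ∀ c W y → c * W + 1ℤ * y ≡ 0ℤ + (y + c * W)
    middle = solve-∀
    top : ∀ c H → c * 0ℤ + 1ℤ * H ≡ 0ℤ + H
    top = solve-∀
    nonneg : c * 0ℤ + 1ℤ * H - (c * W + 1ℤ * y) ≤ H → 0ℤ ≤ y + c * W
    nonneg h = ≤-by (gap h) (solve (c ∷ W ∷ H ∷ y ∷ []))
    below : c * W + 1ℤ * y - (c * 0ℤ + 1ℤ * 0ℤ) ≤ H → y + c * W ≤ H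
    below h = ≤-by (gap h) (solve (c ∷ W ∷ H ∷ y ∷ []))

  -- The equivalence gives `y′` or `w₂ - y′` congruent to `y` modulo `W`. In the first case the
  -- reduced heights agree. In the second each height is the remainder that bounds the other one in
  -- `c1`, so each is at most the other.
  edge-unique : ∀ {k w₂ y y′} → suc k ℕ.< w₂ → 0ℤ ≤ y → y ≤ + ((+ w₂ - y) %ℕ suc k) →
    0ℤ ≤ y′ → y′ ≤ + ((+ w₂ - y′) %ℕ suc k) →
    corner (+ suc k) (+ w₂) 0ℤ y ≅ corner (+ suc k) (+ w₂) 0ℤ y′ → y ≡ y′
  edge-unique {k} {w₂} {y} {y′} w₁<w₂ 0≤y y≤r 0≤y′ y′≤r′ e =
    go (proj₂ (oblong-frame (+<+ w₁<w₂) (edge-spread {y = y} 0≤+) e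
      (corner-profile₁ {y = y} ℤ.≤-refl 0≤+) (corner-profile₁ {y = y′} ℤ.≤-refl 0≤+)
      (corner-profile₂ {x = 0ℤ} 0≤y′ (ℤ.≤-trans (ℤ.<⇒≤ y′<W) (+≤+ (ℕ.<⇒≤ w₁<w₂))))))
    where
    W H : ℤ
    W = + suc k
    H = + w₂
    y<W : y < W
    y<W = c1-bound y≤r
    y′<W : y′ < W
    y′<W = c1-bound y′≤r′
    go : (∃ λ c → Profile (corner W H 0ℤ y) (c , 1ℤ) H y′ ⊎ Profile (corner W H 0ℤ y) (c , 1ℤ) H (H - y′)) → y ≡ y′
    go (c , inj₁ P) = sym (remainder-unique {q = 0ℤ} {q′ = c} (trans (pad W y′) (edge-mid P)) 0≤y′ y′<W 0≤y y<W)
      where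
      pad : ∀ W y → y + 0ℤ * W ≡ y
      pad = solve-∀
    go (c , inj₂ P) = ℤ.≤-antisym
      (ℤ.≤-trans y≤r (ℤ.≤-reflexive (%ℕ-unique c (other H y y′ (c * W) (edge-mid P)) 0≤y′ y′<W)))
      (ℤ.≤-trans y′≤r′ (ℤ.≤-reflexive (%ℕ-unique c (edge-mid P) 0≤y y<W)))
      where
      other : ∀ H y y′ t → H - y′ ≡ y + t → H - y ≡ y′ + t
      other H y y′ t eq = ≡-from (zero-gap eq) (solve (H ∷ y ∷ y′ ∷ t ∷ []))

  -- Areas of the normal forms

  same-sign : ∀ {a b} → 0ℤ < a → 0ℤ < b → a ≡± b → a ≡ b
  same-sign _ _ (inj₁ eq) = eq
  same-sign {a} {b} 0<a 0<b (inj₂ eq) =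
    absurd-by (gap< 0<a ⊕ gap< 0<b ⊕ gap≡ eq ⊕ 0≤+ {1}) (solve (a ∷ b ∷ []))

  cancel-positive : ∀ {c a b} → 0ℤ < c → c * a ≡ c * b → a ≡ b
  cancel-positive {c} {a} {b} 0<c = ℤ.*-cancelˡ-≡ c a b {{ℤ.>-nonZero 0<c}}

  corner-area : ∀ {W H x y} → area (corner W H x y) ≡ W * H - x * y
  corner-area {W} {H} {x} {y} = trans (cross-expand 0ℤ 0ℤ W y x H) (expand W H x y)
    where
    expand : ∀ W H x y → (W - 0ℤ) * (H - 0ℤ) - (y - 0ℤ) * (x - 0ℤ) ≡ W * H - x * y
    expand = solve-∀

  cut-area : ∀ {W H x y} → area (cut W H x y) ≡ W * H - (W - x) * y
  cut-area {W} {H} {x} {y} = trans (cross-expand 0ℤ y W 0ℤ x H) (expand W H x y)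
    where
    expand : ∀ W H x y → (W - 0ℤ) * (H - y) - (0ℤ - y) * (x - 0ℤ) ≡ W * H - (W - x) * y
    expand = solve-∀

  area-positive : ∀ {W H p q} → 0ℤ ≤ q → 0ℤ < W → p ≤ W → q < H → 0ℤ < W * H - p * q
  area-positive {W} {H} {p} {q} 0≤q 0<W p≤W q<H =
    <-by (gap< 0<W ⊗ (gap< q<H ⊕ 0≤+ {1}) ⊕ gap< q<H ⊕ 0≤q ⊗ gap p≤W) (solve (W ∷ H ∷ p ∷ q ∷ []))

  -- Both expressions are positive by `area-positive`, so equality up to sign is equality, and the
  -- common term `W H` cancels.
  product-unique : ∀ {W H p q p′ q′} → 0ℤ < W → 0ℤ ≤ q → p ≤ W → q < H → 0ℤ ≤ q′ → p′ ≤ W → q′ < H →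
    W * H - p′ * q′ ≡± W * H - p * q → p * q ≡ p′ * q′
  product-unique {W} {H} {p} {q} {p′} {q′} 0<W 0≤q p≤W q<H 0≤q′ p′≤W q′<H eq =
    cancel (W * H) (p * q) (p′ * q′) (same-sign (area-positive 0≤q′ 0<W p′≤W q′<H) (area-positive 0≤q 0<W p≤W q<H) eq)
    where
    cancel : ∀ c a b → c - b ≡ c - a → a ≡ b
    cancel c a b eq = ≡-from (zero-gap eq) (solve (c ∷ a ∷ b ∷ []))

  corner-area-unique : ∀ {W H x y y′} → 0ℤ < W → 0ℤ < x → x ≤ W → 0ℤ ≤ y → y < H → 0ℤ ≤ y′ → y′ < H →
    corner W H x y ≅ corner W H x y′ → y ≡ y′
  corner-area-unique {W} {H} {x} {y} {y′} 0<W 0<x x≤W 0≤y y<H 0≤y′ y′<H e = cancel-positive 0<x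
    (product-unique 0<W 0≤y x≤W y<H 0≤y′ x≤W y′<H
      (subst₂ _≡±_ (corner-area {W} {H} {x} {y′}) (corner-area {W} {H} {x} {y}) (area-invariant e)))

  cut-area-unique : ∀ {W H x y y′} → 0ℤ < W → 0ℤ ≤ x → x < W → 0ℤ ≤ y → y < H → 0ℤ ≤ y′ → y′ < H →
    cut W H x y ≅ cut W H x y′ → y ≡ y′
  cut-area-unique {W} {H} {x} {y} {y′} 0<W 0≤x x<W 0≤y y<H 0≤y′ y′<H e = cancel-positive {W - x}
    (<-by (gap< x<W) (solve (W ∷ x ∷ [])))
    (product-unique 0<W 0≤y W-x≤W y<H 0≤y′ W-x≤W y′<H
      (subst₂ _≡±_ (cut-area {W} {H} {x} {y′}) (cut-area {W} {H} {x} {y}) (area-invariant e)))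
    where
    W-x≤W : W - x ≤ W
    W-x≤W = ≤-by 0≤x (solve (W ∷ x ∷ []))

  -- Width `H` forces `c = 0`. For `c < 0` the values at `#2` and `#1` differ by `H - c (W - x)`,
  -- for `c > 0` those at `#2` and `#0` differ by `H + c x - y`, and both exceed `H`.
  cut-mid : ∀ {W H x y c m} → 0ℤ < y → y < x → x < W → W < H → Profile (cut W H x y) (c , 1ℤ) H m → m ≡ y
  cut-mid {W} {H} {x} {y} {c} {m} 0<y y<x x<W W<H P = go (compare c 0ℤ) (Profile-bound P #2 #0) (Profile-bound P #2 #1)
    where
    0≤x : 0ℤ ≤ x
    0≤x = ℤ.≤-trans (ℤ.<⇒≤ 0<y) (ℤ.<⇒≤ y<x)
    go : c < 0ℤ ⊎ c ≡ 0ℤ ⊎ 0ℤ < c →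
         c * x + 1ℤ * H - (c * 0ℤ + 1ℤ * y) ≤ H → c * x + 1ℤ * H - (c * W + 1ℤ * 0ℤ) ≤ H → m ≡ y
    go (inj₁ c<0) _ h = absurd-by (gap h ⊕ gap< c<0 ⊗ gap (ℤ.<⇒≤ x<W) ⊕ gap< x<W) (solve (c ∷ W ∷ H ∷ x ∷ []))
    go (inj₂ (inj₁ refl)) _ _ = Profile-unique P (cut-profile₂ {W} {H} {x} (ℤ.<⇒≤ 0<y)
      (ℤ.≤-trans (ℤ.<⇒≤ y<x) (ℤ.≤-trans (ℤ.<⇒≤ x<W) (ℤ.<⇒≤ W<H))))
    go (inj₂ (inj₂ 0<c)) h _ = absurd-by (gap h ⊕ gap< 0<c ⊗ 0≤x ⊕ gap< y<x) (solve (c ∷ H ∷ x ∷ y ∷ []))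

  -- Both apices lie in the left half, so `x = x′`, and `cut-mid` leaves `y′ = y` or `H - y′ = y`.
  -- In the first case equal areas mean `(W - x) y = x y`, against `2 x < W` and `0 < y`. In the
  -- second `y′ = H - y > W - x`.
  cut≇corner : ∀ {W H x y x′ y′} → W < H → + 2 * x < W → 0ℤ < y → y < x →
    0ℤ ≤ x′ → + 2 * x′ ≤ W → 0ℤ ≤ y′ → y′ ≤ W - x′ → ¬ (cut W H x y ≅ corner W H x′ y′)
  cut≇corner {W} {H} {x} {y} {x′} {y′} W<H 2x<W 0<y y<x 0≤x′ 2x′≤W 0≤y′ y′≤W-x′ e =
    go (proj₂ frame′) (half-unique (ℤ.<⇒≤ 2x<W) 2x′≤W (proj₁ frame′))
    where
    0≤y : 0ℤ ≤ y
    0≤y = ℤ.<⇒≤ 0<y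
    0≤x : 0ℤ ≤ x
    0≤x = ℤ.≤-trans 0≤y (ℤ.<⇒≤ y<x)
    x<W : x < W
    x<W = <-by (gap< 2x<W ⊕ 0≤x) (solve (W ∷ x ∷ []))
    y<H : y < H
    y<H = ℤ.<-trans y<x (ℤ.<-trans x<W W<H)
    y′≤W : y′ ≤ W
    y′≤W = ≤-by (gap y′≤W-x′ ⊕ 0≤x′) (solve (W ∷ x′ ∷ y′ ∷ []))
    frame′ = oblong-frame W<H (cut-spread (ℤ.<⇒≤ W<H) 0≤x (ℤ.<⇒≤ x<W) (ℤ.<⇒≤ y<x)) e
      (cut-profile₁ {y = y} 0≤x (ℤ.<⇒≤ x<W)) (corner-profile₁ {y = y′} 0≤x′ (double-bound 0≤x′ 2x′≤W))
      (corner-profile₂ {x = x′} 0≤y′ (ℤ.≤-trans y′≤W (ℤ.<⇒≤ W<H)))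
    go : (∃ λ c → Profile (cut W H x y) (c , 1ℤ) H y′ ⊎ Profile (cut W H x y) (c , 1ℤ) H (H - y′)) → x ≡ x′ → ⊥
    go (c , inj₁ P) refl = equal-areas
        (product-unique (ℤ.≤-<-trans 0≤x x<W) 0≤y W-x≤W y<H 0≤y′ (ℤ.<⇒≤ x<W) (ℤ.≤-<-trans y′≤W W<H)
          (subst₂ _≡±_ (corner-area {W} {H} {x} {y′}) (cut-area {W} {H} {x} {y}) (area-invariant e)))
        (cut-mid 0<y y<x x<W W<H P)
      where
      W-x≤W : W - x ≤ W
      W-x≤W = ≤-by 0≤x (solve (W ∷ x ∷ []))
      equal-areas : (W - x) * y ≡ x * y′ → y′ ≡ y → ⊥
      equal-areas eq eq′ = absurd-by (gap< 2x<W ⊗ 0≤y ⊕ gap< 0<y ⊕ gap≡ eq ⊕ 0≤x ⊗ gap≡ eq′) (solve (W ∷ x ∷ y ∷ y′ ∷ []))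
    go (c , inj₂ P) refl = far (cut-mid 0<y y<x x<W W<H P)
      where
      far : H - y′ ≡ y → ⊥
      far eq = absurd-by (gap≡ eq ⊕ gap y′≤W-x′ ⊕ gap< W<H ⊕ gap (ℤ.<⇒≤ y<x)) (solve (W ∷ H ∷ x ∷ y ∷ y′ ∷ []))

  -- The common shape of the members for `w₁ = w₂`. The row `x = 0` is `c1`: there the remainder of
  -- `W - y` is `W - y` itself for `0 < y < W`, so the condition of `c1` amounts to `edge`.
  record Square (W x y : ℤ) : Set where
    field
      0<W   : 0ℤ < W
      0≤x   : 0ℤ ≤ x
      x≤y   : x ≤ y
      x+y≤W : x + y ≤ W
      edge  : x ≡ 0ℤ → + 2 * y ≤ W
    0≤y : 0ℤ ≤ y
    0≤y = ℤ.≤-trans 0≤x x≤y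
    2x≤W : + 2 * x ≤ W
    2x≤W = ≤-by (gap x≤y ⊕ gap x+y≤W) (solve (W ∷ x ∷ y ∷ []))
    x<W : x < W
    x<W = [ high-case , (λ h → h) ]′ (≤⊎> W x)
      where
      high-case : W ≤ x → x < W
      high-case W≤x = absurd-by (gap 2x≤W ⊕ gap W≤x ⊕ gap W≤x ⊕ gap< 0<W) (solve (W ∷ x ∷ []))
    y<W : y < W
    y<W = [ high-case , (λ h → h) ]′ (≤⊎> W y)
      where
      high-case : W ≤ y → y < W
      high-case W≤y = absurd-by (gap 2y≤W ⊕ gap W≤y ⊕ gap W≤y ⊕ gap< 0<W) (solve (W ∷ y ∷ []))
        where
        2y≤W : + 2 * y ≤ W
        2y≤W = edge (ℤ.≤-antisym (≤-by (gap x+y≤W ⊕ gap W≤y) (solve (W ∷ x ∷ y ∷ []))) 0≤x)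

  Mid : (W x y m : ℤ) → Set
  Mid W x y m = (m ≡ x ⊎ m ≡ W - x) ⊎ (m ≡ y ⊎ m ≡ W - y)

  Mid-neg : ∀ {W x y m} → Mid W x y (W - m) → Mid W x y m
  Mid-neg {W} {x} {y} {m} = [ inj₁ ∘ flip′ x , inj₂ ∘ flip′ y ]′
    where
    flip′ : ∀ z → W - m ≡ z ⊎ W - m ≡ W - z → m ≡ z ⊎ m ≡ W - z
    flip′ z (inj₁ eq) = inj₂ (≡-from (zero-gap (sym eq)) (solve (W ∷ m ∷ z ∷ [])))
    flip′ z (inj₂ eq) = inj₁ (≡-from (zero-gap (sym eq)) (solve (W ∷ m ∷ z ∷ [])))

  -- The functionals of width W on such a triangle are ±e₁, ±e₂, ±(1,-1) if x + y = W, and ±(1,1) if x = y = 0.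
  square-mid : ∀ {W x y} → Square W x y → ∀ a b {m} → Profile (corner W W x y) (a , b) W m → Mid W x y m
  square-mid {W} {x} {y} sq a b {m} P = sign-a (compare a 0ℤ) P
    where
    open Square sq
    T = corner W W x y
    P₁ : Profile T e₁ W x
    P₁ = corner-profile₁ {y = y} 0≤x (ℤ.<⇒≤ x<W)
    P₂ : Profile T e₂ W y
    P₂ = corner-profile₂ {W} {x = x} 0≤y (ℤ.<⇒≤ y<W)
    0≤W : 0ℤ ≤ W
    0≤W = ℤ.<⇒≤ 0<W
    one : ∀ {a} → 0ℤ < a → ¬ (1ℤ < a) → a ≡ 1ℤ
    one 0<a ¬1<a = ℤ.≤-antisym (ℤ.≮⇒≥ ¬1<a) (ℤ.i<j⇒suc[i]≤j 0<a)

    vertical : ∀ b {m} → 0ℤ < b → Profile T (0ℤ , b) W m → Mid W x y m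
    vertical b 0<b P = at-one (one 0<b too-big) P
      where
      too-big : ¬ (1ℤ < b)
      too-big 1<b = contra (Profile-bound P #2 #0)
        where
        contra : 0ℤ * x + b * W - (0ℤ * 0ℤ + b * 0ℤ) ≤ W → ⊥
        contra h = absurd-by (gap h ⊕ gap< 1<b ⊗ 0≤W ⊕ gap< 0<W) (solve (b ∷ W ∷ x ∷ []))
      at-one : ∀ {b m} → b ≡ 1ℤ → Profile T (0ℤ , b) W m → Mid W x y m
      at-one refl P = inj₂ (inj₁ (Profile-unique P P₂))

    horizontal : ∀ a {m} → 0ℤ < a → Profile T (a , 0ℤ) W m → Mid W x y m
    horizontal a 0<a P = at-one (one 0<a too-big) P
      where
      too-big : ¬ (1ℤ < a)
      too-big 1<a = contra (Profile-bound P #1 #0)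
        where
        contra : a * W + 0ℤ * y - (a * 0ℤ + 0ℤ * 0ℤ) ≤ W → ⊥
        contra h = absurd-by (gap h ⊕ gap< 1<a ⊗ 0≤W ⊕ gap< 0<W) (solve (a ∷ W ∷ y ∷ []))
      at-one : ∀ {a m} → a ≡ 1ℤ → Profile T (a , 0ℤ) W m → Mid W x y m
      at-one refl P = inj₁ (inj₁ (Profile-unique P P₁))

    sum-case : ∀ a b {m} → 0ℤ < a → 0ℤ < b → Profile T (a , b) W m → Mid W x y m
    sum-case a b {m} 0<a 0<b P = finish (one 0<a a-big) (one 0<b b-big) (Profile-bound P #1 #0) P
      where
      bound₁ : a * W + b * y - (a * 0ℤ + b * 0ℤ) ≤ W
      bound₁ = Profile-bound P #1 #0
      bound₂ : a * x + b * W - (a * 0ℤ + b * 0ℤ) ≤ W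
      bound₂ = Profile-bound P #2 #0
      a-big : ¬ (1ℤ < a)
      a-big 1<a = absurd-by (gap bound₁ ⊕ gap< 1<a ⊗ 0≤W ⊕ gap (ℤ.<⇒≤ 0<b) ⊗ 0≤y ⊕ gap< 0<W) (solve (a ∷ b ∷ W ∷ y ∷ []))
      b-big : ¬ (1ℤ < b)
      b-big 1<b = absurd-by (gap bound₂ ⊕ gap< 1<b ⊗ 0≤W ⊕ gap (ℤ.<⇒≤ 0<a) ⊗ 0≤x ⊕ gap< 0<W) (solve (a ∷ b ∷ W ∷ x ∷ []))
      finish : ∀ {a b} → a ≡ 1ℤ → b ≡ 1ℤ → a * W + b * y - (a * 0ℤ + b * 0ℤ) ≤ W → Profile T (a , b) W m → Mid W x y m
      -- The values are `0 , W , W`, so the middle one is `W`, which equals `W - x` because `x = 0`.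
      finish refl refl h P = inj₁ (inj₂ (trans (Profile-unique P P′) (≡-from (zero-gap x≡0) (solve (W ∷ x ∷ [])))))
        where
        y≡0 : y ≡ 0ℤ
        y≡0 = ℤ.≤-antisym (≤-by (gap h) (solve (W ∷ y ∷ []))) 0≤y
        x≡0 : x ≡ 0ℤ
        x≡0 = ℤ.≤-antisym (subst (x ≤_) y≡0 x≤y) 0≤x
        value₁ : 1ℤ * W + 1ℤ * y ≡ 0ℤ + W
        value₁ = ≡-from (-1ℤ ⊠ zero-gap (sym y≡0)) (solve (W ∷ y ∷ []))
        value₂ : 1ℤ * x + 1ℤ * W ≡ 0ℤ + W
        value₂ = ≡-from (-1ℤ ⊠ zero-gap (sym x≡0)) (solve (W ∷ x ∷ []))
        P′ : Profile T (1ℤ , 1ℤ) W W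
        P′ = profile₃ {T} {1ℤ , 1ℤ} {0ℤ} a012 refl value₁ value₂ 0≤W ℤ.≤-refl

    difference-case : ∀ a b {m} → 0ℤ < a → 0ℤ < b → Profile T (a , - b) W m → Mid W x y m
    difference-case a b {m} 0<a 0<b P = finish (one 0<a a-big) (one 0<b b-big) (Profile-bound P #1 #2) P
      where
      bound : a * W + - b * y - (a * x + - b * W) ≤ W
      bound = Profile-bound P #1 #2
      a-big : ¬ (1ℤ < a)
      a-big 1<a = absurd-by (gap bound ⊕ gap< 1<a ⊗ gap (ℤ.<⇒≤ x<W) ⊕ gap< 0<b ⊗ gap (ℤ.<⇒≤ y<W) ⊕ gap x+y≤W ⊕ gap< x<W)
        (solve (a ∷ b ∷ W ∷ x ∷ y ∷ []))
      b-big : ¬ (1ℤ < b)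
      b-big 1<b = absurd-by (gap bound ⊕ gap< 0<a ⊗ gap (ℤ.<⇒≤ x<W) ⊕ gap< 1<b ⊗ gap (ℤ.<⇒≤ y<W) ⊕ gap x+y≤W ⊕ gap< y<W)
        (solve (a ∷ b ∷ W ∷ x ∷ y ∷ []))
      finish : ∀ {a b} → a ≡ 1ℤ → b ≡ 1ℤ → a * W + - b * y - (a * x + - b * W) ≤ W → Profile T (a , - b) W m → Mid W x y m
      -- With `x + y = W` the values at `#2`, `#0`, `#1` are `x - W`, `0`, `x`, so the middle one is
      -- `W - x` above the lowest.
      finish refl refl h P = inj₁ (inj₂ (Profile-unique P P′))
        where
        x+y≡W : x + y ≡ W
        x+y≡W = ℤ.≤-antisym x+y≤W (≤-by (gap h) (solve (W ∷ x ∷ y ∷ [])))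
        value₂ : 1ℤ * x + - 1ℤ * W ≡ x - W
        value₂ = solve (W ∷ x ∷ [])
        value₀ : 0ℤ ≡ x - W + (W - x)
        value₀ = solve (W ∷ x ∷ [])
        value₁ : 1ℤ * W + - 1ℤ * y ≡ x - W + W
        value₁ = ≡-from (-1ℤ ⊠ zero-gap x+y≡W) (solve (W ∷ x ∷ y ∷ []))
        P′ : Profile T (1ℤ , - 1ℤ) W (W - x)
        P′ = profile₃ {T} {1ℤ , - 1ℤ} {x - W} a201 value₂ value₀ value₁ (gap (ℤ.<⇒≤ x<W)) (≤-by 0≤x (solve (W ∷ x ∷ [])))

    positive-a : ∀ a b {m} → 0ℤ < a → b < 0ℤ ⊎ b ≡ 0ℤ ⊎ 0ℤ < b → Profile T (a , b) W m → Mid W x y m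
    positive-a a b {m} 0<a (inj₁ b<0) P = difference-case a (- b) 0<a (ℤ.neg-mono-< b<0)
      (subst (λ b → Profile T (a , b) W m) (sym (ℤ.neg-involutive b)) P)
    positive-a a b 0<a (inj₂ (inj₁ refl)) P = horizontal a 0<a P
    positive-a a b 0<a (inj₂ (inj₂ 0<b)) P = sum-case a b 0<a 0<b P

    zero-a : ∀ b {m} → b < 0ℤ ⊎ b ≡ 0ℤ ⊎ 0ℤ < b → Profile T (0ℤ , b) W m → Mid W x y m
    zero-a b (inj₁ b<0) P = Mid-neg {W} (vertical (- b) (ℤ.neg-mono-< b<0) (Profile-neg P))
    zero-a b (inj₂ (inj₁ refl)) P = ⊥-elim (ℤ.<-irrefl (sym flat) 0<W)
      where
      value : ∀ p → (0ℤ , 0ℤ) · p ≡ 0ℤ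
      value (x , y) = expand x y
        where
        expand : ∀ x y → 0ℤ * x + 0ℤ * y ≡ 0ℤ
        expand = solve-∀
      flat : W ≡ 0ℤ
      flat with Range-attained (range P)
      ... | i , j , eq = trans (sym eq) (cong₂ _-_ (value (T i)) (value (T j)))
    zero-a b (inj₂ (inj₂ 0<b)) P = vertical b 0<b P

    sign-a : a < 0ℤ ⊎ a ≡ 0ℤ ⊎ 0ℤ < a → Profile T (a , b) W m → Mid W x y m
    sign-a (inj₁ a<0) P = Mid-neg {W} (positive-a (- a) (- b) (ℤ.neg-mono-< a<0) (compare (- b) 0ℤ) (Profile-neg P))
    sign-a (inj₂ (inj₁ refl)) P = zero-a b (compare b 0ℤ) P
    sign-a (inj₂ (inj₂ 0<a)) P = positive-a a b 0<a (compare b 0ℤ) P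

  square-mids : ∀ {W x y x′ y′} → Square W x y → Square W x′ y′ → corner W W x y ≅ corner W W x′ y′ →
    Mid W x y x′ × Mid W x y y′
  square-mids {W} {x} {y} {x′} {y′} sq sq′ e = go (frame e)
    where
    module S = Square sq′
    T = corner W W x y
    T′ = corner W W x′ y′
    go : (∃₂ λ u v → det u v ≡± 1ℤ ×
      (∀ {w m} → Profile T′ e₁ w m → Profile T u w m) × (∀ {w m} → Profile T′ e₂ w m → Profile T v w m)) →
      Mid W x y x′ × Mid W x y y′
    go ((a , b) , (c , d) , _ , pull₁ , pull₂) =
      square-mid sq a b (pull₁ (corner-profile₁ {y = y′} S.0≤x (ℤ.<⇒≤ S.x<W))) ,
      square-mid sq c d (pull₂ (corner-profile₂ {x = x′} S.0≤y (ℤ.<⇒≤ S.y<W)))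

  -- The smallest of the candidate middle values `x`, `W - x`, `y`, `W - y` is `x`, so `x = x′` by
  -- symmetry. For `x > 0` the area `W W - x y` then determines `y`. For `x = 0` the area does not
  -- involve `y`; the middle values give `y = y′` or `y = W - y′`, and `edge` decides.
  square-unique : ∀ {W x y x′ y′} → Square W x y → Square W x′ y′ → corner W W x y ≅ corner W W x′ y′ →
    x ≡ x′ × y ≡ y′
  square-unique {W} {x} {y} {x′} {y′} sq sq′ e = x≡x′ , go (≤⇒≡⊎< S.0≤x) x≡x′ e
    where
    module S = Square sq
    module S′ = Square sq′
    mids : Mid W x y x′ × Mid W x y y′
    mids = square-mids sq sq′ e
    mids′ : Mid W x′ y′ x × Mid W x′ y′ y
    mids′ = square-mids sq′ sq (≅-sym e)
    smallest : ∀ {W x y m} → Square W x y → Mid W x y m → x ≤ m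
    smallest sq (inj₁ (inj₁ refl)) = ℤ.≤-refl
    smallest {W} {x} sq (inj₁ (inj₂ refl)) = ≤-by (gap (Square.2x≤W sq)) (solve (W ∷ x ∷ []))
    smallest sq (inj₂ (inj₁ refl)) = Square.x≤y sq
    smallest {W} {x} {y} sq (inj₂ (inj₂ refl)) = ≤-by (gap (Square.x+y≤W sq)) (solve (W ∷ x ∷ y ∷ []))
    x≡x′ : x ≡ x′
    x≡x′ = ℤ.≤-antisym (smallest sq (proj₁ mids)) (smallest sq′ (proj₁ mids′))
    swap : ∀ {a b} → a ≡ W - b → b ≡ W - a
    swap {a} {b} eq = ≡-from (zero-gap eq) (solve (W ∷ a ∷ b ∷ []))
    complement : x ≡ x′ → Mid W x y y′ → Mid W x′ y′ y → y ≡ y′ ⊎ y ≡ W - y′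
    complement _ (inj₂ (inj₁ eq)) _ = inj₁ (sym eq)
    complement _ (inj₂ (inj₂ eq)) _ = inj₂ (swap eq)
    complement _ _ (inj₂ (inj₁ eq)) = inj₁ eq
    complement _ _ (inj₂ (inj₂ eq)) = inj₂ eq
    -- From here on `y′` is `x` or `W - x` and `y` is `x′` or `W - x′`; since `x = x′`, they agree
    -- or are complementary.
    complement refl (inj₁ (inj₁ refl)) (inj₁ (inj₁ eq)) = inj₁ eq
    complement refl (inj₁ (inj₁ refl)) (inj₁ (inj₂ eq)) = inj₂ eq
    complement refl (inj₁ (inj₂ y′≡)) (inj₁ (inj₁ eq)) = inj₂ (trans eq (swap y′≡))
    complement refl (inj₁ (inj₂ y′≡)) (inj₁ (inj₂ eq)) = inj₁ (trans eq (sym y′≡))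
    go : 0ℤ ≡ x ⊎ 0ℤ < x → x ≡ x′ → corner W W x y ≅ corner W W x′ y′ → y ≡ y′
    go (inj₂ 0<x) refl e = corner-area-unique S.0<W 0<x (ℤ.<⇒≤ S.x<W) S.0≤y S.y<W S′.0≤y S′.y<W e
    go (inj₁ 0≡x) eq _ = sym (half-unique (S′.edge (sym (trans 0≡x eq))) (S.edge (sym 0≡x))
      (complement x≡x′ (proj₂ mids) (proj₂ mids′)))

  edge-square : ∀ {k y} → 0ℤ ≤ y → y ≤ + ((+ suc k - y) %ℕ suc k) → Square (+ suc k) 0ℤ y
  edge-square {k} {y} 0≤y y≤r = record
    { 0<W = +<+ (ℕ.s≤s ℕ.z≤n) ; 0≤x = ℤ.≤-refl ; x≤y = 0≤y
    ; x+y≤W = subst (_≤ W) (sym (ℤ.+-identityˡ y)) (ℤ.<⇒≤ (c1-bound {w₂ = suc k} y≤r))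
    ; edge = λ _ → go (≤⇒≡⊎< 0≤y) }
    where
    W : ℤ
    W = + suc k
    double : ∀ {W y} → y ≤ W - y → + 2 * y ≤ W
    double {W} {y} h = ≤-by (gap h) (solve (W ∷ y ∷ []))
    trivial-quotient : ∀ W y → W - y ≡ W - y + 0ℤ * W
    trivial-quotient = solve-∀
    below : ∀ {W y} → 0ℤ < y → W - y < W
    below {W} {y} 0<y = <-by (gap< 0<y) (solve (W ∷ y ∷ []))
    go : 0ℤ ≡ y ⊎ 0ℤ < y → + 2 * y ≤ W
    go (inj₁ refl) = 0≤+
    go (inj₂ 0<y) = double (subst (y ≤_)
      (%ℕ-unique 0ℤ (trivial-quotient W y) (gap (ℤ.<⇒≤ (c1-bound {w₂ = suc k} y≤r))) (below 0<y)) y≤r)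

  corner-square : ∀ {k x y} → 0ℤ < x → y ≤ + suc k - x → x ≤ y → Square (+ suc k) x y
  corner-square {k} {x} {y} 0<x y≤W-x x≤y = record
    { 0<W = +<+ (ℕ.s≤s ℕ.z≤n) ; 0≤x = ℤ.<⇒≤ 0<x ; x≤y = x≤y
    ; x+y≤W = summed y≤W-x ; edge = λ x≡0 → ⊥-elim (ℤ.<-irrefl (sym x≡0) 0<x) }
    where
    summed : ∀ {W} → y ≤ W - x → x + y ≤ W
    summed {W} h = ≤-by (gap h) (solve (W ∷ x ∷ y ∷ []))

  -- The edge argument at `W = 0`: shears do not move the middle vertex, so `y′` is `y` or `H - y`.
  -- `oblong-frame` requires `0 < H`; otherwise both heights are `0`.
  flat-unique : ∀ {H y y′} → 0ℤ ≤ y → + 2 * y ≤ H → 0ℤ ≤ y′ → + 2 * y′ ≤ H →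
    corner 0ℤ H 0ℤ y ≅ corner 0ℤ H 0ℤ y′ → y ≡ y′
  flat-unique {H} {y} {y′} 0≤y 2y≤H 0≤y′ 2y′≤H e = go (≤⊎> H 0ℤ)
    where
    mid : (∃ λ c → Profile (corner 0ℤ H 0ℤ y) (c , 1ℤ) H y′ ⊎ Profile (corner 0ℤ H 0ℤ y) (c , 1ℤ) H (H - y′)) →
          y ≡ y′ ⊎ y ≡ H - y′
    mid (c , inj₁ P) = inj₁ (sym (trans (edge-mid P) (absorb y c)))
      where
      absorb : ∀ y c → y + c * 0ℤ ≡ y
      absorb = solve-∀
    mid (c , inj₂ P) = inj₂ (sym (trans (edge-mid P) (absorb y c)))
      where
      absorb : ∀ y c → y + c * 0ℤ ≡ y
      absorb = solve-∀
    vanish : ∀ {y} → H ≤ 0ℤ → 0ℤ ≤ y → + 2 * y ≤ H → y ≡ 0ℤ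
    vanish {y} H≤0 0≤y 2y≤H = ℤ.≤-antisym (≤-by (gap H≤0 ⊕ gap 2y≤H ⊕ 0≤y) (solve (H ∷ y ∷ []))) 0≤y
    go : H ≤ 0ℤ ⊎ 0ℤ < H → y ≡ y′
    go (inj₁ H≤0) = trans (vanish H≤0 0≤y 2y≤H) (sym (vanish H≤0 0≤y′ 2y′≤H))
    go (inj₂ 0<H) = sym (half-unique 2y′≤H 2y≤H (mid (proj₂ (oblong-frame 0<H (edge-spread {y = y} (ℤ.<⇒≤ 0<H)) e
      (corner-profile₁ {y = y} ℤ.≤-refl ℤ.≤-refl) (corner-profile₁ {y = y′} ℤ.≤-refl ℤ.≤-refl)
      (corner-profile₂ {x = 0ℤ} 0≤y′ (double-bound 0≤y′ 2y′≤H))))))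

  corner-x-unique : ∀ {W H x y x′ y′} → W < H →
    0ℤ ≤ x → + 2 * x ≤ W → (∀ a b → 0ℤ < b → Spread (corner W H x y) H (a , b)) →
    0ℤ ≤ x′ → + 2 * x′ ≤ W → 0ℤ ≤ y′ → y′ ≤ H → corner W H x y ≅ corner W H x′ y′ → x ≡ x′
  corner-x-unique {y = y} {y′ = y′} W<H 0≤x 2x≤W spread 0≤x′ 2x′≤W 0≤y′ y′≤H e = half-unique 2x≤W 2x′≤W
    (proj₁ (oblong-frame W<H spread e (corner-profile₁ {y = y} 0≤x (double-bound 0≤x 2x≤W))
      (corner-profile₁ {y = y′} 0≤x′ (double-bound 0≤x′ 2x′≤W)) (corner-profile₂ 0≤y′ y′≤H)))

  cut-x-unique : ∀ {W H x y x′ y′} → W < H → + 2 * x < W → 0ℤ < y → y < x → + 2 * x′ < W → 0ℤ < y′ → y′ < x′ →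
    cut W H x y ≅ cut W H x′ y′ → x ≡ x′
  cut-x-unique {W} {H} {x} {y} {x′} {y′} W<H 2x<W 0<y y<x 2x′<W 0<y′ y′<x′ e =
    half-unique (ℤ.<⇒≤ 2x<W) (ℤ.<⇒≤ 2x′<W)
      (proj₁ (oblong-frame W<H (cut-spread (ℤ.<⇒≤ W<H) 0≤x x≤W (ℤ.<⇒≤ y<x)) e
        (cut-profile₁ {y = y} 0≤x x≤W) (cut-profile₁ {y = y′} 0≤x′ x′≤W)
        (cut-profile₂ {x = x′} (ℤ.<⇒≤ 0<y′) (ℤ.≤-trans (ℤ.<⇒≤ y′<x′) (ℤ.≤-trans x′≤W (ℤ.<⇒≤ W<H))))))
    where
    0≤x : 0ℤ ≤ x
    0≤x = ℤ.≤-trans (ℤ.<⇒≤ 0<y) (ℤ.<⇒≤ y<x)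
    x≤W : x ≤ W
    x≤W = double-bound 0≤x (ℤ.<⇒≤ 2x<W)
    0≤x′ : 0ℤ ≤ x′
    0≤x′ = ℤ.≤-trans (ℤ.<⇒≤ 0<y′) (ℤ.<⇒≤ y′<x′)
    x′≤W : x′ ≤ W
    x′≤W = double-bound 0≤x′ (ℤ.<⇒≤ 2x′<W)

  -- The middle value of `e₁` determines the apex up to mirroring, and the apex lies in the left
  -- half. The area then gives the other parameter, except on `c1`, where it is always `W H` and
  -- `edge-unique` takes over.
  oblong-injective : ∀ {k w₂} → suc k ℕ.< w₂ → ∀ {T T′} → 𝒮 (suc k) w₂ T → 𝒮 (suc k) w₂ T′ → T ≅ T′ → T ≡ T′
  oblong-injective {k} {w₂} w₁<w₂ = λ where
      (c1 y 0≤y y≤r) (c1 y′ 0≤y′ y′≤r′) e → cong (corner W H 0ℤ) (edge-unique w₁<w₂ 0≤y y≤r 0≤y′ y′≤r′ e)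
      (c1 y 0≤y y≤r) (c2 x′ y′ 0<x′ 2x′≤W 0≤y′ y′≤ _) e → ⊥-elim (edge≇corner y 0<x′ 2x′≤W 0≤y′ y′≤ e)
      (c2 x y 0<x 2x≤W 0≤y y≤ _) (c1 y′ 0≤y′ y′≤r′) e → ⊥-elim (edge≇corner y′ 0<x 2x≤W 0≤y y≤ (≅-sym e))
      (c2 x y 0<x 2x≤W 0≤y y≤ _) (c2 x′ y′ 0<x′ 2x′≤W 0≤y′ y′≤ _) e →
        corners x y 0<x 2x≤W 0≤y y≤ x′ y′ 0<x′ 2x′≤W 0≤y′ y′≤ e
      (c3 x y _ _ 2x<W 0<y y<x) (c1 y′ 0≤y′ y′≤r′) e →
        ⊥-elim (cut≇corner W<H 2x<W 0<y y<x ℤ.≤-refl 0≤+ 0≤y′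
          (subst (y′ ≤_) (sym (ℤ.+-identityʳ W)) (ℤ.<⇒≤ (c1-bound y′≤r′))) e)
      (c3 x y _ _ 2x<W 0<y y<x) (c2 x′ y′ 0<x′ 2x′≤W 0≤y′ y′≤ _) e →
        ⊥-elim (cut≇corner W<H 2x<W 0<y y<x (ℤ.<⇒≤ 0<x′) 2x′≤W 0≤y′ y′≤ e)
      (c1 y 0≤y y≤r) (c3 x′ y′ _ _ 2x′<W 0<y′ y′<x′) e →
        ⊥-elim (cut≇corner W<H 2x′<W 0<y′ y′<x′ ℤ.≤-refl 0≤+ 0≤y
          (subst (y ≤_) (sym (ℤ.+-identityʳ W)) (ℤ.<⇒≤ (c1-bound y≤r))) (≅-sym e))
      (c2 x y 0<x 2x≤W 0≤y y≤ _) (c3 x′ y′ _ _ 2x′<W 0<y′ y′<x′) e →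
        ⊥-elim (cut≇corner W<H 2x′<W 0<y′ y′<x′ (ℤ.<⇒≤ 0<x) 2x≤W 0≤y y≤ (≅-sym e))
      (c3 x y _ _ 2x<W 0<y y<x) (c3 x′ y′ _ _ 2x′<W 0<y′ y′<x′) e →
        cuts x y 2x<W 0<y y<x x′ y′ 2x′<W 0<y′ y′<x′ (cut-x-unique W<H 2x<W 0<y y<x 2x′<W 0<y′ y′<x′ e) e
    where
    W H : ℤ
    W = + suc k
    H = + w₂
    W<H : W < H
    W<H = +<+ w₁<w₂
    0<W : 0ℤ < W
    0<W = +<+ (ℕ.s≤s ℕ.z≤n)
    bounded : ∀ {W x y} → 0ℤ ≤ x → y ≤ W - x → y ≤ W
    bounded {W} {x} {y} 0≤x h = ≤-by (0≤x ⊕ gap h) (solve (W ∷ x ∷ y ∷ []))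
    summed : ∀ {W x y} → y ≤ W - x → x + y ≤ W
    summed {W} {x} {y} h = ≤-by (gap h) (solve (W ∷ x ∷ y ∷ []))
    edge≇corner : ∀ y {x′ y′} → 0ℤ < x′ → + 2 * x′ ≤ W → 0ℤ ≤ y′ → y′ ≤ W - x′ → ¬ (corner W H 0ℤ y ≅ corner W H x′ y′)
    edge≇corner y {x′} {y′} 0<x′ 2x′≤W 0≤y′ y′≤ e = ℤ.<-irrefl
      (corner-x-unique {y = y} W<H ℤ.≤-refl 0≤+ (edge-spread {y = y} 0≤+) (ℤ.<⇒≤ 0<x′) 2x′≤W 0≤y′
        (ℤ.≤-trans (bounded (ℤ.<⇒≤ 0<x′) y′≤) (ℤ.<⇒≤ W<H)) e) 0<x′
    corners : ∀ x y → 0ℤ < x → + 2 * x ≤ W → 0ℤ ≤ y → y ≤ W - x →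
              ∀ x′ y′ → 0ℤ < x′ → + 2 * x′ ≤ W → 0ℤ ≤ y′ → y′ ≤ W - x′ →
              corner W H x y ≅ corner W H x′ y′ → corner W H x y ≡ corner W H x′ y′
    corners x y 0<x 2x≤W 0≤y y≤ x′ y′ 0<x′ 2x′≤W 0≤y′ y′≤ e = same x≡x′ e
      where
      y<H : y < H
      y<H = ℤ.≤-<-trans (bounded (ℤ.<⇒≤ 0<x) y≤) W<H
      y′<H : y′ < H
      y′<H = ℤ.≤-<-trans (bounded (ℤ.<⇒≤ 0<x′) y′≤) W<H
      x≡x′ : x ≡ x′
      x≡x′ = corner-x-unique W<H (ℤ.<⇒≤ 0<x) 2x≤W
        (corner-spread (ℤ.<⇒≤ W<H) (ℤ.<⇒≤ 0<x) 0≤y (summed {W} {x} y≤)) (ℤ.<⇒≤ 0<x′) 2x′≤W 0≤y′ (ℤ.<⇒≤ y′<H) e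
      same : x ≡ x′ → corner W H x y ≅ corner W H x′ y′ → corner W H x y ≡ corner W H x′ y′
      same refl e = cong (corner W H x)
        (corner-area-unique 0<W 0<x (double-bound (ℤ.<⇒≤ 0<x) 2x≤W) 0≤y y<H 0≤y′ y′<H e)
    cuts : ∀ x y → + 2 * x < W → 0ℤ < y → y < x → ∀ x′ y′ → + 2 * x′ < W → 0ℤ < y′ → y′ < x′ →
           x ≡ x′ → cut W H x y ≅ cut W H x′ y′ → cut W H x y ≡ cut W H x′ y′
    cuts x y 2x<W 0<y y<x x′ y′ 2x′<W 0<y′ y′<x′ refl e = cong (cut W H x)
      (cut-area-unique 0<W 0≤x x<W (ℤ.<⇒≤ 0<y) (ℤ.<-trans y<x x<H) (ℤ.<⇒≤ 0<y′) (ℤ.<-trans y′<x′ x<H) e)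
      where
      0≤x : 0ℤ ≤ x
      0≤x = ℤ.≤-trans (ℤ.<⇒≤ 0<y) (ℤ.<⇒≤ y<x)
      less : ∀ {W x} → 0ℤ ≤ x → + 2 * x < W → x < W
      less {W} {x} 0≤x h = <-by (gap< h ⊕ 0≤x) (solve (W ∷ x ∷ []))
      x<W : x < W
      x<W = less 0≤x 2x<W
      x<H : x < H
      x<H = ℤ.<-trans x<W W<H

  𝒮-square : ∀ {k T} → 𝒮 (suc k) (suc k) T →
    ∃₂ λ x y → T ≡ corner (+ suc k) (+ suc k) x y × Square (+ suc k) x y
  𝒮-square (c1 y 0≤y y≤r) = 0ℤ , y , refl , edge-square 0≤y y≤r
  𝒮-square (c2 x y 0<x _ _ y≤W-x x≤y) = x , y , refl , corner-square 0<x y≤W-x (x≤y refl)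
  𝒮-square (c3 _ _ w<w _ _ _ _) = ⊥-elim (ℕ.<-irrefl refl w<w)

  -- Equality of the vertex functions themselves is obtained without extensionality, because every
  -- member is literally `tri` applied to points computed from its parameters.
  𝒮-injective : ∀ {w₁ w₂ T T′} → w₁ ℕ.≤ w₂ → 𝒮 w₁ w₂ T → 𝒮 w₁ w₂ T′ → T ≅ T′ → T ≡ T′
  𝒮-injective {zero} _ (c0 y 0≤y 2y≤H) (c0 y′ 0≤y′ 2y′≤H) e =
    cong (corner 0ℤ _ 0ℤ) (flat-unique 0≤y 2y≤H 0≤y′ 2y′≤H e)
  𝒮-injective {suc k} {w₂} {T} {T′} w₁≤w₂ s s′ e = go (ℕ.m≤n⇒m<n∨m≡n w₁≤w₂) s s′
    where
    squares : (∃₂ λ x y → T ≡ corner (+ suc k) (+ suc k) x y × Square (+ suc k) x y) →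
              (∃₂ λ x y → T′ ≡ corner (+ suc k) (+ suc k) x y × Square (+ suc k) x y) → T ≡ T′
    squares (x , y , refl , sq) (x′ , y′ , refl , sq′) = let (x≡x′ , y≡y′) = square-unique sq sq′ e in
      cong₂ (corner (+ suc k) (+ suc k)) x≡x′ y≡y′
    go : suc k ℕ.< w₂ ⊎ suc k ≡ w₂ → 𝒮 (suc k) w₂ T → 𝒮 (suc k) w₂ T′ → T ≡ T′
    go (inj₁ w₁<w₂) s s′ = oblong-injective w₁<w₂ s s′ e
    go (inj₂ refl) s s′ = squares (𝒮-square s) (𝒮-square s′)

  -- Counting

  -- The index set of an enumeration in rows of varying length: row `x` has `g x` entries. Every
  -- count below is a sum of row lengths.
  table : (ℕ → ℕ) → ℕ → List (ℕ × ℕ)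
  table g zero = []
  table g (suc h) = map (h ,_) (upTo (g h)) ++ table g h

  rowSum : (ℕ → ℕ) → ℕ → ℕ
  rowSum g zero = 0
  rowSum g (suc h) = g h ℕ.+ rowSum g h

  rowSum-suc : ∀ g h → rowSum g (suc h) ≡ rowSum (g ∘ suc) h ℕ.+ g 0
  rowSum-suc g zero = ℕ.+-comm (g 0) 0
  rowSum-suc g (suc h) = trans (cong (g (suc h) ℕ.+_) (rowSum-suc g h)) (sym (ℕ.+-assoc (g (suc h)) _ (g 0)))

  rowSum-const : ∀ c h → rowSum (λ _ → c) h ≡ h ℕ.* c
  rowSum-const c zero = refl
  rowSum-const c (suc h) = cong (c ℕ.+_) (rowSum-const c h)

  table-length : ∀ g h → length (table g h) ≡ rowSum g h
  table-length g zero = refl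
  table-length g (suc h) = trans (length-++ (map (h ,_) (upTo (g h))))
    (cong₂ ℕ._+_ (trans (length-map (h ,_) (upTo (g h))) (length-upTo (g h))) (table-length g h))

  table-∈⁻ : ∀ g h {x z} → (x , z) ∈ table g h → x ℕ.< h × z ℕ.< g x
  table-∈⁻ g (suc h) p with ∈-++⁻ (map (h ,_) (upTo (g h))) p
  ... | inj₂ q = let (x<h , z<gx) = table-∈⁻ g h q in ℕ.m<n⇒m<1+n x<h , z<gx
  ... | inj₁ q with ∈-map⁻ (h ,_) q
  ... | z , z∈ , refl = ℕ.n<1+n h , ∈-upTo⁻ z∈

  table-∈⁺ : ∀ g h {x z} → x ℕ.< h → z ℕ.< g x → (x , z) ∈ table g h
  table-∈⁺ g (suc h) {x} x<1+h z<gx with ℕ.m<1+n⇒m<n∨m≡n x<1+h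
  ... | inj₁ x<h = ∈-++⁺ʳ (map (h ,_) (upTo (g h))) (table-∈⁺ g h x<h z<gx)
  ... | inj₂ refl = ∈-++⁺ˡ (∈-map⁺ (h ,_) (∈-upTo⁺ z<gx))

  table-unique : ∀ g h → Unique (table g h)
  table-unique g zero = []
  table-unique g (suc h) = Unique.++⁺ (Unique.map⁺ (cong proj₂) (Unique.upTo⁺ (g h))) (table-unique g h) disjoint
    where
    disjoint : Disjoint (map (h ,_) (upTo (g h))) (table g h)
    disjoint (p , q) with ∈-map⁻ (h ,_) p
    ... | z , _ , refl = ℕ.<-irrefl refl (proj₁ (table-∈⁻ g h q))

  map-unique : ∀ {A B : Set} (f : A → B) {xs} → (∀ {x y} → x ∈ xs → y ∈ xs → f x ≡ f y → x ≡ y) →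
    Unique xs → Unique (map f xs)
  map-unique f inj [] = []
  map-unique f inj (x∉ ∷ unique) =
    All.map⁺ (All.tabulate λ y∈ eq → All.lookup x∉ y∈ (inj (here refl) (there y∈) eq))
    ∷ map-unique f (λ p q → inj (there p) (there q)) unique

  lookup-injective : ∀ {A : Set} {xs : List A} → Unique xs → ∀ i j → lookup xs i ≡ lookup xs j → i ≡ j
  lookup-injective (_ ∷ _) zero zero _ = refl
  lookup-injective {xs = _ ∷ xs} (x∉ ∷ _) zero (suc j) eq = ⊥-elim (All.lookup x∉ (∈-lookup {xs = xs} j) eq)
  lookup-injective {xs = _ ∷ xs} (x∉ ∷ _) (suc i) zero eq = ⊥-elim (All.lookup x∉ (∈-lookup {xs = xs} i) (sym eq))
  lookup-injective (_ ∷ unique) (suc i) (suc j) eq = cong suc (lookup-injective unique i j eq)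

  -- It suffices to parametrise `𝒮` bijectively by the table. Distinct members are inequivalent by
  -- `𝒮-injective`, and every class is met by `classified`.
  class-count : ∀ {w₁ w₂} → w₁ ℕ.≤ w₂ → (g : ℕ → ℕ) (h : ℕ) (decode : ℕ → ℕ → Triangle) →
    (∀ {x z} → x ℕ.< h → z ℕ.< g x → 𝒮 w₁ w₂ (decode x z)) →
    (∀ {x z x′ z′} → x ℕ.< h → z ℕ.< g x → x′ ℕ.< h → z′ ℕ.< g x′ → decode x z ≡ decode x′ z′ → x ≡ x′ × z ≡ z′) →
    (∀ {T} → 𝒮 w₁ w₂ T → ∃₂ λ x z → x ℕ.< h × z ℕ.< g x × T ≡ decode x z) →
    ClassCount w₁ w₂ (rowSum g h)
  class-count {w₁} {w₂} w₁≤w₂ g h decode sound injective complete =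
    L , trans (length-map code (table g h)) (table-length g h) ,
    (λ i → 𝒮⇒HasWidths w₁≤w₂ (lookup L i) (member i)) ,
    (λ i j e → lookup-injective unique i j (𝒮-injective w₁≤w₂ (member i) (member j) ⌈ e ⌉)) ,
    λ T widths → find (classified {T = T} w₁≤w₂ widths)
    where
    code : ℕ × ℕ → Triangle
    code (x , z) = decode x z
    L : List Triangle
    L = map code (table g h)
    member : ∀ i → 𝒮 w₁ w₂ (lookup L i)
    member i with ∈-map⁻ code (∈-lookup {xs = L} i)
    ... | (x , z) , p , eq = let (x<h , z<gx) = table-∈⁻ g h p in subst (𝒮 w₁ w₂) (sym eq) (sound x<h z<gx)
    unique : Unique L
    unique = map-unique code same (table-unique g h)
      where
      same : ∀ {c c′} → c ∈ table g h → c′ ∈ table g h → code c ≡ code c′ → c ≡ c′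
      same p q eq = let (x<h , z<gx) = table-∈⁻ g h p ; (x′<h , z′<gx′) = table-∈⁻ g h q
                        (x≡ , z≡) = injective x<h z<gx x′<h z′<gx′ eq in cong₂ _,_ x≡ z≡
    find : ∀ {T} → Classified w₁ w₂ T → Σ (Fin (length L)) λ i → AffEquiv T (lookup L i)
    find {T} (T′ , s , e) = let (x , z , x<h , z<gx , eq) = complete s
                                p = subst (_∈ L) (sym eq) (∈-map⁺ code (table-∈⁺ g h x<h z<gx))
      in Any.index p , ⌊ subst (T ≅_) (Any.lookup-index p) e ⌋

  natural : ∀ {y} → 0ℤ ≤ y → ∃ λ n → + n ≡ y
  natural {y} 0≤y = ∣ y ∣ , ℤ.0≤i⇒+∣i∣≡i 0≤y

  halves : ∀ n → + 2 * + (n ℕ./ 2) ≤ + n × + n ≤ + 2 * + (n ℕ./ 2) + 1ℤ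
  halves n = bounds (+ n) (+ (n ℕ./ 2)) (+ (n ℕ.% 2)) (a≡a%ℕn+[a/ℕn]*n (+ n) 2) 0≤+ (+≤+ (ℕ.≤-pred (ℕ.m%n<n n 2)))
    where
    bounds : ∀ n q r → n ≡ r + q * + 2 → 0ℤ ≤ r → r ≤ 1ℤ → + 2 * q ≤ n × n ≤ + 2 * q + 1ℤ
    bounds n q r eq 0≤r r≤1 =
      ≤-by (0≤r ⊕ gap≡ (sym eq)) (solve (n ∷ q ∷ r ∷ [])) , ≤-by (gap r≤1 ⊕ gap≡ eq) (solve (n ∷ q ∷ r ∷ []))

  half-bound : ∀ {n p} → + 2 * + n ≤ + p → n ℕ.< p ℕ./ 2 ℕ.+ 1
  half-bound {n} {p} 2n≤p = ℤ.drop‿+<+ (below (+ n) (+ (p ℕ./ 2)) (+ p) 2n≤p (proj₂ (halves p)))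
    where
    below : ∀ n q p → + 2 * n ≤ p → p ≤ + 2 * q + 1ℤ → n < q + 1ℤ
    below n q p h h′ = [ (λ q<n → absurd n q p h h′ q<n) , (λ n<q+1 → n<q+1) ]′ (≤⊎> (q + 1ℤ) n)
      where
      absurd : ∀ n q p → + 2 * n ≤ p → p ≤ + 2 * q + 1ℤ → q + 1ℤ ≤ n → n < q + 1ℤ
      absurd n q p h h′ q<n = absurd-by (gap h ⊕ gap h′ ⊕ gap q<n ⊕ gap q<n) (solve (n ∷ q ∷ p ∷ []))

  half-bound⁻ : ∀ {n p} → n ℕ.< p ℕ./ 2 ℕ.+ 1 → + 2 * + n ≤ + p
  half-bound⁻ {n} {p} n< = above (+ n) (+ (p ℕ./ 2)) (+ p) (+<+ n<) (proj₁ (halves p))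
    where
    above : ∀ n q p → n < q + 1ℤ → + 2 * q ≤ p → + 2 * n ≤ p
    above n q p h h′ = ≤-by (gap< h ⊕ gap< h ⊕ gap h′) (solve (n ∷ q ∷ p ∷ []))

  -- Enumerations of the normal forms

  apex-x right-y left-y : Triangle → ℤ
  apex-x T = proj₁ (T #2)
  right-y T = proj₂ (T #1)
  left-y T = proj₂ (T #0)

  flat-count : ∀ w₂ → ClassCount 0 w₂ (w₂ ℕ./ 2 ℕ.+ 1)
  flat-count w₂ = subst (ClassCount 0 w₂) (ℕ.+-identityʳ _)
    (class-count ℕ.z≤n (λ _ → w₂ ℕ./ 2 ℕ.+ 1) 1 (λ _ z → corner 0ℤ (+ w₂) 0ℤ (+ z))
      (λ {_} {z} _ z< → c0 (+ z) 0≤+ (half-bound⁻ z<))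
      (λ x<1 _ x′<1 _ eq → trans (ℕ.n<1⇒n≡0 x<1) (sym (ℕ.n<1⇒n≡0 x′<1)) , ℤ.+-injective (cong right-y eq))
      complete)
    where
    complete : ∀ {T} → 𝒮 0 w₂ T → ∃₂ λ x z → x ℕ.< 1 × z ℕ.< w₂ ℕ./ 2 ℕ.+ 1 × T ≡ corner 0ℤ (+ w₂) 0ℤ (+ z)
    complete (c0 y 0≤y 2y≤w₂) = go (natural 0≤y) 2y≤w₂
      where
      go : ∀ {y} → (∃ λ n → + n ≡ y) → + 2 * y ≤ + w₂ →
           ∃₂ λ x z → x ℕ.< 1 × z ℕ.< w₂ ℕ./ 2 ℕ.+ 1 × corner 0ℤ (+ w₂) 0ℤ y ≡ corner 0ℤ (+ w₂) 0ℤ (+ z)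
      go (n , refl) 2n≤w₂ = 0 , n , ℕ.s≤s ℕ.z≤n , half-bound 2n≤w₂ , refl

  half-bound′ : ∀ {n p} → + 2 * (+ n + 1ℤ) ≤ + p → n ℕ.< p ℕ./ 2
  half-bound′ {n} {p} h = ℕ.≤-pred (subst₂ ℕ._<_ (ℕ.+-comm n 1) (ℕ.+-comm (p ℕ./ 2) 1) (half-bound h))

  half-bound′⁻ : ∀ {n p} → n ℕ.< p ℕ./ 2 → + 2 * (+ n + 1ℤ) ≤ + p
  half-bound′⁻ {n} {p} n< = half-bound⁻ {n ℕ.+ 1} (subst₂ ℕ._<_ (ℕ.+-comm 1 n) (ℕ.+-comm 1 (p ℕ./ 2)) (ℕ.s≤s n<))

  edge-member : ∀ {k w₂ y} r q → + w₂ - y ≡ r + q * + suc k → 0ℤ ≤ r → r < + suc k → 0ℤ ≤ y → y ≤ r →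
    𝒮 (suc k) w₂ (corner (+ suc k) (+ w₂) 0ℤ y)
  edge-member {y = y} r q eq 0≤r r<W 0≤y y≤r = c1 y 0≤y (subst (y ≤_) (sym (%ℕ-unique q eq 0≤r r<W)) y≤r)

  square-edge-member : ∀ {k} n → + 2 * + n ≤ + suc k → 𝒮 (suc k) (suc k) (corner (+ suc k) (+ suc k) 0ℤ (+ n))
  -- At `y = 0` the remainder of `W - y` is `0` and not `W - y`, so this height is treated apart.
  square-edge-member zero _ = c1 0ℤ ℤ.≤-refl 0≤+
  square-edge-member {k} (suc n) h = edge-member (+ suc k - + suc n) 0ℤ (expand (+ suc k) (+ suc n))
    (nonneg (+ suc k) (+ suc n) h 0≤+) (below (+ suc k) (+ suc n) (+<+ (ℕ.s≤s ℕ.z≤n))) 0≤+ (fits (+ suc k) (+ suc n) h)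
    where
    expand : ∀ W y → W - y ≡ W - y + 0ℤ * W
    expand = solve-∀
    nonneg : ∀ W y → + 2 * y ≤ W → 0ℤ ≤ y → 0ℤ ≤ W - y
    nonneg W y h 0≤y = ≤-by (gap h ⊕ 0≤y) (solve (W ∷ y ∷ []))
    below : ∀ W y → 0ℤ < y → W - y < W
    below W y 0<y = <-by (gap< 0<y) (solve (W ∷ y ∷ []))
    fits : ∀ W y → + 2 * y ≤ W → y ≤ W - y
    fits W y h = ≤-by (gap h) (solve (W ∷ y ∷ []))

  +-cancel-from : ∀ {h a b : ℤ} → h - a ≡ h - b → a ≡ b
  +-cancel-from {h} {a} {b} eq = ≡-from (zero-gap (sym eq)) (solve (h ∷ a ∷ b ∷ []))

  difference≢0 : ∀ {i h} → i ℕ.< h → 0ℤ ≢ + h - + i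
  difference≢0 {i} {h} i<h eq = ℤ.<-irrefl (sym (ℤ.i-j≡0⇒i≡j (+ h) (+ i) (sym eq))) (+<+ i<h)

  -- Write `W = 2 h + ε`. Row `0` holds the edges with `0 ≤ y ≤ h`. Row `1 + i` holds `x = h - i`
  -- and `y = x + z`, where `x ≤ y ≤ W - x` leaves `W - 2 x + 1 = 2 i + 1 + ε` choices. Counting `x`
  -- down from `h` makes the row lengths independent of `h`.
  square-count : ∀ k h ε → + suc k ≡ + 2 * + h + + ε → ε ℕ.≤ 1 →
    ClassCount (suc k) (suc k) (rowSum (λ i → 2 ℕ.* i ℕ.+ 1 ℕ.+ ε) h ℕ.+ (h ℕ.+ 1))
  square-count k h ε W≡ ε≤1 = subst (ClassCount (suc k) (suc k)) (rowSum-suc g h)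
    (class-count ℕ.≤-refl g (suc h) decode sound injective (complete ∘ 𝒮-square))
    where
    W : ℤ
    W = + suc k
    g : ℕ → ℕ
    g zero = h ℕ.+ 1
    g (suc i) = 2 ℕ.* i ℕ.+ 1 ℕ.+ ε
    row : ℤ → ℤ → Triangle
    row x z = corner W W x (x + z)
    decode : ℕ → ℕ → Triangle
    decode zero z = corner W W 0ℤ (+ z)
    decode (suc i) z = row (+ h - + i) (+ z)
    g≡ : ∀ i → + g (suc i) ≡ + 2 * + i + 1ℤ + + ε
    g≡ i = cong (λ n → n + 1ℤ + + ε) (ℤ.pos-* 2 i)

    sound : ∀ {x z} → x ℕ.< suc h → z ℕ.< g x → 𝒮 (suc k) (suc k) (decode x z)
    sound {zero} {z} _ z< = square-edge-member z (doubled W (+ h) (+ ε) (+ z) W≡ 0≤+ (+<+ z<))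
      where
      doubled : ∀ W h ε z → W ≡ + 2 * h + ε → 0ℤ ≤ ε → z < h + 1ℤ → + 2 * z ≤ W
      doubled W h ε z W≡ 0≤ε z< = ≤-by (gap≡ (sym W≡) ⊕ 0≤ε ⊕ gap< z< ⊕ gap< z<) (solve (W ∷ h ∷ ε ∷ z ∷ []))
    sound {suc i} {z} i< z< = let (0<x , 2x≤W , y≤W-x , x≤y , 0≤y) = bounds W (+ h) (+ i) (+ ε) (+ z) (+ g (suc i))
                                    W≡ (g≡ i) 0≤+ 0≤+ 0≤+ (+<+ z<) (+<+ (ℕ.≤-pred i<))
      in c2 (+ h - + i) (+ h - + i + + z) 0<x 2x≤W 0≤y y≤W-x (λ _ → x≤y)
      where
      bounds : ∀ W h i ε z G → W ≡ + 2 * h + ε → G ≡ + 2 * i + 1ℤ + ε → 0ℤ ≤ ε → 0ℤ ≤ i → 0ℤ ≤ z → z < G → i < h →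
        0ℤ < h - i × + 2 * (h - i) ≤ W × h - i + z ≤ W - (h - i) × h - i ≤ h - i + z × 0ℤ ≤ h - i + z
      bounds W h i ε z G W≡ G≡ 0≤ε 0≤i 0≤z z<G i<h =
        <-by (gap< i<h) (solve (h ∷ i ∷ [])) ,
        ≤-by (gap≡ (sym W≡) ⊕ 0≤ε ⊕ 0≤i ⊕ 0≤i) (solve (W ∷ h ∷ i ∷ ε ∷ [])) ,
        ≤-by (gap≡ (sym W≡) ⊕ gap< z<G ⊕ gap≡ G≡) (solve (W ∷ h ∷ i ∷ ε ∷ z ∷ G ∷ [])) ,
        ≤-by 0≤z (solve (h ∷ i ∷ z ∷ [])) ,
        ≤-by (gap< i<h ⊕ 0≤z ⊕ 0≤+ {1}) (solve (h ∷ i ∷ z ∷ []))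

    injective : ∀ {x z x′ z′} → x ℕ.< suc h → z ℕ.< g x → x′ ℕ.< suc h → z′ ℕ.< g x′ →
                decode x z ≡ decode x′ z′ → x ≡ x′ × z ≡ z′
    injective {zero} {_} {zero} _ _ _ _ eq = refl , ℤ.+-injective (cong right-y eq)
    injective {zero} {_} {suc i} _ _ i< _ eq = ⊥-elim (difference≢0 (ℕ.≤-pred i<) (cong apex-x eq))
    injective {suc i} {_} {zero} i< _ _ _ eq = ⊥-elim (difference≢0 (ℕ.≤-pred i<) (cong apex-x (sym eq)))
    injective {suc i} {z} {suc i′} {z′} _ _ _ _ eq =
      cong suc (ℤ.+-injective (+-cancel-from {+ h} (cong apex-x eq))) ,
      ℤ.+-injective (second (+ h - + i) (+ h - + i′) (+ z) (+ z′) (cong apex-x eq) (cong right-y eq))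
      where
      second : ∀ x x′ z z′ → x ≡ x′ → x + z ≡ x′ + z′ → z ≡ z′
      second x x′ z z′ eq eq′ = ≡-from (zero-gap (sym eq) ⊞ zero-gap eq′) (solve (x ∷ x′ ∷ z ∷ z′ ∷ []))

    complete : ∀ {T} → (∃₂ λ x y → T ≡ corner W W x y × Square W x y) →
               ∃₂ λ x z → x ℕ.< suc h × z ℕ.< g x × T ≡ decode x z
    complete (x , y , refl , sq) = [ edge-case , inner-case ]′ (≤⇒≡⊎< 0≤x)
      where
      open Square sq
      Found : Set
      Found = ∃₂ λ x′ z → x′ ℕ.< suc h × z ℕ.< g x′ × corner W W x y ≡ decode x′ z
      ε≤1′ : + ε ≤ 1ℤ
      ε≤1′ = +≤+ ε≤1
      x≤h : x ≤ + h
      x≤h = [ (λ h → h) , (λ h<x → too-big W x (+ h) (+ ε) W≡ ε≤1′ 2x≤W h<x) ]′ (≤⊎> x (+ h))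
        where
        too-big : ∀ W x h ε → W ≡ + 2 * h + ε → ε ≤ 1ℤ → + 2 * x ≤ W → h < x → x ≤ h
        too-big W x h ε W≡ ε≤1 2x≤W h<x =
          absurd-by (gap≡ W≡ ⊕ gap ε≤1 ⊕ gap 2x≤W ⊕ gap< h<x ⊕ gap< h<x) (solve (W ∷ x ∷ h ∷ ε ∷ []))
      edge-case : 0ℤ ≡ x → Found
      edge-case 0≡x = 0 , proj₁ n , ℕ.s≤s ℕ.z≤n ,
        ℤ.drop‿+<+ (small W y (+ h) (+ ε) (+ proj₁ n) W≡ ε≤1′ (edge (sym 0≡x)) (proj₂ n)) ,
        cong₂ (corner W W) (sym 0≡x) (sym (proj₂ n))
        where
        n = natural 0≤y
        small : ∀ W y h ε n → W ≡ + 2 * h + ε → ε ≤ 1ℤ → + 2 * y ≤ W → n ≡ y → n < h + 1ℤ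
        small W y h ε n W≡ ε≤1 2y≤W n≡y = [ big , (λ h → h) ]′ (≤⊎> (h + 1ℤ) n)
          where
          big : h + 1ℤ ≤ n → n < h + 1ℤ
          big h< = absurd-by (gap≡ W≡ ⊕ gap ε≤1 ⊕ gap 2y≤W ⊕ gap h< ⊕ gap h< ⊕ gap≡ n≡y ⊕ gap≡ n≡y) (solve (W ∷ y ∷ h ∷ ε ∷ n ∷ []))
      inner-case : 0ℤ < x → Found
      inner-case 0<x = suc (proj₁ i) , proj₁ z , ℕ.s≤s (ℤ.drop‿+<+ (earlier x (+ h) (+ proj₁ i) (proj₂ i) 0<x)) ,
        ℤ.drop‿+<+ (fits W x y (+ h) (+ ε) (+ proj₁ i) (+ proj₁ z) (+ g (suc (proj₁ i))) W≡ (g≡ (proj₁ i)) (proj₂ i) (proj₂ z) x+y≤W) ,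
        cong₂ (corner W W) (back x (+ h) (+ proj₁ i) (proj₂ i)) (back′ x y (+ h) (+ proj₁ i) (+ proj₁ z) (proj₂ i) (proj₂ z))
        where
        i = natural (gap x≤h)
        z = natural (gap x≤y)
        earlier : ∀ x h i → i ≡ h - x → 0ℤ < x → i < h
        earlier x h i eq 0<x = <-by (gap< 0<x ⊕ gap≡ eq) (solve (x ∷ h ∷ i ∷ []))
        fits : ∀ W x y h ε i z G → W ≡ + 2 * h + ε → G ≡ + 2 * i + 1ℤ + ε → i ≡ h - x → z ≡ y - x → x + y ≤ W → z < G
        fits W x y h ε i z G W≡ G≡ i≡ z≡ x+y≤W =
          <-by (gap≡ W≡ ⊕ gap≡ (sym G≡) ⊕ gap≡ (sym i≡) ⊕ gap≡ (sym i≡) ⊕ gap≡ z≡ ⊕ gap x+y≤W)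
            (solve (W ∷ x ∷ y ∷ h ∷ ε ∷ i ∷ z ∷ G ∷ []))
        back : ∀ x h i → i ≡ h - x → x ≡ h - i
        back x h i eq = ≡-from (zero-gap eq) (solve (x ∷ h ∷ i ∷ []))
        back′ : ∀ x y h i z → i ≡ h - x → z ≡ y - x → y ≡ h - i + z
        back′ x y h i z eq eq′ = ≡-from (zero-gap eq ⊞ zero-gap (sym eq′)) (solve (x ∷ y ∷ h ∷ i ∷ z ∷ []))

  -- For `2 x < W` there are `W - x + 1` corners and `x - 1` cuts with apex at `x`, exactly `W` in
  -- all, so a single index `z < W` runs through both. The decision is an argument so that lemmas
  -- can split on it.
  oblong-row : (W H x z : ℤ) → z ≤ W - x ⊎ W - x < z → Triangle
  oblong-row W H x z (inj₁ _) = corner W H x z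
  oblong-row W H x z (inj₂ _) = cut W H x (z - (W - x))

  oblong-row-apex : ∀ W H x z d → apex-x (oblong-row W H x z d) ≡ x
  oblong-row-apex W H x z (inj₁ _) = refl
  oblong-row-apex W H x z (inj₂ _) = refl

  oblong-row-injective : ∀ W H x z z′ d d′ → oblong-row W H x z d ≡ oblong-row W H x z′ d′ → z ≡ z′
  oblong-row-injective W H x z z′ (inj₁ _) (inj₁ _) eq = cong right-y eq
  oblong-row-injective W H x z z′ (inj₁ _) (inj₂ h) eq = ⊥-elim (apart z′ (cong left-y eq) h)
    where
    apart : ∀ z → 0ℤ ≡ z - (W - x) → ¬ (W - x < z)
    apart z eq h = absurd-by (gap< h ⊕ gap≡ (sym eq)) (solve (W ∷ x ∷ z ∷ []))
  oblong-row-injective W H x z z′ (inj₂ h) (inj₁ _) eq = ⊥-elim (apart z (cong left-y eq) h)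
    where
    apart : ∀ z → z - (W - x) ≡ 0ℤ → ¬ (W - x < z)
    apart z eq h = absurd-by (gap< h ⊕ gap≡ eq) (solve (W ∷ x ∷ z ∷ []))
  oblong-row-injective W H x z z′ (inj₂ _) (inj₂ _) eq = cancel z z′ (W - x) (cong left-y eq)
    where
    cancel : ∀ z z′ c → z - c ≡ z′ - c → z ≡ z′
    cancel z z′ c eq = ≡-from (zero-gap eq) (solve (z ∷ z′ ∷ c ∷ []))

  oblong-row-corner : ∀ {W H x z} → z ≤ W - x → ∀ d → corner W H x z ≡ oblong-row W H x z d
  oblong-row-corner _ (inj₁ _) = refl
  oblong-row-corner z≤ (inj₂ <z) = ⊥-elim (ℤ.<⇒≱ <z z≤)

  oblong-row-cut : ∀ {W H x y z} → y ≡ z - (W - x) → 0ℤ < y → ∀ d → cut W H x y ≡ oblong-row W H x z d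
  oblong-row-cut refl 0<y (inj₂ _) = refl
  oblong-row-cut {W} {H} {x} {_} {z} refl 0<y (inj₁ z≤) = ⊥-elim (not-below z≤ 0<y)
    where
    not-below : z ≤ W - x → ¬ (0ℤ < z - (W - x))
    not-below z≤ 0<y = absurd-by (gap z≤ ⊕ gap< 0<y) (solve (W ∷ x ∷ z ∷ []))

  -- The two kinds of rows. An apex strictly in the left half has `w₁` triangles. An apex exactly in
  -- the middle admits no cuts, and the corners with `0 ≤ y₁ ≤ h` remain.
  FullRow HalfRow : (W h x : ℤ) (g k : ℕ) → Set
  FullRow W h x g k = + 2 * x < W × g ≡ suc k
  HalfRow W h x g k = + 2 * x ≡ W × + g ≡ h + 1ℤ × W - x ≡ h

  oblong-row-member : ∀ {k w₂ h x z} (g : ℕ) → suc k ℕ.< w₂ → 0ℤ < x → z ℕ.< g →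
    FullRow (+ suc k) h x g k ⊎ HalfRow (+ suc k) h x g k → ∀ d → 𝒮 (suc k) w₂ (oblong-row (+ suc k) (+ w₂) x (+ z) d)
  oblong-row-member {k} {w₂} {h} {x} {z} g w₁<w₂ 0<x z<g spec = go
    where
    W : ℤ
    W = + suc k
    2x≤W : FullRow W h x g k ⊎ HalfRow W h x g k → + 2 * x ≤ W
    2x≤W (inj₁ (2x<W , _)) = ℤ.<⇒≤ 2x<W
    2x≤W (inj₂ (2x≡W , _)) = ℤ.≤-reflexive 2x≡W
    go : ∀ d → 𝒮 (suc k) w₂ (oblong-row W (+ w₂) x (+ z) d)
    go (inj₁ z≤) = c2 x (+ z) 0<x (2x≤W spec) 0≤+ z≤ (λ eq → ⊥-elim (ℕ.<⇒≢ w₁<w₂ eq))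
    go (inj₂ <z) = cut-member spec
      where
      positive : ∀ z c → c < z → 0ℤ < z - c
      positive z c h = <-by (gap< h) (solve (z ∷ c ∷ []))
      0<y : 0ℤ < + z - (W - x)
      0<y = positive (+ z) (W - x) <z
      small : ∀ z W x → z < W → z - (W - x) < x
      small z W x h = <-by (gap< h) (solve (z ∷ W ∷ x ∷ []))
      cut-member : FullRow W h x g k ⊎ HalfRow W h x g k → 𝒮 (suc k) w₂ (cut W (+ w₂) x (+ z - (W - x)))
      cut-member (inj₁ (2x<W , refl)) = c3 x (+ z - (W - x)) w₁<w₂ (ℤ.≤-<-trans (ℤ.i<j⇒suc[i]≤j 0<y) y<x) 2x<W 0<y y<x
        where
        y<x : + z - (W - x) < x
        y<x = small (+ z) W x (+<+ z<g)
      cut-member (inj₂ (_ , g≡ , W-x≡h)) = ⊥-elim (overflow (+ z) (+ g) h (W - x) (+<+ z<g) g≡ W-x≡h <z)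
        where
        overflow : ∀ z g h c → z < g → g ≡ h + 1ℤ → c ≡ h → ¬ (c < z)
        overflow z g h c z<g g≡ c≡ c<z = absurd-by (gap< z<g ⊕ gap≡ g≡ ⊕ gap≡ (sym c≡) ⊕ gap< c<z) (solve (z ∷ g ∷ h ∷ c ∷ []))

  -- Rows 0 and 1 are the edges y₁ ≤ ρ / 2 and ρ < y₁ ≤ (ρ + w₁) / 2, where ρ = w₂ mod w₁ = w₁ - 1 - t.
  -- Row 2 + i holds x₂ = h - i: first the corners with y₁ = z, then the cuts with y₀ = z - (w₁ - x₂).
  oblong-count : ∀ {k w₂} h (g : ℕ → ℕ) t → suc k ℕ.< w₂ → + suc k ≤ + 2 * + h + 1ℤ →
    (∀ {i} → i ℕ.< h → FullRow (+ suc k) (+ h) (+ h - + i) (g i) k ⊎ HalfRow (+ suc k) (+ h) (+ h - + i) (g i) k) →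
    suc k ≡ w₂ ℕ.% suc k ℕ.+ 1 ℕ.+ t →
    ClassCount (suc k) w₂ (rowSum g h ℕ.+ (1 ℕ.+ t) ℕ./ 2 ℕ.+ ((w₂ ℕ.% suc k) ℕ./ 2 ℕ.+ 1))
  oblong-count {k} {w₂} h g t w₁<w₂ W≤2h+1 rows W≡ = subst (ClassCount (suc k) w₂)
    (trans (rowSum-suc G (suc h)) (cong (ℕ._+ G 0) (rowSum-suc (G ∘ suc) h)))
    (class-count (ℕ.<⇒≤ w₁<w₂) G (suc (suc h)) decode sound injective complete)
    where
    W H ρ Q : ℤ
    W = + suc k
    H = + w₂
    ρ = + (w₂ ℕ.% suc k)
    Q = + (w₂ ℕ./ suc k)
    H≡ : H ≡ ρ + Q * W
    H≡ = a≡a%ℕn+[a/ℕn]*n H (suc k)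
    W≡ρ+1+t : W ≡ ρ + 1ℤ + + t
    W≡ρ+1+t = cong +_ W≡
    0≤ρ : 0ℤ ≤ ρ
    0≤ρ = 0≤+
    0≤t : 0ℤ ≤ + t
    0≤t = 0≤+
    G : ℕ → ℕ
    G 0 = (w₂ ℕ.% suc k) ℕ./ 2 ℕ.+ 1
    -- With `y₁ = ρ + 1 + j` the condition `2 y₁ ≤ ρ + w₁` becomes `2 (j + 1) ≤ 1 + t`.
    G 1 = (1 ℕ.+ t) ℕ./ 2
    G (suc (suc i)) = g i
    side : ∀ i z → + z ≤ W - (+ h - + i) ⊎ W - (+ h - + i) < + z
    side i z = ≤⊎> (+ z) (W - (+ h - + i))
    decode : ℕ → ℕ → Triangle
    decode 0 z = corner W H 0ℤ (+ z)
    decode 1 z = corner W H 0ℤ (ρ + 1ℤ + + z)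
    decode (suc (suc i)) z = oblong-row W H (+ h - + i) (+ z) (side i z)
    inner : ∀ {i} → suc (suc i) ℕ.< suc (suc h) → i ℕ.< h
    inner i< = ℕ.≤-pred (ℕ.≤-pred i<)

    -- The remainder of `w₂ - y` is `ρ - y` for `y ≤ ρ` and `ρ + w₁ - y` for `ρ < y < w₁`. The
    -- condition of `c1` thus reads `2 y ≤ ρ` or `2 y ≤ ρ + w₁`.
    low-quotient : ∀ H ρ Q W y → H ≡ ρ + Q * W → H - y ≡ ρ - y + Q * W
    low-quotient H ρ Q W y eq = ≡-from (zero-gap eq) (solve (H ∷ ρ ∷ Q ∷ W ∷ y ∷ []))
    high-quotient : ∀ H ρ Q W y → H ≡ ρ + Q * W → H - y ≡ ρ + W - y + (Q - 1ℤ) * W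
    high-quotient H ρ Q W y eq = ≡-from (zero-gap eq) (solve (H ∷ ρ ∷ Q ∷ W ∷ y ∷ []))

    sound : ∀ {x z} → x ℕ.< suc (suc h) → z ℕ.< G x → 𝒮 (suc k) w₂ (decode x z)
    sound {0} {z} _ z< = edge-member (ρ - + z) Q (low-quotient H ρ Q W (+ z) H≡)
        (nonneg ρ (+ z) 0≤+ 2z≤ρ) (below W ρ (+ t) (+ z) W≡ρ+1+t 0≤t 0≤+) 0≤+ (fits ρ (+ z) 2z≤ρ)
      where
      2z≤ρ : + 2 * + z ≤ ρ
      2z≤ρ = half-bound⁻ z<
      nonneg : ∀ ρ z → 0ℤ ≤ z → + 2 * z ≤ ρ → 0ℤ ≤ ρ - z
      nonneg ρ z 0≤z h = ≤-by (0≤z ⊕ gap h) (solve (ρ ∷ z ∷ []))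
      below : ∀ W ρ t z → W ≡ ρ + 1ℤ + t → 0ℤ ≤ t → 0ℤ ≤ z → ρ - z < W
      below W ρ t z W≡ 0≤t 0≤z = <-by (gap≡ (sym W≡) ⊕ 0≤t ⊕ 0≤z) (solve (W ∷ ρ ∷ t ∷ z ∷ []))
      fits : ∀ ρ z → + 2 * z ≤ ρ → z ≤ ρ - z
      fits ρ z h = ≤-by (gap h) (solve (ρ ∷ z ∷ []))
    sound {1} {j} _ j< = edge-member (ρ + W - y) (Q - 1ℤ) (high-quotient H ρ Q W y H≡)
        (nonneg W ρ (+ t) (+ j) W≡ρ+1+t 0≤ρ 0≤+ 2j+2≤) (below W ρ (+ j) 0≤+)
        (0≤ρ ⊕ 0≤+ {1} ⊕ 0≤+) (fits W ρ (+ t) (+ j) W≡ρ+1+t 2j+2≤)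
      where
      y : ℤ
      y = ρ + 1ℤ + + j
      2j+2≤ : + 2 * (+ j + 1ℤ) ≤ 1ℤ + + t
      2j+2≤ = half-bound′⁻ j<
      nonneg : ∀ W ρ t j → W ≡ ρ + 1ℤ + t → 0ℤ ≤ ρ → 0ℤ ≤ j → + 2 * (j + 1ℤ) ≤ 1ℤ + t → 0ℤ ≤ ρ + W - (ρ + 1ℤ + j)
      nonneg W ρ t j W≡ 0≤ρ 0≤j h = ≤-by (gap≡ (sym W≡) ⊕ 0≤ρ ⊕ 0≤j ⊕ gap h ⊕ 0≤+ {1}) (solve (W ∷ ρ ∷ t ∷ j ∷ []))
      below : ∀ W ρ j → 0ℤ ≤ j → ρ + W - (ρ + 1ℤ + j) < W
      below W ρ j 0≤j = <-by 0≤j (solve (W ∷ ρ ∷ j ∷ []))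
      fits : ∀ W ρ t j → W ≡ ρ + 1ℤ + t → + 2 * (j + 1ℤ) ≤ 1ℤ + t → ρ + 1ℤ + j ≤ ρ + W - (ρ + 1ℤ + j)
      fits W ρ t j W≡ h = ≤-by (gap≡ (sym W≡) ⊕ gap h) (solve (W ∷ ρ ∷ t ∷ j ∷ []))
    sound {suc (suc i)} {z} i< z< =
      oblong-row-member (g i) w₁<w₂ (positive (+ h) (+ i) (+<+ (inner i<))) z< (rows (inner i<)) (side i z)
      where
      positive : ∀ h i → i < h → 0ℤ < h - i
      positive h i i<h = <-by (gap< i<h) (solve (h ∷ i ∷ []))

    segments-apart : ∀ ρ z j → 0ℤ ≤ z → + 2 * z ≤ ρ → 0ℤ ≤ j → z ≢ ρ + 1ℤ + j
    segments-apart ρ z j 0≤z 2z≤ρ 0≤j eq =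
      absurd-by (gap 2z≤ρ ⊕ 0≤z ⊕ 0≤j ⊕ gap≡ (sym eq)) (solve (ρ ∷ z ∷ j ∷ []))
    edge-inner : ∀ {i} → suc (suc i) ℕ.< suc (suc h) → ∀ {z} → 0ℤ ≢ apex-x (decode (suc (suc i)) z)
    edge-inner {i} i< {z} eq = difference≢0 (inner i<) (trans eq (oblong-row-apex W H (+ h - + i) (+ z) (side i z)))
    injective : ∀ {x z x′ z′} → x ℕ.< suc (suc h) → z ℕ.< G x → x′ ℕ.< suc (suc h) → z′ ℕ.< G x′ →
                decode x z ≡ decode x′ z′ → x ≡ x′ × z ≡ z′
    injective {0} {_} {0} _ _ _ _ eq = refl , ℤ.+-injective (cong right-y eq)
    injective {1} {z} {1} {z′} _ _ _ _ eq = refl , ℤ.+-injective (cancel ρ (+ z) (+ z′) (cong right-y eq))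
      where
      cancel : ∀ ρ z z′ → ρ + 1ℤ + z ≡ ρ + 1ℤ + z′ → z ≡ z′
      cancel ρ z z′ eq = ≡-from (zero-gap eq) (solve (ρ ∷ z ∷ z′ ∷ []))
    injective {0} {z} {1} {j} _ z< _ _ eq = ⊥-elim (segments-apart ρ (+ z) (+ j) 0≤+ (half-bound⁻ z<) 0≤+ (cong right-y eq))
    injective {1} {j} {0} {z} _ _ _ z< eq = ⊥-elim (segments-apart ρ (+ z) (+ j) 0≤+ (half-bound⁻ z<) 0≤+ (sym (cong right-y eq)))
    injective {0} {_} {suc (suc i)} {z} _ _ i< _ eq = ⊥-elim (edge-inner i< {z} (cong apex-x eq))
    injective {1} {_} {suc (suc i)} {z} _ _ i< _ eq = ⊥-elim (edge-inner i< {z} (cong apex-x eq))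
    injective {suc (suc i)} {z} {0} i< _ _ _ eq = ⊥-elim (edge-inner i< {z} (sym (cong apex-x eq)))
    injective {suc (suc i)} {z} {1} i< _ _ _ eq = ⊥-elim (edge-inner i< {z} (sym (cong apex-x eq)))
    injective {suc (suc i)} {z} {suc (suc i′)} {z′} _ _ _ _ eq = cong (2 ℕ.+_) i≡i′ , same i≡i′ eq
      where
      x≡x′ : + h - + i ≡ + h - + i′
      x≡x′ = trans (sym (oblong-row-apex W H (+ h - + i) (+ z) (side i z)))
        (trans (cong apex-x eq) (oblong-row-apex W H (+ h - + i′) (+ z′) (side i′ z′)))
      i≡i′ : i ≡ i′
      i≡i′ = ℤ.+-injective (+-cancel-from {+ h} x≡x′)
      same : i ≡ i′ → decode (suc (suc i)) z ≡ decode (suc (suc i′)) z′ → z ≡ z′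
      same refl eq = ℤ.+-injective (oblong-row-injective W H (+ h - + i) (+ z) (+ z′) (side i z) (side i z′) eq)

    Found : Triangle → Set
    Found T = ∃₂ λ x z → x ℕ.< suc (suc h) × z ℕ.< G x × T ≡ decode x z

    x≤h : ∀ {x} → + 2 * x ≤ W → x ≤ + h
    x≤h {x} 2x≤W = [ (λ h → h) , too-big W x (+ h) W≤2h+1 2x≤W ]′ (≤⊎> x (+ h))
      where
      too-big : ∀ W x h → W ≤ + 2 * h + 1ℤ → + 2 * x ≤ W → h < x → x ≤ h
      too-big W x h W≤ 2x≤W h<x = absurd-by (gap W≤ ⊕ gap 2x≤W ⊕ gap< h<x ⊕ gap< h<x) (solve (W ∷ x ∷ h ∷ []))
    find-row : ∀ {x} → 0ℤ < x → + 2 * x ≤ W → ∃ λ i → i ℕ.< h × + h - + i ≡ x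
    find-row {x} 0<x 2x≤W = proj₁ i , ℤ.drop‿+<+ (earlier x (+ h) (+ proj₁ i) (proj₂ i) 0<x) , back x (+ h) (+ proj₁ i) (proj₂ i)
      where
      i = natural (gap (x≤h 2x≤W))
      earlier : ∀ x h i → i ≡ h - x → 0ℤ < x → i < h
      earlier x h i eq 0<x = <-by (gap< 0<x ⊕ gap≡ eq) (solve (x ∷ h ∷ i ∷ []))
      back : ∀ x h i → i ≡ h - x → h - i ≡ x
      back x h i eq = ≡-from (zero-gap (sym eq)) (solve (x ∷ h ∷ i ∷ []))

    find-corner : ∀ {i x} z → i ℕ.< h → + h - + i ≡ x → + z ≤ W - x → 0ℤ < x → Found (corner W H x (+ z))
    find-corner {i} z i<h refl z≤ 0<x = suc (suc i) , z , ℕ.s≤s (ℕ.s≤s i<h) , bound (rows i<h) , oblong-row-corner z≤ (side i z)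
      where
      bound : FullRow W (+ h) (+ h - + i) (g i) k ⊎ HalfRow W (+ h) (+ h - + i) (g i) k → z ℕ.< g i
      bound (inj₁ (_ , eq)) = subst (z ℕ.<_) (sym eq) (ℤ.drop‿+<+ (small (+ z) W (+ h - + i) z≤ 0<x))
        where
        small : ∀ z W x → z ≤ W - x → 0ℤ < x → z < W
        small z W x z≤ 0<x = <-by (gap z≤ ⊕ gap< 0<x) (solve (z ∷ W ∷ x ∷ []))
      bound (inj₂ (_ , g≡ , W-x≡h)) = ℤ.drop‿+<+ (small (+ z) (+ g i) (+ h) (W - (+ h - + i)) g≡ W-x≡h z≤)
        where
        small : ∀ z g h c → g ≡ h + 1ℤ → c ≡ h → z ≤ c → z < g
        small z g h c g≡ c≡ z≤ = <-by (gap≡ (sym g≡) ⊕ gap≡ c≡ ⊕ gap z≤) (solve (z ∷ g ∷ h ∷ c ∷ []))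

    find-cut : ∀ {i x y} z → i ℕ.< h → + h - + i ≡ x → + 2 * x < W → y ≡ + z - (W - x) → 0ℤ < y → y < x → Found (cut W H x y)
    find-cut {i} {_} {y} z i<h refl 2x<W y≡ 0<y y<x =
      suc (suc i) , z , ℕ.s≤s (ℕ.s≤s i<h) , bound (rows i<h) , oblong-row-cut y≡ 0<y (side i z)
      where
      bound : FullRow W (+ h) (+ h - + i) (g i) k ⊎ HalfRow W (+ h) (+ h - + i) (g i) k → z ℕ.< g i
      bound (inj₁ (_ , eq)) = subst (z ℕ.<_) (sym eq) (ℤ.drop‿+<+ (small (+ z) y W (+ h - + i) y≡ y<x))
        where
        small : ∀ z y W x → y ≡ z - (W - x) → y < x → z < W
        small z y W x y≡ y<x = <-by (gap< y<x ⊕ gap≡ (sym y≡)) (solve (z ∷ y ∷ W ∷ x ∷ []))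
      bound (inj₂ (eq , _)) = ⊥-elim (ℤ.<-irrefl eq 2x<W)

    find-edge : ∀ {y} → 0ℤ ≤ y → y ≤ + ((H - y) %ℕ suc k) → Found (corner W H 0ℤ y)
    find-edge {y} 0≤y y≤r = [ low-case , high-case ]′ (≤⊎> y ρ)
      where
      y<W : y < W
      y<W = c1-bound y≤r
      low-case : y ≤ ρ → Found (corner W H 0ℤ y)
      low-case y≤ρ = 0 , proj₁ n , ℕ.s≤s ℕ.z≤n ,
        half-bound (subst (λ y → + 2 * y ≤ ρ) (sym (proj₂ n)) (double ρ y (subst (y ≤_) r≡ y≤r))) ,
        cong (corner W H 0ℤ) (sym (proj₂ n))
        where
        n = natural 0≤y
        below : ∀ W ρ t y → W ≡ ρ + 1ℤ + t → 0ℤ ≤ t → 0ℤ ≤ y → ρ - y < W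
        below W ρ t y W≡ 0≤t 0≤y = <-by (gap≡ (sym W≡) ⊕ 0≤t ⊕ 0≤y) (solve (W ∷ ρ ∷ t ∷ y ∷ []))
        r≡ : + ((H - y) %ℕ suc k) ≡ ρ - y
        r≡ = %ℕ-unique Q (low-quotient H ρ Q W y H≡) (gap y≤ρ) (below W ρ (+ t) y W≡ρ+1+t 0≤t 0≤y)
        double : ∀ ρ y → y ≤ ρ - y → + 2 * y ≤ ρ
        double ρ y h = ≤-by (gap h) (solve (ρ ∷ y ∷ []))
      high-case : ρ < y → Found (corner W H 0ℤ y)
      high-case ρ<y = 1 , proj₁ j , ℕ.s≤s (ℕ.s≤s ℕ.z≤n) ,
        half-bound′ (double W ρ (+ t) y (+ proj₁ j) W≡ρ+1+t (proj₂ j) (subst (y ≤_) r≡ y≤r)) ,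
        cong (corner W H 0ℤ) (back ρ y (+ proj₁ j) (proj₂ j))
        where
        j = natural (gap< ρ<y)
        nonneg : ∀ W ρ y → y < W → 0ℤ ≤ ρ → 0ℤ ≤ ρ + W - y
        nonneg W ρ y y<W 0≤ρ = ≤-by (gap (ℤ.<⇒≤ y<W) ⊕ 0≤ρ) (solve (W ∷ ρ ∷ y ∷ []))
        below : ∀ W ρ y → ρ < y → ρ + W - y < W
        below W ρ y ρ<y = <-by (gap< ρ<y) (solve (W ∷ ρ ∷ y ∷ []))
        r≡ : + ((H - y) %ℕ suc k) ≡ ρ + W - y
        r≡ = %ℕ-unique (Q - 1ℤ) (high-quotient H ρ Q W y H≡) (nonneg W ρ y y<W 0≤ρ) (below W ρ y ρ<y)
        double : ∀ W ρ t y j → W ≡ ρ + 1ℤ + t → j ≡ y - ρ - 1ℤ → y ≤ ρ + W - y → + 2 * (j + 1ℤ) ≤ 1ℤ + t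
        double W ρ t y j W≡ j≡ h = ≤-by (gap≡ W≡ ⊕ gap≡ j≡ ⊕ gap≡ j≡ ⊕ gap h) (solve (W ∷ ρ ∷ t ∷ y ∷ j ∷ []))
        back : ∀ ρ y j → j ≡ y - ρ - 1ℤ → y ≡ ρ + 1ℤ + j
        back ρ y j eq = ≡-from (zero-gap (sym eq)) (solve (ρ ∷ y ∷ j ∷ []))

    complete : ∀ {T} → 𝒮 (suc k) w₂ T → Found T
    complete (c1 y 0≤y y≤r) = find-edge 0≤y y≤r
    complete (c2 x y 0<x 2x≤W 0≤y y≤ _) = let (i , i<h , x≡) = find-row 0<x 2x≤W in
        subst (λ y → Found (corner W H x y)) (proj₂ n) (find-corner (proj₁ n) i<h x≡ (subst (_≤ W - x) (sym (proj₂ n)) y≤) 0<x)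
      where
      n = natural 0≤y
    complete (c3 x y _ _ 2x<W 0<y y<x) = let (i , i<h , x≡) = find-row 0<x (ℤ.<⇒≤ 2x<W) in
        find-cut (proj₁ z) i<h x≡ 2x<W (back y (W - x) (+ proj₁ z) (proj₂ z)) 0<y y<x
      where
      0<x : 0ℤ < x
      0<x = ℤ.<-trans 0<y y<x
      nonneg : ∀ W x y → + 2 * x < W → 0ℤ < x → 0ℤ < y → 0ℤ ≤ y + (W - x)
      nonneg W x y 2x<W 0<x 0<y = ≤-by (gap (ℤ.<⇒≤ 2x<W) ⊕ gap (ℤ.<⇒≤ 0<x) ⊕ gap (ℤ.<⇒≤ 0<y)) (solve (W ∷ x ∷ y ∷ []))
      z = natural (nonneg W x y 2x<W 0<x 0<y)
      back : ∀ y c z → z ≡ y + c → y ≡ z - c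
      back y c z eq = ≡-from (zero-gap (sym eq)) (solve (y ∷ c ∷ z ∷ []))

  -- Closed forms of the counts

  rowSum-odd : ∀ ε h → rowSum (λ i → 2 ℕ.* i ℕ.+ 1 ℕ.+ ε) h ≡ h ℕ.* h ℕ.+ h ℕ.* ε
  rowSum-odd ε zero = refl
  rowSum-odd ε (suc h) = trans (cong (2 ℕ.* h ℕ.+ 1 ℕ.+ ε ℕ.+_) (rowSum-odd ε h)) (expand ε h)
    where
    expand : ∀ ε h → 2 ℕ.* h ℕ.+ 1 ℕ.+ ε ℕ.+ (h ℕ.* h ℕ.+ h ℕ.* ε) ≡ (1 ℕ.+ h) ℕ.* (1 ℕ.+ h) ℕ.+ (1 ℕ.+ h) ℕ.* ε
    expand = ℕRing.solve-∀

  parity : ∀ {ε} w → w ℕ.% 2 ≡ ε → w ≡ 2 ℕ.* (w ℕ./ 2) ℕ.+ ε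
  parity w refl = trans (ℕ.m≡m%n+[m/n]*n w 2) (swap (w ℕ.% 2) (w ℕ./ 2))
    where
    swap : ∀ r q → r ℕ.+ q ℕ.* 2 ≡ 2 ℕ.* q ℕ.+ r
    swap = ℕRing.solve-∀

  parity-ℤ : ∀ {ε} w → w ℕ.% 2 ≡ ε → + w ≡ + 2 * + (w ℕ./ 2) + + ε
  parity-ℤ {ε} w eq = trans (cong +_ (parity w eq)) (cong (_+ + ε) (ℤ.pos-* 2 (w ℕ./ 2)))

  -- With `w₁ = 2 h` the inner rows are the odd numbers, with sum `h h`, and the edges add `h + 1`.
  -- The factor 4 clears the denominators.
  square-even : ∀ k → suc k ℕ.% 2 ≡ 0 →
    Σ ℕ λ N → ClassCount (suc k) (suc k) N × 4 ℕ.* N ≡ suc k ℕ.* suc k ℕ.+ 2 ℕ.* suc k ℕ.+ 4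
  square-even k even = _ , square-count k h 0 (parity-ℤ (suc k) even) ℕ.z≤n ,
    trans (cong (λ r → 4 ℕ.* (r ℕ.+ (h ℕ.+ 1))) (rowSum-odd 0 h))
      (subst (λ w → 4 ℕ.* (h ℕ.* h ℕ.+ h ℕ.* 0 ℕ.+ (h ℕ.+ 1)) ≡ w ℕ.* w ℕ.+ 2 ℕ.* w ℕ.+ 4) (sym (parity (suc k) even)) (expand h))
    where
    h = suc k ℕ./ 2
    expand : ∀ h → 4 ℕ.* (h ℕ.* h ℕ.+ h ℕ.* 0 ℕ.+ (h ℕ.+ 1)) ≡ (2 ℕ.* h ℕ.+ 0) ℕ.* (2 ℕ.* h ℕ.+ 0) ℕ.+ 2 ℕ.* (2 ℕ.* h ℕ.+ 0) ℕ.+ 4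
    expand = ℕRing.solve-∀

  -- With `w₁ = 2 h + 1` the inner rows add up to `h h + h`; together with the `h + 1` edges this is
  -- the square of `h + 1`.
  square-odd : ∀ k → suc k ℕ.% 2 ≡ 1 →
    Σ ℕ λ N → ClassCount (suc k) (suc k) N × 4 ℕ.* N ≡ suc k ℕ.* suc k ℕ.+ 2 ℕ.* suc k ℕ.+ 1
  square-odd k odd = _ , square-count k h 1 (parity-ℤ (suc k) odd) ℕ.≤-refl ,
    trans (cong (λ r → 4 ℕ.* (r ℕ.+ (h ℕ.+ 1))) (rowSum-odd 1 h))
      (subst (λ w → 4 ℕ.* (h ℕ.* h ℕ.+ h ℕ.* 1 ℕ.+ (h ℕ.+ 1)) ≡ w ℕ.* w ℕ.+ 2 ℕ.* w ℕ.+ 1) (sym (parity (suc k) odd)) (expand h))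
    where
    h = suc k ℕ./ 2
    expand : ∀ h → 4 ℕ.* (h ℕ.* h ℕ.+ h ℕ.* 1 ℕ.+ (h ℕ.+ 1)) ≡ (2 ℕ.* h ℕ.+ 1) ℕ.* (2 ℕ.* h ℕ.+ 1) ℕ.+ 2 ℕ.* (2 ℕ.* h ℕ.+ 1) ℕ.+ 1
    expand = ℕRing.solve-∀

  -- Rounded halves are known through inequalities between their doubles. An error of at most 1 in
  -- each direction still forces equality.
  half-cancel : ∀ a b → + 2 * a ≤ + 2 * b + 1ℤ → + 2 * b ≤ + 2 * a + 1ℤ → a ≡ b
  half-cancel a b h h′ = ℤ.≤-antisym (halve a b h) (halve b a h′)
    where
    halve : ∀ a b → + 2 * a ≤ + 2 * b + 1ℤ → a ≤ b
    halve a b h = [ (λ a≤b → a≤b) , too-big ]′ (≤⊎> a b)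
      where
      too-big : b < a → a ≤ b
      too-big b<a = absurd-by (gap h ⊕ gap< b<a ⊕ gap< b<a) (solve (a ∷ b ∷ []))

  complement : ∀ w₂ k → suc k ≡ w₂ ℕ.% suc k ℕ.+ 1 ℕ.+ (k ℕ.∸ w₂ ℕ.% suc k)
  complement w₂ k = trans (cong suc (sym (ℕ.m+[n∸m]≡n (ℕ.≤-pred (ℕ.m%n<n w₂ (suc k))))))
    (regroup (w₂ ℕ.% suc k) (k ℕ.∸ w₂ ℕ.% suc k))
    where
    regroup : ∀ ρ t → 1 ℕ.+ (ρ ℕ.+ t) ≡ ρ ℕ.+ 1 ℕ.+ t
    regroup = ℕRing.solve-∀

  -- With `w₁ = 2 h + 1` there are `h` rows of length `w₁`. The edges number `p + s + 1 = h + 1`: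
  -- since `ρ + t = 2 h`, the numbers `ρ` and `t` have the same parity, and exactly one of the
  -- halves `ρ / 2` and `(1 + t) / 2` is rounded down.
  oblong-odd : ∀ k w₂ → suc k ℕ.< w₂ → suc k ℕ.% 2 ≡ 1 →
    Σ ℕ λ N → ClassCount (suc k) w₂ N × 2 ℕ.* N ≡ suc k ℕ.* suc k ℕ.+ 1
  oblong-odd k w₂ w₁<w₂ odd = _ ,
    oblong-count h (λ _ → suc k) t w₁<w₂ (ℤ.≤-reflexive W≡) (λ {i} _ → inj₁ (full (+ suc k) (+ h) (+ i) W≡ 0≤+ , refl)) (complement w₂ k) ,
    count h s p (suc k) (rowSum (λ _ → suc k) h) (parity (suc k) odd) (rowSum-const (suc k) h) p+s≡h
    where
    h = suc k ℕ./ 2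
    ρ = w₂ ℕ.% suc k
    t = k ℕ.∸ ρ
    p = ρ ℕ./ 2
    s = (1 ℕ.+ t) ℕ./ 2
    W≡ : + suc k ≡ + 2 * + h + 1ℤ
    W≡ = parity-ℤ (suc k) odd
    full : ∀ W h i → W ≡ + 2 * h + 1ℤ → 0ℤ ≤ i → + 2 * (h - i) < W
    full W h i W≡ 0≤i = <-by (gap≡ (sym W≡) ⊕ 0≤i ⊕ 0≤i) (solve (W ∷ h ∷ i ∷ []))
    p+s≡h : p ℕ.+ s ≡ h
    p+s≡h = ℤ.+-injective (half-cancel (+ p + + s) (+ h)
        (above (+ suc k) (+ h) (+ ρ) (+ t) (+ p) (+ s) W≡ (cong +_ (complement w₂ k)) (proj₁ (halves ρ)) (proj₁ (halves (1 ℕ.+ t))))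
        (below (+ suc k) (+ h) (+ ρ) (+ t) (+ p) (+ s) W≡ (cong +_ (complement w₂ k)) (proj₂ (halves ρ)) (proj₂ (halves (1 ℕ.+ t)))))
      where
      above : ∀ W h ρ t p s → W ≡ + 2 * h + 1ℤ → W ≡ ρ + 1ℤ + t → + 2 * p ≤ ρ → + 2 * s ≤ 1ℤ + t → + 2 * (p + s) ≤ + 2 * h + 1ℤ
      above W h ρ t p s W≡ W≡′ hp hs =
        ≤-by (gap≡ W≡ ⊕ gap≡ (sym W≡′) ⊕ gap hp ⊕ gap hs) (solve (W ∷ h ∷ ρ ∷ t ∷ p ∷ s ∷ []))
      below : ∀ W h ρ t p s → W ≡ + 2 * h + 1ℤ → W ≡ ρ + 1ℤ + t → ρ ≤ + 2 * p + 1ℤ → 1ℤ + t ≤ + 2 * s + 1ℤ → + 2 * h ≤ + 2 * (p + s) + 1ℤ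
      below W h ρ t p s W≡ W≡′ hp hs =
        ≤-by (gap≡ (sym W≡) ⊕ gap≡ W≡′ ⊕ gap hp ⊕ gap hs) (solve (W ∷ h ∷ ρ ∷ t ∷ p ∷ s ∷ []))
    count : ∀ h s p w r → w ≡ 2 ℕ.* h ℕ.+ 1 → r ≡ h ℕ.* w → p ℕ.+ s ≡ h → 2 ℕ.* (r ℕ.+ s ℕ.+ (p ℕ.+ 1)) ≡ w ℕ.* w ℕ.+ 1
    count _ s p _ _ refl refl refl = expand s p
      where
      expand : ∀ s p → 2 ℕ.* ((p ℕ.+ s) ℕ.* (2 ℕ.* (p ℕ.+ s) ℕ.+ 1) ℕ.+ s ℕ.+ (p ℕ.+ 1))
                       ≡ (2 ℕ.* (p ℕ.+ s) ℕ.+ 1) ℕ.* (2 ℕ.* (p ℕ.+ s) ℕ.+ 1) ℕ.+ 1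
      expand = ℕRing.solve-∀

  -- With w₁ = 2 (1 + h), the remainder of w₂ modulo w₁ has the parity δ of w₂; δ + p + s = 1 + h counts the edge rows.
  oblong-even : ∀ k w₂ δ → suc k ℕ.< w₂ → suc k ℕ.% 2 ≡ 0 → w₂ ℕ.% 2 ≡ δ → δ ℕ.≤ 1 →
    Σ ℕ λ N → ClassCount (suc k) w₂ N × 2 ℕ.* N ℕ.+ 2 ℕ.* δ ≡ suc k ℕ.* suc k ℕ.+ 4
  oblong-even k w₂ δ w₁<w₂ even w₂-parity δ≤1 = go (suc k ℕ./ 2) (parity (suc k) even) (parity-ℤ (suc k) even)
    where
    ρ = w₂ ℕ.% suc k
    t = k ℕ.∸ ρ
    p = ρ ℕ./ 2
    s = (1 ℕ.+ t) ℕ./ 2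
    go : ∀ h → suc k ≡ 2 ℕ.* h ℕ.+ 0 → + suc k ≡ + 2 * + h + 0ℤ →
         Σ ℕ λ N → ClassCount (suc k) w₂ N × 2 ℕ.* N ℕ.+ 2 ℕ.* δ ≡ suc k ℕ.* suc k ℕ.+ 4
    -- `w₁` is positive and even, so its half is a successor and the case `0` is excluded by `w≡`.
    go (suc h) w≡ W≡ = _ ,
      oblong-count (suc h) g t w₁<w₂ (ℤ.≤-trans (ℤ.≤-reflexive W≡) (ℤ.+-monoʳ-≤ (+ 2 * + suc h) 0≤+)) rows (complement w₂ k) ,
      count h s p δ (suc k) (rowSum g (suc h)) w≡
        (trans (rowSum-suc g h) (cong (ℕ._+ (suc h ℕ.+ 1)) (rowSum-const (suc k) h))) δ+p+s≡h
      where
      g : ℕ → ℕ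
      -- Row `0` has its apex at the midpoint `2 x = w₁`, so it is the one half row.
      g zero = suc h ℕ.+ 1
      g (suc i) = suc k
      rows : ∀ {i} → i ℕ.< suc h → FullRow (+ suc k) (+ suc h) (+ suc h - + i) (g i) k ⊎ HalfRow (+ suc k) (+ suc h) (+ suc h - + i) (g i) k
      rows {zero} _ = inj₂ (middle (+ suc k) (+ suc h) W≡ , refl , rest (+ suc k) (+ suc h) W≡)
        where
        middle : ∀ W h → W ≡ + 2 * h + 0ℤ → + 2 * (h - 0ℤ) ≡ W
        middle W h W≡ = ≡-from (zero-gap (sym W≡)) (solve (W ∷ h ∷ []))
        rest : ∀ W h → W ≡ + 2 * h + 0ℤ → W - (h - 0ℤ) ≡ h
        rest W h W≡ = ≡-from (zero-gap W≡) (solve (W ∷ h ∷ []))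
      rows {suc i} _ = inj₁ (full (+ suc k) (+ suc h) (+ suc i) W≡ (+<+ (ℕ.s≤s ℕ.z≤n)) , refl)
        where
        full : ∀ W h i → W ≡ + 2 * h + 0ℤ → 0ℤ < i → + 2 * (h - i) < W
        full W h i W≡ 0<i = <-by (gap≡ (sym W≡) ⊕ gap< 0<i ⊕ gap< 0<i ⊕ 0≤+ {1}) (solve (W ∷ h ∷ i ∷ []))
      ρ-parity : ρ ℕ.% 2 ≡ δ
      ρ-parity = trans (sym (ℕ.[m+kn]%n≡m%n ρ (w₂ ℕ./ suc k ℕ.* suc h) 2)) (trans (cong (ℕ._% 2) (sym decomposition)) w₂-parity)
        where
        regroup : ∀ q h → q ℕ.* (2 ℕ.* h ℕ.+ 0) ≡ q ℕ.* h ℕ.* 2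
        regroup = ℕRing.solve-∀
        decomposition : w₂ ≡ ρ ℕ.+ w₂ ℕ./ suc k ℕ.* suc h ℕ.* 2
        decomposition = trans (ℕ.m≡m%n+[m/n]*n w₂ (suc k))
          (cong (ρ ℕ.+_) (trans (cong (w₂ ℕ./ suc k ℕ.*_) w≡) (regroup (w₂ ℕ./ suc k) (suc h))))
      δ+p+s≡h : δ ℕ.+ p ℕ.+ s ≡ suc h
      δ+p+s≡h = ℤ.+-injective (half-cancel (+ δ + + p + + s) (+ suc h)
          (above (+ suc k) (+ suc h) (+ ρ) (+ t) (+ p) (+ s) (+ δ) W≡ (cong +_ (complement w₂ k)) (parity-ℤ ρ ρ-parity) (+≤+ δ≤1) (proj₁ (halves (1 ℕ.+ t))))
          (below (+ suc k) (+ suc h) (+ ρ) (+ t) (+ p) (+ s) (+ δ) W≡ (cong +_ (complement w₂ k)) (parity-ℤ ρ ρ-parity) 0≤+ (proj₂ (halves (1 ℕ.+ t)))))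
        where
        above : ∀ W h ρ t p s δ → W ≡ + 2 * h + 0ℤ → W ≡ ρ + 1ℤ + t → ρ ≡ + 2 * p + δ → δ ≤ 1ℤ → + 2 * s ≤ 1ℤ + t →
                + 2 * (δ + p + s) ≤ + 2 * h + 1ℤ
        above W h ρ t p s δ W≡ W≡′ ρ≡ δ≤1 hs =
          ≤-by (gap≡ W≡ ⊕ gap≡ (sym W≡′) ⊕ gap≡ (sym ρ≡) ⊕ gap δ≤1 ⊕ gap hs) (solve (W ∷ h ∷ ρ ∷ t ∷ p ∷ s ∷ δ ∷ []))
        below : ∀ W h ρ t p s δ → W ≡ + 2 * h + 0ℤ → W ≡ ρ + 1ℤ + t → ρ ≡ + 2 * p + δ → 0ℤ ≤ δ → 1ℤ + t ≤ + 2 * s + 1ℤ →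
                + 2 * h ≤ + 2 * (δ + p + s) + 1ℤ
        below W h ρ t p s δ W≡ W≡′ ρ≡ 0≤δ hs =
          ≤-by (gap≡ (sym W≡) ⊕ gap≡ W≡′ ⊕ gap≡ ρ≡ ⊕ 0≤δ ⊕ gap hs) (solve (W ∷ h ∷ ρ ∷ t ∷ p ∷ s ∷ δ ∷ []))
      count : ∀ h s p δ w r → w ≡ 2 ℕ.* suc h ℕ.+ 0 → r ≡ h ℕ.* w ℕ.+ (suc h ℕ.+ 1) → δ ℕ.+ p ℕ.+ s ≡ suc h →
              2 ℕ.* (r ℕ.+ s ℕ.+ (p ℕ.+ 1)) ℕ.+ 2 ℕ.* δ ≡ w ℕ.* w ℕ.+ 4
      count h s p δ _ _ refl refl eq = trans (collect h s p δ) (trans (cong (doubled h) eq) (expand h))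
        where
        doubled : ℕ → ℕ → ℕ
        doubled h e = 2 ℕ.* (h ℕ.* (2 ℕ.* (1 ℕ.+ h) ℕ.+ 0) ℕ.+ (1 ℕ.+ h ℕ.+ 1) ℕ.+ e ℕ.+ 1)
        collect : ∀ h s p δ → 2 ℕ.* (h ℕ.* (2 ℕ.* (1 ℕ.+ h) ℕ.+ 0) ℕ.+ (1 ℕ.+ h ℕ.+ 1) ℕ.+ s ℕ.+ (p ℕ.+ 1)) ℕ.+ 2 ℕ.* δ
                  ≡ 2 ℕ.* (h ℕ.* (2 ℕ.* (1 ℕ.+ h) ℕ.+ 0) ℕ.+ (1 ℕ.+ h ℕ.+ 1) ℕ.+ (δ ℕ.+ p ℕ.+ s) ℕ.+ 1)
        collect = ℕRing.solve-∀
        expand : ∀ h → 2 ℕ.* (h ℕ.* (2 ℕ.* (1 ℕ.+ h) ℕ.+ 0) ℕ.+ (1 ℕ.+ h ℕ.+ 1) ℕ.+ (1 ℕ.+ h) ℕ.+ 1)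
                 ≡ (2 ℕ.* (1 ℕ.+ h) ℕ.+ 0) ℕ.* (2 ℕ.* (1 ℕ.+ h) ℕ.+ 0) ℕ.+ 4
        expand = ℕRing.solve-∀

  -- The bijection, and the even counts separated by the parity of `w₂`

  class-map-bijective : ∀ {w₁ w₂} → w₁ ℕ.≤ w₂ → ClassMapBijective w₁ w₂
  class-map-bijective w₁≤w₂ =
    𝒮⇒HasWidths w₁≤w₂ ,
    (λ T T′ s s′ e → same (𝒮-injective w₁≤w₂ s s′ ⌈ e ⌉)) ,
    λ T widths → let (T′ , s , e) = classified {T = T} w₁≤w₂ widths in T′ , s , ⌊ e ⌋
    where
    same : ∀ {T T′} → T ≡ T′ → SameTriangle T T′
    same refl = Perm.id , λ _ → refl

  oblong-even-even : ∀ k w₂ → suc k ℕ.< w₂ → suc k ℕ.% 2 ≡ 0 → w₂ ℕ.% 2 ≡ 0 →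
    Σ ℕ λ N → ClassCount (suc k) w₂ N × 2 ℕ.* N ≡ suc k ℕ.* suc k ℕ.+ 4
  oblong-even-even k w₂ w₁<w₂ even even′ = let (N , count , eq) = oblong-even k w₂ 0 w₁<w₂ even even′ ℕ.z≤n in
    N , count , trans (sym (ℕ.+-identityʳ (2 ℕ.* N))) eq

  oblong-even-odd : ∀ k w₂ → suc k ℕ.< w₂ → suc k ℕ.% 2 ≡ 0 → w₂ ℕ.% 2 ≡ 1 →
    Σ ℕ λ N → ClassCount (suc k) w₂ N × 2 ℕ.* N ≡ suc k ℕ.* suc k ℕ.+ 2
  oblong-even-odd k w₂ w₁<w₂ even odd = let (N , count , eq) = oblong-even k w₂ 1 w₁<w₂ even odd ℕ.≤-refl in
    N , count , ℕ.+-cancelʳ-≡ 2 (2 ℕ.* N) (suc k ℕ.* suc k ℕ.+ 2) (trans eq (sym (ℕ.+-assoc (suc k ℕ.* suc k) 2 2)))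

open import Data.Nat using (ℕ; zero; suc; _≤_; _<_; _+_; _*_; _/_; _%_)
open import Data.Product using (Σ; _×_; _,_)
open import Relation.Binary.PropositionalEquality using (_≡_; refl)
open Triangles using (class-map-bijective; oblong-even-even; oblong-even-odd; oblong-odd; square-even; square-odd; flat-count)

theorem1p1 : ∀ (w₁ w₂ : ℕ) → w₁ ≤ w₂ →
    ClassMapBijective w₁ w₂
    × (0 < w₁ → w₁ < w₂ → w₁ % 2 ≡ 0 → w₂ % 2 ≡ 0 →
    Σ ℕ λ N → ClassCount w₁ w₂ N × 2 * N ≡ w₁ * w₁ + 4)
    × (0 < w₁ → w₁ < w₂ → w₁ % 2 ≡ 0 → w₂ % 2 ≡ 1 →
    Σ ℕ λ N → ClassCount w₁ w₂ N × 2 * N ≡ w₁ * w₁ + 2)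
    × (0 < w₁ → w₁ < w₂ → w₁ % 2 ≡ 1 →
    Σ ℕ λ N → ClassCount w₁ w₂ N × 2 * N ≡ w₁ * w₁ + 1)
    × (0 < w₁ → w₁ ≡ w₂ → w₁ % 2 ≡ 0 →
    Σ ℕ λ N → ClassCount w₁ w₂ N × 4 * N ≡ w₁ * w₁ + 2 * w₁ + 4)
    × (0 < w₁ → w₁ ≡ w₂ → w₁ % 2 ≡ 1 →
    Σ ℕ λ N → ClassCount w₁ w₂ N × 4 * N ≡ w₁ * w₁ + 2 * w₁ + 1)
    × (w₁ ≡ 0 → ClassCount 0 w₂ (w₂ / 2 + 1))
theorem1p1 zero w₂ w₁≤w₂ =
  class-map-bijective w₁≤w₂ , (λ ()) , (λ ()) , (λ ()) , (λ ()) , (λ ()) , λ _ → flat-count w₂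
theorem1p1 (suc k) w₂ w₁≤w₂ =
  class-map-bijective w₁≤w₂ ,
  (λ _ → oblong-even-even k w₂) , (λ _ → oblong-even-odd k w₂) , (λ _ → oblong-odd k w₂) ,
  (λ { _ refl → square-even k }) , (λ { _ refl → square-odd k }) , λ ()
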